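{- Over ETCS, the following are equivalent: (i) replacement of contexts; (ii) collection of sets; (iii) full structural separation together with collection of sets and collection of functions.
   Context: **Language of categories.** A dependently typed first-order language: a type of objects, types $X\to Y$ of arrows, identities, composition, a terminal object term $1$; the only atomic formulas are equalities of parallel arrows (no equality of objects); connectives and quantifiers over objects and arrows (not over an object variable occurring in the type of a free arrow variable). Formulas in schemas may contain parameters from a context $\Gamma$, universally quantified outside each instance. **ETCS** (Lawvere's Elementary Theory of the Category of Sets): the theory of a well-pointed elementary topos $\mathbf{Set}$ with a natural numbers object, satisfying full classical logic ($\varphi\vee\neg\varphi$ for all formulas) and the axiom of choice (every epimorphism splits). Well-pointed means: $1$ is a generator (if $f,g\colon X\to Y$ satisfy $fx=gx$ for all $x\colon1\to X$ then $f=g$) and there is no map $1\to0$. An element of $X$ is an arrow $1\to X$; a subset of $X$ is a mono $S\to X$; $x\in S$ means $x$ factors through $S$; pullback of an object or arrow of a slice along $p$ is denoted $p^*$. **Full separation**: for any formula $\varphi(x)$ and any $X$, there is a subset $S$ of $X$ such that for every element $x$ of $X$, $x\in S$ iff $\varphi(x)$. **Collection of sets**: for any formula $\varphi(u,X)$ with $u$ an element variable of $U$ and $X$ an object variable, if for every $u$ there is an object $X$ with $\varphi(u,X)$, then there are a regular epi $p\colon V\to U$ and $A\in\mathbf{Set}/V$ with $\varphi(pv,v^*A)$ for every element $v$ of $V$. **Collection of functions**: for any formula $\varphi(u,X,Y,f\colon X\to Y)$ and any $A,B$ in $\mathbf{Set}/U$, if for every $u$ there is $f\colon u^*A\to u^*B$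 with $\varphi(u,u^*A,u^*B,f)$, then there are a regular epi $p\colon V\to U$ and $g\colon p^*A\to p^*B$ in $\mathbf{Set}/V$ with $\varphi(pv,(pv)^*A,(pv)^*B,v^*g)$ for every element $v$ of $V$. **Replacement of contexts.** Let $\Theta$ be a finite list of object and arrow variables extending the context $(\Gamma,U,u\colon1\to U)$. An isomorphism between two instantiations of $\Theta$ (over the same $\Gamma,U,u$) is a family of isomorphisms, one for each object variable of $\Theta$, commuting with all arrows of $\Theta$ (taken to be identities on objects not in $\Theta$). The schema says: for any formula $\varphi(U,u,\Theta)$ and any $U$, if for every element $u$ of $U$ there is an instantiation of $\Theta$ extending $(U,u)$ with $\varphi(U,u,\Theta)$, unique up to a unique isomorphism, then there is an instantiation $\Theta'$ of $\Theta$ in $\mathbf{Set}/U$ extending $(U^*U,\Delta_U)$ (parameters pulled back to $\mathbf{Set}/U$, $U$ interpreted as $U^*U=U\times U$, $u$ as the diagonal $\Delta_U\colon1_U\to U^*U$) such that $\varphi(U,u,u^*\Theta')$ for all elements $u$ of $U$. -}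

module Defs where

open import Level using (Level; suc)
open import Data.Empty.Polymorphic using (⊥)
open import Data.Unit.Polymorphic using (⊤)
open import Data.Product using (Σ; Σ-syntax; _×_; _,_)
open import Data.Sum using (_⊎_)
open import Function.Bundles using (_⇔_)
open import Relation.Binary.Structures using (IsEquivalence)
open import Relation.Binary.PropositionalEquality using (_≡_; refl; subst₂)
open import Relation.Nullary using (¬_)

private variable
  ℓ : Level

-- Contexts are telescopes of declarations of object variables (ob) and of
-- arrow variables (S ⇒ T).  An object term is a variable or the constant 1.
data Ctx : Set
data ObVar : Ctx → Set
data Ob (Γ : Ctx) : Set
data Decl (Γ : Ctx) : Set

infixl 5 _▹_
infix  6 _⇒_

data Ctx where
  ∅   : Ctx
  _▹_ : (Γ : Ctx) → Decl Γ → Ctx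

data Decl Γ where
  ob  : Decl Γ
  _⇒_ : Ob Γ → Ob Γ → Decl Γ

data Ob Γ where
  one : Ob Γ
  var : ObVar Γ → Ob Γ

data ObVar where
  here  : ∀ {Γ} → ObVar (Γ ▹ ob)
  there : ∀ {Γ d} → ObVar Γ → ObVar (Γ ▹ d)

wk : ∀ {Γ d} → Ob Γ → Ob (Γ ▹ d)
wk one     = one
wk (var v) = var (there v)

data ArVar : (Γ : Ctx) → Ob Γ → Ob Γ → Set where
  here  : ∀ {Γ S T} → ArVar (Γ ▹ S ⇒ T) (wk S) (wk T)
  there : ∀ {Γ d S T} → ArVar Γ S T → ArVar (Γ ▹ d) (wk S) (wk T)

data Ar (Γ : Ctx) : Ob Γ → Ob Γ → Set where
  var  : ∀ {S T} → ArVar Γ S T → Ar Γ S T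
  idᵃ  : ∀ {T} → Ar Γ T T
  _∘ᵃ_ : ∀ {R S T} → Ar Γ S T → Ar Γ R S → Ar Γ R T

-- A bound object variable is the last declaration of its scope, so it never
-- occurs in the type of a free arrow variable.
data Formula (Γ : Ctx) : Set where
  _≐_         : ∀ {S T} → Ar Γ S T → Ar Γ S T → Formula Γ
  ⊤ᶠ ⊥ᶠ       : Formula Γ
  _∧_ _∨_ _⊃_ : Formula Γ → Formula Γ → Formula Γ
  all ex      : (d : Decl Γ) → Formula (Γ ▹ d) → Formula Γ

-- Tel Γ Δ: a finite list of declarations extending Γ to Δ.
infixl 5 _▸_

data Tel (Γ : Ctx) : Ctx → Set where
  []  : Tel Γ Γ
  _▸_ : ∀ {Δ} → Tel Γ Δ → (d : Decl Δ) → Tel Γ (Δ ▹ d)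

-- Hom-types carry an equivalence relation, which interprets equality of
-- parallel arrows; equality of objects is never used.
record Category (ℓ : Level) : Set (suc ℓ) where
  infix  4 _≈_
  infixr 9 _∘_
  field
    Obj  : Set ℓ
    Hom  : Obj → Obj → Set ℓ
    _≈_  : ∀ {A B} → Hom A B → Hom A B → Set ℓ
    id   : ∀ {A} → Hom A A
    _∘_  : ∀ {A B C} → Hom B C → Hom A B → Hom A C
    equiv     : ∀ {A B} → IsEquivalence (_≈_ {A} {B})
    ∘-cong    : ∀ {A B C} {f f′ : Hom B C} {g g′ : Hom A B} →
                f ≈ f′ → g ≈ g′ → f ∘ g ≈ f′ ∘ g′
    identityˡ : ∀ {A B} {f : Hom A B} → id ∘ f ≈ f
    identityʳ : ∀ {A B} {f : Hom A B} → f ∘ id ≈ f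
    assoc     : ∀ {A B C D} {f : Hom C D} {g : Hom B C} {h : Hom A B} →
                (f ∘ g) ∘ h ≈ f ∘ (g ∘ h)

  module _ {A B : Obj} where
    open IsEquivalence (equiv {A} {B}) public
      renaming (refl to ≈-refl; sym to ≈-sym; trans to ≈-trans)
      hiding (reflexive; isPartialEquivalence)

  ∘-congˡ : ∀ {A B C} {f : Hom B C} {g g′ : Hom A B} → g ≈ g′ → f ∘ g ≈ f ∘ g′
  ∘-congˡ = ∘-cong ≈-refl

  ∘-congʳ : ∀ {A B C} {f f′ : Hom B C} {g : Hom A B} → f ≈ f′ → f ∘ g ≈ f′ ∘ g
  ∘-congʳ p = ∘-cong p ≈-refl

module Notions (C : Category ℓ) where
  open Category C

  record IsTerminal (T : Obj) : Set ℓ where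
    field
      !        : ∀ {A} → Hom A T
      !-unique : ∀ {A} (f g : Hom A T) → f ≈ g

  record IsInitial (Z : Obj) : Set ℓ where
    field
      ¡        : ∀ {A} → Hom Z A
      ¡-unique : ∀ {A} (f g : Hom Z A) → f ≈ g

  Mono : ∀ {A B} → Hom A B → Set ℓ
  Mono {A} m = ∀ {W} (f g : Hom W A) → m ∘ f ≈ m ∘ g → f ≈ g

  Epi : ∀ {A B} → Hom A B → Set ℓ
  Epi {A} {B} e = ∀ {W} (f g : Hom B W) → f ∘ e ≈ g ∘ e → f ≈ g

  record IsCoequalizer {W A B} (f g : Hom W A) (q : Hom A B) : Set ℓ where
    field
      commutes  : q ∘ f ≈ q ∘ g
      universal : ∀ {Z} (h : Hom A Z) → h ∘ f ≈ h ∘ g → Hom B Z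
      factors   : ∀ {Z} {h : Hom A Z} (eq : h ∘ f ≈ h ∘ g) → universal h eq ∘ q ≈ h
      unique    : ∀ {Z} {h : Hom A Z} (eq : h ∘ f ≈ h ∘ g) {k : Hom B Z} →
                  k ∘ q ≈ h → k ≈ universal h eq

  RegularEpi : ∀ {A B} → Hom A B → Set ℓ
  RegularEpi {A} q = Σ[ W ∈ Obj ] Σ[ f ∈ Hom W A ] Σ[ g ∈ Hom W A ] IsCoequalizer f g q

  record _≅_ (A B : Obj) : Set ℓ where
    field
      to      : Hom A B
      from    : Hom B A
      to∘from : to ∘ from ≈ id
      from∘to : from ∘ to ≈ id

  ≅-refl : ∀ {A} → A ≅ A
  ≅-refl = record { to = id ; from = id ; to∘from = identityˡ ; from∘to = identityˡ }

  record IsProduct {A B P} (π₁ : Hom P A) (π₂ : Hom P B) : Set ℓ where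
    field
      ⟨_,_⟩  : ∀ {W} → Hom W A → Hom W B → Hom W P
      π₁-⟨⟩  : ∀ {W} {f : Hom W A} {g : Hom W B} → π₁ ∘ ⟨ f , g ⟩ ≈ f
      π₂-⟨⟩  : ∀ {W} {f : Hom W A} {g : Hom W B} → π₂ ∘ ⟨ f , g ⟩ ≈ g
      unique : ∀ {W} {h k : Hom W P} → π₁ ∘ h ≈ π₁ ∘ k → π₂ ∘ h ≈ π₂ ∘ k → h ≈ k

  record Product (A B : Obj) : Set ℓ where
    field
      {P}       : Obj
      π₁        : Hom P A
      π₂        : Hom P B
      isProduct : IsProduct π₁ π₂
    open IsProduct isProduct public

  record IsPullback {A B D P} (f : Hom A D) (g : Hom B D)
                    (p₁ : Hom P A) (p₂ : Hom P B) : Set ℓ where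
    field
      commutes : f ∘ p₁ ≈ g ∘ p₂
      universal : ∀ {W} (h : Hom W A) (k : Hom W B) → f ∘ h ≈ g ∘ k → Hom W P
      p₁-universal : ∀ {W} {h : Hom W A} {k : Hom W B} (eq : f ∘ h ≈ g ∘ k) →
                     p₁ ∘ universal h k eq ≈ h
      p₂-universal : ∀ {W} {h : Hom W A} {k : Hom W B} (eq : f ∘ h ≈ g ∘ k) →
                     p₂ ∘ universal h k eq ≈ k
      unique : ∀ {W} {h k : Hom W P} → p₁ ∘ h ≈ p₁ ∘ k → p₂ ∘ h ≈ p₂ ∘ k → h ≈ k

  record Pullback {A B D} (f : Hom A D) (g : Hom B D) : Set ℓ where
    field
      {P}        : Obj
      p₁         : Hom P A
      p₂         : Hom P B
      isPullback : IsPullback f g p₁ p₂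
    open IsPullback isPullback public

  record Exponential (product : ∀ A B → Product A B) (A B : Obj) : Set ℓ where
    open module × {X Y} = Product (product X Y) using (π₁; π₂; ⟨_,_⟩)
    field
      B^A    : Obj
      eval   : Hom (Product.P (product B^A A)) B
      curry  : ∀ {X} → Hom (Product.P (product X A)) B → Hom X B^A
      β      : ∀ {X} {f : Hom (Product.P (product X A)) B} →
               eval ∘ ⟨ curry f ∘ π₁ , π₂ ⟩ ≈ f
      unique : ∀ {X} {f : Hom (Product.P (product X A)) B} {h : Hom X B^A} →
               eval ∘ ⟨ h ∘ π₁ , π₂ ⟩ ≈ f → h ≈ curry f

  record SubobjectClassifier {𝟙} (terminal : IsTerminal 𝟙) : Set ℓ where
    open IsTerminal terminal
    field
      Ω        : Obj
      true     : Hom 𝟙 Ω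
      χ        : ∀ {S X} (m : Hom S X) → Mono m → Hom X Ω
      classify : ∀ {S X} {m : Hom S X} (mono : Mono m) → IsPullback true (χ m mono) ! m
      unique   : ∀ {S X} {m : Hom S X} (mono : Mono m) {c : Hom X Ω} →
                 IsPullback true c ! m → c ≈ χ m mono

  record NaturalNumbersObject (𝟙 : Obj) : Set ℓ where
    field
      N      : Obj
      zero   : Hom 𝟙 N
      succ   : Hom N N
      rec    : ∀ {X} → Hom 𝟙 X → Hom X X → Hom N X
      rec-z  : ∀ {X} {x : Hom 𝟙 X} {f : Hom X X} → rec x f ∘ zero ≈ x
      rec-s  : ∀ {X} {x : Hom 𝟙 X} {f : Hom X X} → rec x f ∘ succ ≈ f ∘ rec x f
      unique : ∀ {X} {x : Hom 𝟙 X} {f : Hom X X} {h : Hom N X} →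
               h ∘ zero ≈ x → h ∘ succ ≈ f ∘ h → h ≈ rec x f

module _ (C : Category ℓ) (U : Category.Obj C) where
  open Category C

  record SliceObj : Set ℓ where
    constructor _↓_
    field
      total : Obj
      arr   : Hom total U

  open SliceObj

  record SliceHom (X Y : SliceObj) : Set ℓ where
    constructor _∣_
    field
      map      : Hom (total X) (total Y)
      triangle : arr Y ∘ map ≈ arr X

  open SliceHom

  Slice : Category ℓ
  Slice = record
    { Obj = SliceObj
    ; Hom = SliceHom
    ; _≈_ = λ f g → map f ≈ map g
    ; id  = id ∣ identityʳ
    ; _∘_ = λ f g → (map f ∘ map g)
                  ∣ ≈-trans (≈-sym assoc) (≈-trans (∘-congʳ (triangle f)) (triangle g))
    ; equiv     = record { refl = ≈-refl ; sym = ≈-sym ; trans = ≈-trans }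
    ; ∘-cong    = ∘-cong
    ; identityˡ = identityˡ
    ; identityʳ = identityʳ
    ; assoc     = assoc
    }

  1/ : SliceObj
  1/ = U ↓ id

open SliceObj public
open SliceHom public

module Interpretation (C : Category ℓ) (𝟙 : Category.Obj C) where
  open Category C
  open Notions C using (_≅_; ≅-refl)
  open _≅_ using (to)

  infixl 5 _▷_

  data Env : Ctx → Set ℓ
  lookupOb : ∀ {Γ} → Env Γ → ObVar Γ → Obj
  ⟦_⟧ : ∀ {Γ} → Ob Γ → Env Γ → Obj
  ⟦_⟧ᵈ : ∀ {Γ} → Decl Γ → Env Γ → Set ℓ

  data Env where
    []  : Env ∅
    _▷_ : ∀ {Γ} {d : Decl Γ} (γ : Env Γ) → ⟦ d ⟧ᵈ γ → Env (Γ ▹ d)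

  ⟦ ob ⟧ᵈ    γ = Obj
  ⟦ S ⇒ T ⟧ᵈ γ = Hom (⟦ S ⟧ γ) (⟦ T ⟧ γ)

  lookupOb (γ ▷ X) here      = X
  lookupOb (γ ▷ _) (there v) = lookupOb γ v

  ⟦ one ⟧   γ = 𝟙
  ⟦ var v ⟧ γ = lookupOb γ v

  init : ∀ {Γ d} → Env (Γ ▹ d) → Env Γ
  init (γ ▷ _) = γ

  ⟦wk⟧ : ∀ {Γ d} (γ : Env (Γ ▹ d)) (T : Ob Γ) → ⟦ T ⟧ (init γ) ≡ ⟦ wk T ⟧ γ
  ⟦wk⟧ (γ ▷ x) one     = refl
  ⟦wk⟧ (γ ▷ x) (var v) = refl

  wkHom : ∀ {Γ d} (γ : Env (Γ ▹ d)) (S T : Ob Γ) →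
          Hom (⟦ S ⟧ (init γ)) (⟦ T ⟧ (init γ)) → Hom (⟦ wk S ⟧ γ) (⟦ wk T ⟧ γ)
  wkHom γ S T = subst₂ Hom (⟦wk⟧ γ S) (⟦wk⟧ γ T)

  lookupAr : ∀ {Γ S T} (γ : Env Γ) → ArVar Γ S T → Hom (⟦ S ⟧ γ) (⟦ T ⟧ γ)
  lookupAr δ@(γ ▷ f) (here {S = S} {T})      = wkHom δ S T f
  lookupAr δ@(γ ▷ _) (there {S = S} {T} v) = wkHom δ S T (lookupAr γ v)

  ⟦_⟧ᵃ : ∀ {Γ S T} → Ar Γ S T → (γ : Env Γ) → Hom (⟦ S ⟧ γ) (⟦ T ⟧ γ)
  ⟦ var v ⟧ᵃ γ = lookupAr γ v
  ⟦ idᵃ ⟧ᵃ   γ = id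
  ⟦ f ∘ᵃ g ⟧ᵃ γ = ⟦ f ⟧ᵃ γ ∘ ⟦ g ⟧ᵃ γ

  -- Tarskian truth; ∨ and ∃ are Agda's ⊎ and Σ.
  infix 4 _⊨_

  _⊨_ : ∀ {Γ} → Env Γ → Formula Γ → Set ℓ
  γ ⊨ f ≐ g   = ⟦ f ⟧ᵃ γ ≈ ⟦ g ⟧ᵃ γ
  γ ⊨ ⊤ᶠ      = ⊤
  γ ⊨ ⊥ᶠ      = ⊥
  γ ⊨ φ ∧ ψ   = (γ ⊨ φ) × (γ ⊨ ψ)
  γ ⊨ φ ∨ ψ   = (γ ⊨ φ) ⊎ (γ ⊨ ψ)
  γ ⊨ φ ⊃ ψ   = γ ⊨ φ → γ ⊨ ψ
  γ ⊨ all d φ = (x : ⟦ d ⟧ᵈ γ) → γ ▷ x ⊨ φ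
  γ ⊨ ex d φ  = Σ[ x ∈ ⟦ d ⟧ᵈ γ ] (γ ▷ x ⊨ φ)

  data Inst {Γ} (γ : Env Γ) : ∀ {Δ} → Tel Γ Δ → Set ℓ
  _⊕_ : ∀ {Γ Δ} {Θ : Tel Γ Δ} (γ : Env Γ) → Inst γ Θ → Env Δ

  data Inst γ where
    []  : Inst γ []
    _▷_ : ∀ {Δ} {Θ : Tel _ Δ} {d : Decl Δ} (i : Inst γ Θ) → ⟦ d ⟧ᵈ (γ ⊕ i) → Inst γ (Θ ▸ d)

  γ ⊕ []      = γ
  γ ⊕ (i ▷ x) = (γ ⊕ i) ▷ x

  infix 4 _≅ᵢ_

  data _≅ᵢ_ {Γ} {γ : Env Γ} : ∀ {Δ} {Θ : Tel Γ Δ} (i j : Inst γ Θ) → Set ℓ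
  componentᵛ : ∀ {Γ Δ} {γ : Env Γ} {Θ : Tel Γ Δ} {i j : Inst γ Θ} → i ≅ᵢ j →
               (v : ObVar Δ) → lookupOb (γ ⊕ i) v ≅ lookupOb (γ ⊕ j) v
  component : ∀ {Γ Δ} {γ : Env Γ} {Θ : Tel Γ Δ} {i j : Inst γ Θ} → i ≅ᵢ j →
              (T : Ob Δ) → ⟦ T ⟧ (γ ⊕ i) ≅ ⟦ T ⟧ (γ ⊕ j)

  data _≅ᵢ_ {Γ} {γ} where
    []  : [] ≅ᵢ []
    _▸ob_ : ∀ {Δ} {Θ : Tel Γ Δ} {i j : Inst γ Θ} {X Y : Obj} →
            i ≅ᵢ j → X ≅ Y → _≅ᵢ_ {Θ = Θ ▸ ob} (i ▷ X) (j ▷ Y)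
    _▸ar_ : ∀ {Δ} {Θ : Tel Γ Δ} {S T : Ob Δ} {i j : Inst γ Θ}
            {f : ⟦ S ⇒ T ⟧ᵈ (γ ⊕ i)} {g : ⟦ S ⇒ T ⟧ᵈ (γ ⊕ j)} (α : i ≅ᵢ j) →
            to (component α T) ∘ f ≈ g ∘ to (component α S) →
            _≅ᵢ_ {Θ = Θ ▸ S ⇒ T} (i ▷ f) (j ▷ g)

  componentᵛ []       v         = ≅-refl
  componentᵛ (α ▸ob x) here      = x
  componentᵛ (α ▸ob x) (there v) = componentᵛ α v
  componentᵛ (α ▸ar e) (there v) = componentᵛ α v

  component α one     = ≅-refl
  component α (var v) = componentᵛ α v

  infix 4 _≈ᵢ_

  _≈ᵢ_ : ∀ {Γ Δ} {γ : Env Γ} {Θ : Tel Γ Δ} {i j : Inst γ Θ} (α β : i ≅ᵢ j) → Set ℓ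
  _≈ᵢ_ {Δ = Δ} α β = (v : ObVar Δ) → to (componentᵛ α v) ≈ to (componentᵛ β v)

record ETCS (C : Category ℓ) : Set ℓ where
  open Category C
  open Notions C
  field
    𝟙        : Obj
    terminal : IsTerminal 𝟙
    product  : ∀ A B → Product A B
    pullback : ∀ {A B D} (f : Hom A D) (g : Hom B D) → Pullback f g
    exponential : ∀ A B → Exponential product A B
    classifier  : SubobjectClassifier terminal
    nno         : NaturalNumbersObject 𝟙

    generator : ∀ {X Y} (f g : Hom X Y) → (∀ (x : Hom 𝟙 X) → f ∘ x ≈ g ∘ x) → f ≈ g
    no-1→0    : ∀ {Z} → IsInitial Z → ¬ Hom 𝟙 Z

  open Interpretation C 𝟙
  field
    excluded-middle : ∀ {Γ} (φ : Formula Γ) (γ : Env Γ) → (γ ⊨ φ) ⊎ ¬ (γ ⊨ φ)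
    choice : ∀ {A B} (e : Hom A B) → Epi e → Σ[ s ∈ Hom B A ] e ∘ s ≈ id

module Reindexing {C : Category ℓ} (E : ETCS C) where
  open Category C
  open Notions C
  open ETCS E
  open IsTerminal terminal
  open Interpretation C 𝟙

  _^*_ : ∀ {V U} → Hom V U → SliceObj C U → SliceObj C V
  p ^* (A ↓ a) = Pullback.P (pullback p a) ↓ Pullback.p₁ (pullback p a)

  -- Z is (the underlying object of) a pullback of X along u : 1 → U.
  record Fibre {U} (u : Hom 𝟙 U) (X : SliceObj C U) (Z : Obj) : Set ℓ where
    field
      incl       : Hom Z (total X)
      isPullback : IsPullback u (arr X) ! incl
    open IsPullback isPullback public

  fibre : ∀ {U} (u : Hom 𝟙 U) (X : SliceObj C U) → Fibre u X (total (u ^* X))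
  fibre u (A ↓ a) = record
    { incl = p₂
    ; isPullback = record
      { commutes     = ≈-trans (∘-congˡ (!-unique _ _)) commutes
      ; universal    = universal
      ; p₁-universal = λ _ → !-unique _ _
      ; p₂-universal = p₂-universal
      ; unique       = λ _ → unique (!-unique _ _)
      }
    }
    where open Pullback (pullback u a)

  -- u^*f, for any choice of the pullbacks u^*X and u^*Y
  fibreMap : ∀ {U} {u : Hom 𝟙 U} {X Y : SliceObj C U} {Z W : Obj} →
             Fibre u X Z → Fibre u Y W → SliceHom C U X Y → Hom Z W
  fibreMap {u = u} {X} {Y} F G f =
    G.universal ! (map f ∘ F.incl)
      (≈-trans F.commutes
        (≈-trans (∘-congʳ (≈-sym (triangle f))) assoc))
    where module F = Fibre F
          module G = Fibre G

  -- (pv)^*A is a pullback of p^*A along v.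
  fibre-∘ : ∀ {V U} (p : Hom V U) (v : Hom 𝟙 V) (A : SliceObj C U) →
            Fibre v (p ^* A) (total ((p ∘ v) ^* A))
  fibre-∘ p v A = record
    { incl = incl
    ; isPullback = record
      { commutes     = ≈-sym (Q.p₁-universal square)
      ; universal    = λ h k eq → F.universal ! (Q.p₂ ∘ k) (square′ eq)
      ; p₁-universal = λ _ → !-unique _ _
      ; p₂-universal = λ {_} {h} {k} eq → Q.unique
          (≈-trans (≈-sym assoc)
            (≈-trans (∘-congʳ (Q.p₁-universal square))
              (≈-trans assoc (≈-trans (∘-congˡ (!-unique _ _)) eq))))
          (≈-trans (≈-sym assoc)
            (≈-trans (∘-congʳ (Q.p₂-universal square)) (F.p₂-universal (square′ eq))))
      ; unique       = λ {_} {h} {k} _ e → F.unique (!-unique _ _)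
          (≈-trans (∘-congʳ (≈-sym (Q.p₂-universal square)))
            (≈-trans assoc
              (≈-trans (∘-congˡ e)
                (≈-trans (≈-sym assoc) (∘-congʳ (Q.p₂-universal square))))))
      }
    }
    where
    module Q = Pullback (pullback p (arr A))
    module F = Fibre (fibre (p ∘ v) A)
    square : p ∘ (v ∘ !) ≈ arr A ∘ F.incl
    square = ≈-trans (≈-sym assoc) F.commutes
    incl = Q.universal (v ∘ !) F.incl square
    square′ : ∀ {W} {h : Hom W 𝟙} {k : Hom W Q.P} → v ∘ h ≈ Q.p₁ ∘ k →
              (p ∘ v) ∘ ! ≈ arr A ∘ (Q.p₂ ∘ k)
    square′ eq =
      ≈-trans assoc
        (≈-trans (∘-congˡ (≈-trans (∘-congˡ (!-unique _ _)) eq))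
          (≈-trans (≈-sym assoc) (≈-trans (∘-congʳ Q.commutes) assoc)))

  module _ (U : Obj) where
    private module Sl = Interpretation (Slice C U) (1/ C U)

    -- X is (isomorphic to) U^*Z = (U × Z → U).
    record Constant (X : SliceObj C U) (Z : Obj) : Set ℓ where
      field
        proj      : Hom (total X) Z
        isProduct : IsProduct (arr X) proj
      open IsProduct isProduct public

    constantMap : ∀ {X Y Z W} → Constant X Z → Constant Y W → Hom Z W → SliceHom C U X Y
    constantMap {X} K L f = L.⟨ arr X , f ∘ K.proj ⟩ ∣ L.π₁-⟨⟩
      where module K = Constant K
            module L = Constant L

    constant-𝟙 : Constant (1/ C U) 𝟙
    constant-𝟙 = record
      { proj = !
      ; isProduct = record
        { ⟨_,_⟩  = λ f _ → f
        ; π₁-⟨⟩  = identityˡ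
        ; π₂-⟨⟩  = !-unique _ _
        ; unique = λ e _ → ≈-trans (≈-sym identityˡ) (≈-trans e identityˡ)
        }
      }

    fibre-constant : ∀ {X Z} (u : Hom 𝟙 U) → Constant X Z → Fibre u X Z
    fibre-constant {X} {Z} u K = record
      { incl = K.⟨ u ∘ ! , id ⟩
      ; isPullback = record
        { commutes     = ≈-sym K.π₁-⟨⟩
        ; universal    = λ _ k _ → K.proj ∘ k
        ; p₁-universal = λ _ → !-unique _ _
        ; p₂-universal = λ eq → K.unique
            (≈-trans (≈-sym assoc)
              (≈-trans (∘-congʳ K.π₁-⟨⟩)
                (≈-trans assoc (≈-trans (∘-congˡ (!-unique _ _)) eq))))
            (≈-trans (≈-sym assoc) (≈-trans (∘-congʳ K.π₂-⟨⟩) identityˡ))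
        ; unique       = λ _ e →
            ≈-trans (≈-sym (retract _)) (≈-trans (∘-congˡ e) (retract _))
        }
      }
      where
      module K = Constant K
      retract : ∀ {W} (h : Hom W Z) → K.proj ∘ (K.⟨ u ∘ ! , id ⟩ ∘ h) ≈ h
      retract h = ≈-trans (≈-sym assoc) (≈-trans (∘-congʳ K.π₂-⟨⟩) identityˡ)

    -- U^*γ, with the constant 1 going to 1_U rather than to U × 1
    pull : ∀ {Γ} → Env Γ → Sl.Env Γ
    constantᵛ : ∀ {Γ} (γ : Env Γ) (v : ObVar Γ) →
                Constant (Sl.lookupOb (pull γ) v) (lookupOb γ v)
    constant : ∀ {Γ} (γ : Env Γ) (T : Ob Γ) → Constant (Sl.⟦ T ⟧ (pull γ)) (⟦ T ⟧ γ)

    pull []                      = Sl.[]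
    pull (_▷_ {d = ob} γ X)      = pull γ Sl.▷ (Product.P (product U X) ↓ Product.π₁ (product U X))
    pull (_▷_ {d = Q ⇒ T} γ f)   = pull γ Sl.▷ constantMap (constant γ Q) (constant γ T) f

    constantᵛ (_▷_ {d = ob} γ X) here =
      record { proj = Product.π₂ (product U X) ; isProduct = Product.isProduct (product U X) }
    constantᵛ (_▷_ {d = ob} γ X) (there v)    = constantᵛ γ v
    constantᵛ (_▷_ {d = Q ⇒ T} γ f) (there v) = constantᵛ γ v

    constant γ one     = constant-𝟙
    constant γ (var v) = constantᵛ γ v

  module _ {Γ} (γ : Env Γ) (U : ObVar Γ) where
    private
      U₀ = lookupOb γ U
      module Sl = Interpretation (Slice C U₀) (1/ C U₀)

    diagonal : SliceHom C U₀ (1/ C U₀) (Sl.lookupOb (pull U₀ γ) U)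
    diagonal = ⟨ id , id ⟩ ∣ π₁-⟨⟩
      where open Constant (constantᵛ U₀ γ U)

    -- The environment (U^*γ , Δ_U) for (Γ , u : 1 → U) in the slice over U
    generic : Sl.Env (Γ ▹ one ⇒ var U)
    generic = pull U₀ γ Sl.▷ diagonal

    -- u^*Θ′, together with the maps exhibiting each of its objects as a fibre.
    -- On objects not in Θ these are the canonical maps Z → U × Z and u : 1 → U.
    fibreInst : ∀ {Δ} {Θ : Tel (Γ ▹ one ⇒ var U) Δ} (u : Hom 𝟙 U₀) →
                Sl.Inst generic Θ → Inst (γ ▷ u) Θ
    fibreOfᵛ : ∀ {Δ} {Θ : Tel (Γ ▹ one ⇒ var U) Δ} (u : Hom 𝟙 U₀)
               (i : Sl.Inst generic Θ) (v : ObVar Δ) →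
               Fibre u (Sl.lookupOb (generic Sl.⊕ i) v) (lookupOb ((γ ▷ u) ⊕ fibreInst u i) v)
    fibreOf : ∀ {Δ} {Θ : Tel (Γ ▹ one ⇒ var U) Δ} (u : Hom 𝟙 U₀)
              (i : Sl.Inst generic Θ) (T : Ob Δ) →
              Fibre u (Sl.⟦ T ⟧ (generic Sl.⊕ i)) (⟦ T ⟧ ((γ ▷ u) ⊕ fibreInst u i))

    fibreInst u Sl.[]                    = []
    fibreInst u (Sl._▷_ {d = ob} i X)    = fibreInst u i ▷ total (u ^* X)
    fibreInst u (Sl._▷_ {d = S ⇒ T} i f) =
      fibreInst u i ▷ fibreMap (fibreOf u i S) (fibreOf u i T) f

    fibreOfᵛ u Sl.[] (there v)                    = fibre-constant U₀ u (constantᵛ U₀ γ v)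
    fibreOfᵛ u (Sl._▷_ {d = ob} i X) here         = fibre u X
    fibreOfᵛ u (Sl._▷_ {d = ob} i X) (there v)    = fibreOfᵛ u i v
    fibreOfᵛ u (Sl._▷_ {d = S ⇒ T} i f) (there v) = fibreOfᵛ u i v

    fibreOf u i one     = fibre-constant U₀ u (constant-𝟙 U₀)
    fibreOf u i (var v) = fibreOfᵛ u i v

-- In each schema the set over which the formula varies is an object variable of
-- the parameter context Γ, so that parameters may have it as domain or codomain.
module Schemas {C : Category ℓ} (E : ETCS C) where
  open Category C
  open Notions C
  open ETCS E
  open Interpretation C 𝟙
  open Reindexing E

  _∈_ : ∀ {X S} → Hom 𝟙 X → Hom S X → Set ℓ
  _∈_ {S = S} x m = Σ[ y ∈ Hom 𝟙 S ] m ∘ y ≈ x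

  FullSeparation : Set ℓ
  FullSeparation =
    ∀ {Γ} (X : ObVar Γ) (φ : Formula (Γ ▹ one ⇒ var X)) (γ : Env Γ) →
    Σ[ S ∈ Obj ] Σ[ m ∈ Hom S (lookupOb γ X) ] Mono m ×
      (∀ (x : Hom 𝟙 (lookupOb γ X)) → x ∈ m ⇔ (γ ▷ x ⊨ φ))

  CollectionOfSets : Set ℓ
  CollectionOfSets =
    ∀ {Γ} (U : ObVar Γ) (φ : Formula (Γ ▹ one ⇒ var U ▹ ob)) (γ : Env Γ) →
    let U₀ = lookupOb γ U in
    (∀ (u : Hom 𝟙 U₀) → Σ[ X ∈ Obj ] (γ ▷ u ▷ X ⊨ φ)) →
    Σ[ V ∈ Obj ] Σ[ p ∈ Hom V U₀ ] RegularEpi p ×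
      (Σ[ A ∈ SliceObj C V ] ∀ (v : Hom 𝟙 V) → γ ▷ p ∘ v ▷ total (v ^* A) ⊨ φ)

  CollectionOfFunctions : Set ℓ
  CollectionOfFunctions =
    ∀ {Γ} (U : ObVar Γ)
    (φ : Formula (Γ ▹ one ⇒ var U ▹ ob ▹ ob ▹ var (there here) ⇒ var here))
    (γ : Env Γ) →
    let U₀ = lookupOb γ U in
    (A B : SliceObj C U₀) →
    (∀ (u : Hom 𝟙 U₀) → Σ[ f ∈ Hom (total (u ^* A)) (total (u ^* B)) ]
       (γ ▷ u ▷ total (u ^* A) ▷ total (u ^* B) ▷ f ⊨ φ)) →
    Σ[ V ∈ Obj ] Σ[ p ∈ Hom V U₀ ] RegularEpi p ×
      (Σ[ g ∈ SliceHom C V (p ^* A) (p ^* B) ] ∀ (v : Hom 𝟙 V) →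
         γ ▷ p ∘ v ▷ total ((p ∘ v) ^* A) ▷ total ((p ∘ v) ^* B)
           ▷ fibreMap (fibre-∘ p v A) (fibre-∘ p v B) g ⊨ φ)

  ReplacementOfContexts : Set ℓ
  ReplacementOfContexts =
    ∀ {Γ Δ} (U : ObVar Γ) (Θ : Tel (Γ ▹ one ⇒ var U) Δ) (φ : Formula Δ) (γ : Env Γ) →
    let U₀ = lookupOb γ U
        module Sl = Interpretation (Slice C U₀) (1/ C U₀)
    in
    (∀ (u : Hom 𝟙 U₀) →
       (Σ[ i ∈ Inst (γ ▷ u) Θ ] ((γ ▷ u) ⊕ i ⊨ φ)) ×
       (∀ (i j : Inst (γ ▷ u) Θ) → (γ ▷ u) ⊕ i ⊨ φ → (γ ▷ u) ⊕ j ⊨ φ →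
          Σ[ α ∈ i ≅ᵢ j ] (∀ (β : i ≅ᵢ j) → α ≈ᵢ β))) →
    Σ[ Θ′ ∈ Sl.Inst (generic γ U) Θ ]
      (∀ (u : Hom 𝟙 U₀) → (γ ▷ u) ⊕ fibreInst γ U u Θ′ ⊨ φ)

{-# OPTIONS --safe #-}

-- Truth is invariant under isomorphism of environments, and by choice every cover
-- splits, so collection provides a family over U itself.  Applied to "X is a singleton
-- if φ u holds, and empty otherwise", collection gives full separation; so does
-- replacement, such an X being unique up to unique isomorphism.
--
-- Collection implies replacement: Θ is instantiated one declaration at a time.  That a
-- formula depends on slice objects already found is eliminated by quantifying over
-- fibres of their total objects.  An object is then found by collection; an arrow is
-- coded by an element of a power object, and found by separation and choice.
-- Collection of functions is the case of a single arrow.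
--
-- Replacement implies collection: among the well-orders on whose carrier φ u holds, one
-- of which no proper initial segment satisfies φ u is unique up to unique isomorphism.
-- It exists by Zermelo's theorem; two such well-orders are compared through the largest
-- bisimulation between them.
module Submission where

open import Level using (Level)
open import Data.Empty using () renaming (⊥-elim to ⊥-elim₀)
open import Data.Empty.Polymorphic using (⊥)
open import Data.Nat using (ℕ; zero; suc; _∸_)
open import Data.Product using (Σ; Σ-syntax; _×_; _,_; proj₁; proj₂)
open import Data.Sum using (_⊎_; inj₁; inj₂; [_,_]′)
open import Function.Bundles using (_⇔_; mk⇔; Equivalence)
open import Defs

private variable
  ℓ : Level

-- Excluded middle and the schemas speak of formulas only. So a case distinction, a subset, or a
-- property used in an induction has to be written as a formula of the language; the raw syntax
-- keeps these short, and their truth unfolds to the intended proposition. The obstacle to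
-- replacement is that a schema takes its parameters in Set, whereas a partial instantiation of `Θ`
-- lives in the slice over `U`. Its total objects are legitimate parameters, but the language has no
-- term for a fibre of them, and a fibre is determined only up to isomorphism; hence the need for
-- invariance of truth. The obstacle to collection is uniqueness: `φ u` may hold of many
-- non-isomorphic objects, each with many automorphisms. A well-order has no automorphism but the
-- identity, and minimality leaves a single isomorphism type. The largest bisimulation is defined by
-- one formula that quantifies over objects, and takes the place of transfinite recursion along the
-- orders.

-- Renamings between contexts

mapOb : ∀ {Γ B} → (ObVar Γ → ObVar B) → Ob Γ → Ob B
mapOb r one     = one
mapOb r (var v) = var (r v)

record Ren (Γ B : Ctx) : Set where
  field
    onOb : ObVar Γ → ObVar B
    onAr : ∀ {S T} → ArVar Γ S T → ArVar B (mapOb onOb S) (mapOb onOb T)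

  _·_ : Ob Γ → Ob B
  _·_ = mapOb onOb

open Ren using (onOb; onAr; _·_)

-- `wk (mapOb r S)` becomes the required object term only once `S` is known to be `one` or a
-- variable. This is why this function, and many proofs below, split into cases with the same
-- right-hand side.
thereᴿ : ∀ {Γ B d} (r : ObVar Γ → ObVar B) (S T : Ob Γ) →
         ArVar B (mapOb r S) (mapOb r T) →
         ArVar (B ▹ d) (mapOb (λ v → there (r v)) S) (mapOb (λ v → there (r v)) T)
thereᴿ r one     one     f = there f
thereᴿ r one     (var _) f = there f
thereᴿ r (var _) one     f = there f
thereᴿ r (var _) (var _) f = there f

hereᴿ : ∀ {Γ B} (r : ObVar Γ → ObVar B) (S T : Ob Γ) →
        ArVar (B ▹ mapOb r S ⇒ mapOb r T)
              (mapOb (λ v → there (r v)) S) (mapOb (λ v → there (r v)) T)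
hereᴿ r one     one     = here
hereᴿ r one     (var _) = here
hereᴿ r (var _) one     = here
hereᴿ r (var _) (var _) = here

idᴿ : ∀ {Γ} → Ren Γ Γ
idᴿ = record { onOb = λ v → v ; onAr = λ {S} {T} → idAr S T }
  where
  idAr : ∀ {Γ} (S T : Ob Γ) → ArVar Γ S T → ArVar Γ (mapOb (λ v → v) S) (mapOb (λ v → v) T)
  idAr one     one     f = f
  idAr one     (var _) f = f
  idAr (var _) one     f = f
  idAr (var _) (var _) f = f

↑ : ∀ {Γ B d} → Ren Γ B → Ren Γ (B ▹ d)
↑ ρ = record { onOb = λ v → there (onOb ρ v) ; onAr = λ {S} {T} f → thereᴿ (onOb ρ) S T (onAr ρ f) }

strengthen : ∀ {Γ B d} (r : ObVar (Γ ▹ d) → ObVar B) (S T : Ob Γ) →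
             ArVar B (mapOb (λ v → r (there v)) S) (mapOb (λ v → r (there v)) T) →
             ArVar B (mapOb r (wk S)) (mapOb r (wk T))
strengthen r one     one     f = f
strengthen r one     (var _) f = f
strengthen r (var _) one     f = f
strengthen r (var _) (var _) f = f

infixl 5 _,ob_ _,ar_

_,ob_ : ∀ {Γ B} → Ren Γ B → ObVar B → Ren (Γ ▹ ob) B
_,ob_ {Γ} {B} ρ w = record { onOb = o ; onAr = a }
  where
  o : ObVar (Γ ▹ ob) → ObVar B
  o here      = w
  o (there v) = onOb ρ v
  a : ∀ {S T} → ArVar (Γ ▹ ob) S T → ArVar B (mapOb o S) (mapOb o T)
  a (there {S = S} {T} f) = strengthen o S T (onAr ρ f)

_,ar_ : ∀ {Γ B S T} (ρ : Ren Γ B) → ArVar B (ρ · S) (ρ · T) → Ren (Γ ▹ S ⇒ T) B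
_,ar_ {Γ} {B} {S} {T} ρ w = record { onOb = o ; onAr = a }
  where
  o : ObVar (Γ ▹ S ⇒ T) → ObVar B
  o (there v) = onOb ρ v
  a : ∀ {S′ T′} → ArVar (Γ ▹ S ⇒ T) S′ T′ → ArVar B (mapOb o S′) (mapOb o T′)
  a here                    = strengthen o S T w
  a (there {S = S′} {T′} f) = strengthen o S′ T′ (onAr ρ f)

renDecl : ∀ {Γ B} → Ren Γ B → Decl Γ → Decl B
renDecl ρ ob      = ob
renDecl ρ (S ⇒ T) = (ρ · S) ⇒ (ρ · T)

lift : ∀ {Γ B} (ρ : Ren Γ B) (d : Decl Γ) → Ren (Γ ▹ d) (B ▹ renDecl ρ d)
lift ρ ob      = ↑ ρ ,ob here
lift ρ (S ⇒ T) = ↑ ρ ,ar hereᴿ (onOb ρ) S T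

renAr : ∀ {Γ B S T} (ρ : Ren Γ B) → Ar Γ S T → Ar B (ρ · S) (ρ · T)
renAr ρ (var f)  = var (onAr ρ f)
renAr ρ idᵃ      = idᵃ
renAr ρ (f ∘ᵃ g) = renAr ρ f ∘ᵃ renAr ρ g

ren : ∀ {Γ B} → Ren Γ B → Formula Γ → Formula B
ren ρ (f ≐ g)   = renAr ρ f ≐ renAr ρ g
ren ρ ⊤ᶠ        = ⊤ᶠ
ren ρ ⊥ᶠ        = ⊥ᶠ
ren ρ (φ ∧ ψ)   = ren ρ φ ∧ ren ρ ψ
ren ρ (φ ∨ ψ)   = ren ρ φ ∨ ren ρ ψ
ren ρ (φ ⊃ ψ)   = ren ρ φ ⊃ ren ρ ψ
ren ρ (all d φ) = all (renDecl ρ d) (ren (lift ρ d) φ)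
ren ρ (ex d φ)  = ex (renDecl ρ d) (ren (lift ρ d) φ)

-- Raw formulas and their elaboration

-- Formulas with named variables: a binder passes to its body the level of the
-- variable it binds, counted from the start of the last n declarations of Γ.
-- Ill-typed equations elaborate to ⊥ᶠ.
infixr 9 _∙_
infix  7 _≐ʳ_
infixr 6 _∧ʳ_
infixr 5 _∨ʳ_
infixr 4 _⊃ʳ_

data RawAr : Set where
  $   : ℕ → RawAr
  _∙_ : RawAr → RawAr → RawAr

data Raw : Set where
  _≐ʳ_           : RawAr → RawAr → Raw
  ⊤ʳ ⊥ʳ          : Raw
  _∧ʳ_ _∨ʳ_ _⊃ʳ_ : Raw → Raw → Raw
  ∀ᵒ ∃ᵒ          : (ℕ → Raw) → Raw
  ∀ᵉ ∃ᵉ          : ℕ → (ℕ → Raw) → Raw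
  ∀ᵃ ∃ᵃ          : ℕ → ℕ → (ℕ → Raw) → Raw

¬ʳ : Raw → Raw
¬ʳ r = r ⊃ʳ ⊥ʳ

indexOb : ℕ → (Γ : Ctx) → Ob Γ
indexOb zero    (Γ ▹ ob) = var here
indexOb (suc i) (Γ ▹ d)  = wk (indexOb i Γ)
indexOb _       _        = one

-- The functions below are in continuation-passing style, with a default for
-- failure, so that a closed Raw elaborates to a formula free of redexes.
indexAr : ∀ {A : Set} → ℕ → (Γ : Ctx) → A → (∀ {S T} → ArVar Γ S T → A) → A
indexAr zero    (Γ ▹ S ⇒ T) d k = k here
indexAr (suc i) (Γ ▹ _)     d k = indexAr i Γ d λ f → k (there f)
indexAr _       _           d k = d

castVar : ∀ {A : Set} {Γ} (v w : ObVar Γ) (P : ObVar Γ → Set) → P v → A → (P w → A) → A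
castVar here      here      P p d k = k p
castVar (there v) (there w) P p d k = castVar v w (λ x → P (there x)) p d k
castVar _         _         P p d k = d

castOb : ∀ {A : Set} {Γ} (S T : Ob Γ) (P : Ob Γ → Set) → P S → A → (P T → A) → A
castOb one     one     P p d k = k p
castOb (var v) (var w) P p d k = castVar v w (λ x → P (var x)) p d k
castOb _       _       P p d k = d

depth : Ctx → ℕ
depth ∅       = 0
depth (Γ ▹ _) = suc (depth Γ)

-- Level 0 is the outermost of the last `n` declarations, whence the reversal to the de Bruijn index
-- `n ∸ suc i`.
level : ℕ → ℕ → (Γ : Ctx) → Ob Γ
level n i = indexOb (n ∸ suc i)

elabAr : ∀ {A : Set} → ℕ → (Γ : Ctx) → RawAr → A → (∀ {S T} → Ar Γ S T → A) → A
elabAr n Γ ($ i)   d k = indexAr (n ∸ suc i) Γ d λ f → k (var f)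
elabAr n Γ (g ∙ f) d k =
  elabAr n Γ g d λ {S} g′ → elabAr n Γ f d λ {Q} {R} f′ →
    castOb R S (Ar Γ Q) f′ d λ f″ → k (g′ ∘ᵃ f″)

elab : (n : ℕ) {Γ : Ctx} → Raw → Formula Γ
elab n {Γ} (f ≐ʳ g)   =
  elabAr n Γ f ⊥ᶠ λ {S} {T} f′ → elabAr n Γ g ⊥ᶠ λ {Q} {R} g′ →
    castOb Q S (λ O → Ar Γ O R) g′ ⊥ᶠ λ g″ → castOb R T (Ar Γ S) g″ ⊥ᶠ λ g‴ → f′ ≐ g‴
elab n ⊤ʳ             = ⊤ᶠ
elab n ⊥ʳ             = ⊥ᶠ
elab n (r ∧ʳ s)       = elab n r ∧ elab n s
elab n (r ∨ʳ s)       = elab n r ∨ elab n s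
elab n (r ⊃ʳ s)       = elab n r ⊃ elab n s
elab n (∀ᵒ b)         = all ob (elab (suc n) (b n))
elab n (∃ᵒ b)         = ex ob (elab (suc n) (b n))
elab n {Γ} (∀ᵉ X b)   = all (one ⇒ level n X Γ) (elab (suc n) (b n))
elab n {Γ} (∃ᵉ X b)   = ex (one ⇒ level n X Γ) (elab (suc n) (b n))
elab n {Γ} (∀ᵃ X Y b) = all (level n X Γ ⇒ level n Y Γ) (elab (suc n) (b n))
elab n {Γ} (∃ᵃ X Y b) = ex (level n X Γ ⇒ level n Y Γ) (elab (suc n) (b n))

-- Composites and isomorphisms in a category

module CategoryLemmas (C : Category ℓ) where
  open Category C public
  open Notions C public
  open _≅_ public

  infixr 5 _⨾_
  _⨾_ : ∀ {A B} {f g h : Hom A B} → f ≈ g → g ≈ h → f ≈ h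
  _⨾_ = ≈-trans

  pullˡ : ∀ {A B D X} {f : Hom B D} {g : Hom A B} {h : Hom A D} {k : Hom X A} →
          f ∘ g ≈ h → f ∘ (g ∘ k) ≈ h ∘ k
  pullˡ e = ≈-sym assoc ⨾ ∘-congʳ e

  pullʳ : ∀ {A B D X} {k : Hom D X} {f : Hom B D} {g : Hom A B} {h : Hom A D} →
          f ∘ g ≈ h → (k ∘ f) ∘ g ≈ k ∘ h
  pullʳ e = assoc ⨾ ∘-congˡ e

  cancelˡ : ∀ {A B X} {f : Hom A B} {g : Hom B A} {k : Hom X B} →
            f ∘ g ≈ id → f ∘ (g ∘ k) ≈ k
  cancelˡ e = pullˡ e ⨾ identityˡ

  cancelʳ : ∀ {A B X} {f : Hom A B} {g : Hom B A} {k : Hom B X} →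
            f ∘ g ≈ id → (k ∘ f) ∘ g ≈ k
  cancelʳ e = pullʳ e ⨾ identityʳ

  ≅-sym : ∀ {A B} → A ≅ B → B ≅ A
  ≅-sym i = record { to = from i ; from = to i ; to∘from = from∘to i ; from∘to = to∘from i }

  ≅-trans : ∀ {A B D} → A ≅ B → B ≅ D → A ≅ D
  ≅-trans i j = record
    { to = to j ∘ to i ; from = from i ∘ from j
    ; to∘from = pullʳ (cancelˡ (to∘from i)) ⨾ to∘from j
    ; from∘to = pullʳ (cancelˡ (from∘to j)) ⨾ from∘to i }

  iso-cancelˡ : ∀ {A B X} (i : A ≅ B) {f g : Hom X A} → to i ∘ f ≈ to i ∘ g → f ≈ g
  iso-cancelˡ i e = ≈-sym (cancelˡ (from∘to i)) ⨾ ∘-congˡ e ⨾ cancelˡ (from∘to i)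

  iso-cancelʳ : ∀ {A B X} (i : A ≅ B) {f g : Hom B X} → f ∘ to i ≈ g ∘ to i → f ≈ g
  iso-cancelʳ i e = ≈-sym (cancelʳ (to∘from i)) ⨾ ∘-congʳ e ⨾ cancelʳ (to∘from i)

-- Invariance of truth under isomorphism of environments

module Simulation (C : Category ℓ) (𝟙 : Category.Obj C) where
  open CategoryLemmas C
  open Interpretation C 𝟙

  mapIso : ∀ {Γ B} {γ : Env Γ} {β : Env B} {r : ObVar Γ → ObVar B} →
           (∀ v → lookupOb γ v ≅ lookupOb β (r v)) → ∀ T → ⟦ T ⟧ γ ≅ ⟦ mapOb r T ⟧ β
  mapIso i one     = ≅-refl
  mapIso i (var v) = i v

  -- The components are isomorphisms and not mere arrows because implications and universal
  -- quantifiers carry truth and values backwards as well.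
  record Sim {Γ B} (ρ : Ren Γ B) (γ : Env Γ) (β : Env B) : Set ℓ where
    field
      iso    : ∀ v → lookupOb γ v ≅ lookupOb β (onOb ρ v)
      square : ∀ {S T} (f : ArVar Γ S T) →
               to (mapIso {r = onOb ρ} iso T) ∘ lookupAr γ f ≈
               lookupAr β (onAr ρ f) ∘ to (mapIso {r = onOb ρ} iso S)

    isoOb : ∀ T → ⟦ T ⟧ γ ≅ ⟦ ρ · T ⟧ β
    isoOb = mapIso iso

  open Sim public

  sim-id : ∀ {Γ} {γ : Env Γ} → Sim idᴿ γ γ
  iso (sim-id) v = ≅-refl
  square (sim-id {γ = γ}) {one} {one} f     = identityˡ ⨾ ≈-sym identityʳ
  square (sim-id {γ = γ}) {one} {var _} f   = identityˡ ⨾ ≈-sym identityʳ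
  square (sim-id {γ = γ}) {var _} {one} f   = identityˡ ⨾ ≈-sym identityʳ
  square (sim-id {γ = γ}) {var _} {var _} f = identityˡ ⨾ ≈-sym identityʳ

  -- The transport in `wkHom` disappears once `S` and `T` are in constructor form; in each case the
  -- goal is then the hypothesis.
  strengthen-square :
    ∀ {Γ B} {d : Decl Γ} {γ : Env Γ} {x : ⟦ d ⟧ᵈ γ} {β : Env B} (r : ObVar (Γ ▹ d) → ObVar B)
    (i : ∀ v → lookupOb (γ ▷ x) v ≅ lookupOb β (r v)) (S T : Ob Γ)
    {f : Hom (⟦ S ⟧ γ) (⟦ T ⟧ γ)}
    {w : ArVar B (mapOb (λ v → r (there v)) S) (mapOb (λ v → r (there v)) T)} →
    to (mapIso {γ = γ} {r = λ v → r (there v)} (λ v → i (there v)) T) ∘ f ≈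
      lookupAr β w ∘ to (mapIso {γ = γ} {r = λ v → r (there v)} (λ v → i (there v)) S) →
    to (mapIso {γ = γ ▷ x} {r = r} i (wk T)) ∘ wkHom (γ ▷ x) S T f ≈
      lookupAr β (strengthen r S T w) ∘ to (mapIso {γ = γ ▷ x} {r = r} i (wk S))
  strengthen-square r i one     one     e = e
  strengthen-square r i one     (var _) e = e
  strengthen-square r i (var _) one     e = e
  strengthen-square r i (var _) (var _) e = e

  module _ {Γ B} {ρ : Ren Γ B} {γ : Env Γ} {β : Env B} (s : Sim ρ γ β) where

    sim-↑ : ∀ {d : Decl B} {x : ⟦ d ⟧ᵈ β} → Sim (↑ {d = d} ρ) γ (_▷_ {d = d} β x)
    iso sim-↑ = iso s
    square sim-↑ {one}   {one}   f = square s f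
    square sim-↑ {one}   {var _} f = square s f
    square sim-↑ {var _} {one}   f = square s f
    square sim-↑ {var _} {var _} f = square s f

    sim-ob : ∀ {X : Obj} {w : ObVar B} → X ≅ lookupOb β w → Sim (ρ ,ob w) (γ ▷ X) β
    iso (sim-ob i) here      = i
    iso (sim-ob i) (there v) = iso s v
    square (sim-ob {X} {w} i) (there {S = S} {T} f) =
      strengthen-square {γ = γ} {x = X} (onOb (ρ ,ob w)) (iso (sim-ob i)) S T (square s f)

    sim-ar : ∀ {S T} {f : Hom (⟦ S ⟧ γ) (⟦ T ⟧ γ)} {w : ArVar B (ρ · S) (ρ · T)} →
             to (isoOb s T) ∘ f ≈ lookupAr β w ∘ to (isoOb s S) →
             Sim (ρ ,ar w) (γ ▷ f) β
    iso (sim-ar e) (there v) = iso s v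
    square (sim-ar {S} {T} {g} {w} e) here =
      strengthen-square {γ = γ} {x = g} (onOb (ρ ,ar w)) (iso (sim-ar {f = g} {w} e)) S T e
    square (sim-ar {f = g} {w} e) (there {S = S} {T} f) =
      strengthen-square {γ = γ} {x = g} (onOb (ρ ,ar w)) (iso (sim-ar {f = g} {w} e)) S T (square s f)

  sim-lift-ob : ∀ {Γ B} {ρ : Ren Γ B} {γ : Env Γ} {β : Env B} → Sim ρ γ β →
                ∀ {X Y : Obj} → X ≅ Y → Sim (lift ρ ob) (γ ▷ X) (β ▷ Y)
  sim-lift-ob s {Y = Y} i = sim-ob (sim-↑ s {ob} {Y}) i

  sim-lift-ar : ∀ {Γ B} {ρ : Ren Γ B} {γ : Env Γ} {β : Env B} (s : Sim ρ γ β) →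
                ∀ {S T} {f : Hom (⟦ S ⟧ γ) (⟦ T ⟧ γ)} {g : Hom (⟦ ρ · S ⟧ β) (⟦ ρ · T ⟧ β)} →
                to (isoOb s T) ∘ f ≈ g ∘ to (isoOb s S) →
                Sim (lift ρ (S ⇒ T)) (γ ▷ f) (β ▷ g)
  sim-lift-ar {ρ = ρ} s {S@one} {T@one} {f} {g} e = sim-ar (sim-↑ s {ρ · S ⇒ ρ · T} {g}) {S} {T} {f} e
  sim-lift-ar {ρ = ρ} s {S@one} {T@(var _)} {f} {g} e = sim-ar (sim-↑ s {ρ · S ⇒ ρ · T} {g}) {S} {T} {f} e
  sim-lift-ar {ρ = ρ} s {S@(var _)} {T@one} {f} {g} e = sim-ar (sim-↑ s {ρ · S ⇒ ρ · T} {g}) {S} {T} {f} e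
  sim-lift-ar {ρ = ρ} s {S@(var _)} {T@(var _)} {f} {g} e = sim-ar (sim-↑ s {ρ · S ⇒ ρ · T} {g}) {S} {T} {f} e

  module _ {Γ B} {ρ : Ren Γ B} {γ : Env Γ} {β : Env B} (s : Sim ρ γ β) where

    sim-term : ∀ {S T} (f : Ar Γ S T) →
               to (isoOb s T) ∘ ⟦ f ⟧ᵃ γ ≈ ⟦ renAr ρ f ⟧ᵃ β ∘ to (isoOb s S)
    sim-term (var f)  = square s f
    sim-term idᵃ      = identityʳ ⨾ ≈-sym identityˡ
    sim-term (f ∘ᵃ g) =
      pullˡ (sim-term f) ⨾ assoc ⨾ ∘-congˡ (sim-term g) ⨾ ≈-sym assoc

    -- Existential quantifiers carry a value forwards, universal ones (by `sim-pull`) backwards: an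
    -- object is kept, an arrow is conjugated by the isomorphisms.
    sim-push : (d : Decl Γ) (x : ⟦ d ⟧ᵈ γ) →
               Σ[ y ∈ ⟦ renDecl ρ d ⟧ᵈ β ] Sim (lift ρ d) (γ ▷ x) (β ▷ y)
    sim-push ob      X = X , sim-lift-ob s ≅-refl
    sim-push (S ⇒ T) f = to (isoOb s T) ∘ f ∘ from (isoOb s S) ,
      sim-lift-ar s (≈-sym (assoc ⨾ ∘-congˡ (cancelʳ (from∘to (isoOb s S)))))

    sim-pull : (d : Decl Γ) (y : ⟦ renDecl ρ d ⟧ᵈ β) →
               Σ[ x ∈ ⟦ d ⟧ᵈ γ ] Sim (lift ρ d) (γ ▷ x) (β ▷ y)
    sim-pull ob      Y = Y , sim-lift-ob s ≅-refl
    sim-pull (S ⇒ T) g = from (isoOb s T) ∘ g ∘ to (isoOb s S) ,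
      sim-lift-ar s (cancelˡ (to∘from (isoOb s T)))

  sim-⊨ : ∀ {Γ B} {ρ : Ren Γ B} {γ : Env Γ} {β : Env B} → Sim ρ γ β →
          (φ : Formula Γ) → γ ⊨ φ → β ⊨ ren ρ φ
  sim-⊨⁻ : ∀ {Γ B} {ρ : Ren Γ B} {γ : Env Γ} {β : Env B} → Sim ρ γ β →
           (φ : Formula Γ) → β ⊨ ren ρ φ → γ ⊨ φ

  sim-⊨ s (_≐_ {S} {T} f g) e =
    ≈-sym (cancelʳ (to∘from (isoOb s S)))
    ⨾ ∘-congʳ (≈-sym (sim-term s f) ⨾ ∘-congˡ e ⨾ sim-term s g)
    ⨾ cancelʳ (to∘from (isoOb s S))
  sim-⊨ s ⊤ᶠ        t         = t
  sim-⊨ s (φ ∧ ψ)   (p , q)   = sim-⊨ s φ p , sim-⊨ s ψ q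
  sim-⊨ s (φ ∨ ψ)   (inj₁ p)  = inj₁ (sim-⊨ s φ p)
  sim-⊨ s (φ ∨ ψ)   (inj₂ q)  = inj₂ (sim-⊨ s ψ q)
  sim-⊨ s (φ ⊃ ψ)   h         = λ p → sim-⊨ s ψ (h (sim-⊨⁻ s φ p))
  sim-⊨ s (all d φ) h         = λ y → sim-⊨ (proj₂ (sim-pull s d y)) φ (h (proj₁ (sim-pull s d y)))
  sim-⊨ s (ex d φ)  (x , p)   = proj₁ (sim-push s d x) , sim-⊨ (proj₂ (sim-push s d x)) φ p

  sim-⊨⁻ s (_≐_ {S} {T} f g) e =
    ≈-sym (cancelˡ (from∘to (isoOb s T)))
    ⨾ ∘-congˡ (sim-term s f ⨾ ∘-congʳ e ⨾ ≈-sym (sim-term s g))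
    ⨾ cancelˡ (from∘to (isoOb s T))
  sim-⊨⁻ s ⊤ᶠ        t        = t
  sim-⊨⁻ s (φ ∧ ψ)   (p , q)  = sim-⊨⁻ s φ p , sim-⊨⁻ s ψ q
  sim-⊨⁻ s (φ ∨ ψ)   (inj₁ p) = inj₁ (sim-⊨⁻ s φ p)
  sim-⊨⁻ s (φ ∨ ψ)   (inj₂ q) = inj₂ (sim-⊨⁻ s ψ q)
  sim-⊨⁻ s (φ ⊃ ψ)   h        = λ p → sim-⊨⁻ s ψ (h (sim-⊨ s φ p))
  sim-⊨⁻ s (all d φ) h        = λ x → sim-⊨⁻ (proj₂ (sim-push s d x)) φ (h (proj₁ (sim-push s d x)))
  sim-⊨⁻ s (ex d φ)  (y , p)  = proj₁ (sim-pull s d y) , sim-⊨⁻ (proj₂ (sim-pull s d y)) φ p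

-- Elementwise reasoning in a well-pointed topos with choice

module Elements {C : Category ℓ} (E : ETCS C) where
  open CategoryLemmas C public
  open ETCS E public
  open IsTerminal terminal public
  open Interpretation C 𝟙 public
  open Simulation C 𝟙 public
  open Reindexing E public
  open Schemas E public

  ⊥ₗ : Set ℓ
  ⊥ₗ = ⊥

  ⊥-elim : ∀ {A : Set ℓ} → ⊥ₗ → A
  ⊥-elim ()

  -- This is definitionally the truth of `¬ʳ`, so that semantic statements and raw formulas match
  -- without conversion.
  ¬ₗ : Set ℓ → Set ℓ
  ¬ₗ P = P → ⊥ₗ

  decide : ∀ Γ (r : Raw) (γ : Env Γ) → (γ ⊨ elab (depth Γ) r) ⊎ ¬ₗ (γ ⊨ elab (depth Γ) r)
  decide Γ r γ with excluded-middle (elab (depth Γ) r) γ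
  ... | inj₁ p = inj₁ p
  ... | inj₂ q = inj₂ λ p → ⊥-elim₀ (q p)

  El : Obj → Set ℓ
  El X = Hom 𝟙 X

  Injective : ∀ {A B} → Hom A B → Set ℓ
  Injective {A} m = ∀ (x y : El A) → m ∘ x ≈ m ∘ y → x ≈ y

  Surjective : ∀ {A B} → Hom A B → Set ℓ
  Surjective {B = B} e = ∀ (y : El B) → y ∈ e

  el-𝟙 : ∀ {A} {f : Hom A 𝟙} {g : Hom A 𝟙} → f ≈ g
  el-𝟙 = !-unique _ _

  injective⇒mono : ∀ {A B} {m : Hom A B} → Injective m → Mono m
  injective⇒mono inj f g e = generator f g λ x → inj _ _ (pullˡ e ⨾ assoc)

  epi⇒surjective : ∀ {A B} {e : Hom A B} → Epi e → Surjective e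
  epi⇒surjective {e = e} epi y with choice e epi
  ... | s , es = s ∘ y , cancelˡ es

  regularEpi⇒epi : ∀ {A B} {e : Hom A B} → RegularEpi e → Epi e
  regularEpi⇒epi (_ , a , b , q) f g e = unique eq e ⨾ ≈-sym (unique eq ≈-refl)
    where open IsCoequalizer q
          eq = pullʳ commutes ⨾ ≈-sym assoc

  id-regularEpi : ∀ {A} → RegularEpi (id {A})
  id-regularEpi = _ , id , id , record
    { commutes  = ≈-refl
    ; universal = λ h _ → h
    ; factors   = λ _ → identityʳ
    ; unique    = λ _ e → ≈-sym identityʳ ⨾ e
    }

  surjective⇒epi : ∀ {A B} {e : Hom A B} → Surjective e → Epi e
  surjective⇒epi {e = e} surj f g eq = generator f g λ y →
    let x , ex≈y = surj y in
    ∘-congˡ (≈-sym ex≈y) ⨾ pullˡ eq ⨾ pullʳ ex≈y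

  section : ∀ {A B} {e : Hom A B} → Surjective e → Σ[ s ∈ Hom B A ] e ∘ s ≈ id
  section {e = e} surj = choice e (surjective⇒epi surj)

  -- A span with surjective left leg is a total relation; a section of that leg selects a function
  -- inside it.
  choose : ∀ {S A B} (a : Hom S A) (b : Hom S B) → Surjective a →
           Σ[ f ∈ Hom A B ] (∀ x → Σ[ s ∈ El S ] (a ∘ s ≈ x) × (b ∘ s ≈ f ∘ x))
  choose a b surj with section surj
  ... | s , as = b ∘ s , λ x → s ∘ x , cancelˡ as , ≈-sym assoc

  -- The hypothesis makes the projection from the pullback of `m` along `f` to `W` surjective, and
  -- choice splits it. This is how arrows are built from statements about elements.
  factor : ∀ {S W X} (m : Hom S X) (f : Hom W X) → (∀ w → (f ∘ w) ∈ m) →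
           Σ[ g ∈ Hom W S ] m ∘ g ≈ f
  factor m f h with choose p₂ p₁ surj
    where
    open Pullback (pullback m f)
    surj : Surjective p₂
    surj w = let y , e = h w in universal y w e , p₂-universal e
  ... | g , spec = g , generator _ _ λ w →
    let s , p₂s≈w , p₁s≈gw = spec w in
    assoc ⨾ ∘-congˡ (≈-sym p₁s≈gw) ⨾ pullˡ commutes ⨾ pullʳ p₂s≈w
    where open Pullback (pullback m f)

  bijective⇒iso : ∀ {A B} (f : Hom A B) → Injective f → Surjective f →
                  Σ[ i ∈ A ≅ B ] to i ≈ f
  bijective⇒iso f inj surj with section surj
  ... | s , fs = record
    { to = f ; from = s ; to∘from = fs
    ; from∘to = injective⇒mono inj _ _ (cancelˡ fs ⨾ ≈-sym identityʳ) } , ≈-refl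

  sameImage⇒iso : ∀ {S T X} {m : Hom S X} {n : Hom T X} → Injective m → Injective n →
                  (∀ s → (m ∘ s) ∈ n) → (∀ t → (n ∘ t) ∈ m) →
                  Σ[ i ∈ S ≅ T ] n ∘ to i ≈ m
  sameImage⇒iso {m = m} {n} injm injn h k with factor n m h | factor m n k
  ... | f , nf | g , mg = record
    { to = f ; from = g
    ; to∘from = injective⇒mono injn _ _ (pullˡ nf ⨾ mg ⨾ ≈-sym identityʳ)
    ; from∘to = injective⇒mono injm _ _ (pullˡ mg ⨾ nf ⨾ ≈-sym identityʳ) } , nf

  module _ {A B : Obj} where
    open Product (product A B) public using (π₁; π₂; ⟨_,_⟩; π₁-⟨⟩; π₂-⟨⟩)
      renaming (unique to ×-unique)

  infixr 7 _×ₒ_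
  _×ₒ_ : Obj → Obj → Obj
  A ×ₒ B = Product.P (product A B)

  -- If every object had an element, `𝟙` would be initial: arrows out of it would exist, and any two
  -- would agree because their pullback has an element. This contradicts `no-1→0`.
  empty : Σ[ Z ∈ Obj ] ¬ₗ (El Z)
  empty with decide ∅ (∃ᵒ λ Z → ¬ʳ (∃ᵉ Z λ _ → ⊤ʳ)) []
  ... | inj₁ (Z , h) = Z , λ z → h (z , _)
  ... | inj₂ h = ⊥-elim₀ (no-1→0 𝟙-initial id)
    where
    inhabited : ∀ X → El X
    inhabited X with decide (∅ ▹ ob) (∃ᵉ 0 λ _ → ⊤ʳ) ([] ▷ X)
    ... | inj₁ (x , _) = x
    ... | inj₂ n       = ⊥-elim (h (X , n))
    𝟙-initial : IsInitial 𝟙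
    𝟙-initial = record
      { ¡ = inhabited _
      ; ¡-unique = λ f g →
          let open Pullback (pullback f g)
              p = inhabited P
          in ≈-sym identityʳ ⨾ ∘-congˡ el-𝟙 ⨾ pullˡ {k = p} commutes ⨾ pullʳ el-𝟙 ⨾ identityʳ
      }

  module _ {U : Obj} (u : El U) (X : SliceObj C U) where

    fibre-injective : ∀ {Z} (F : Fibre u X Z) → Injective (Fibre.incl F)
    fibre-injective F x y e = Fibre.unique F el-𝟙 e

    fibre-over : ∀ {Z} (F : Fibre u X Z) (x : El Z) → arr X ∘ Fibre.incl F ∘ x ≈ u
    fibre-over F x = pullˡ (≈-sym (Fibre.commutes F)) ⨾ pullʳ el-𝟙 ⨾ identityʳ

    fibre-covers : ∀ {Z} (F : Fibre u X Z) (x : El (total X)) → arr X ∘ x ≈ u →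
                   x ∈ Fibre.incl F
    fibre-covers F x e = Fibre.universal F id x e′ , Fibre.p₂-universal F e′
      where e′ = identityʳ ⨾ ≈-sym e

-- Contexts are built from named stages: in a context written out in full, each
-- occurrence of `there` would carry a copy of the whole context.
leg : (Γ : Ctx) → ObVar Γ → Ctx
leg Γ X = Γ ▹ ob ▹ var here ⇒ var (there X)

span : (Γ : Ctx) → ObVar Γ → ObVar Γ → Ctx
span Γ X Y = leg Γ X ▹ var (there here) ⇒ var (there (there Y))

relʳ : (R r₁ r₂ : ℕ) → RawAr → RawAr → Raw
relʳ R r₁ r₂ a b = ∃ᵉ R λ z → ($ r₁ ∙ $ z ≐ʳ a) ∧ʳ ($ r₂ ∙ $ z ≐ʳ b)

-- Families over U and full separation

module Families {C : Category ℓ} (E : ETCS C) where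
  open Elements E

  -- `ren ρ φ` is not definitionally `φ`, even when `ρ` fixes every variable; the second simulation,
  -- from `β` to itself, undoes the renaming.
  invariant : ∀ {Γ} {ρ : Ren Γ Γ} {γ β : Env Γ} → Sim ρ γ β → Sim ρ β β →
              (φ : Formula Γ) → γ ⊨ φ → β ⊨ φ
  invariant s t φ p = sim-⊨⁻ t φ (sim-⊨ s φ p)

  id-square : ∀ {A B} {f g : Hom A B} → f ≈ g → id ∘ f ≈ g ∘ id
  id-square e = identityˡ ⨾ e ⨾ ≈-sym identityʳ

  module _ {Γ} {U : ObVar Γ} {γ : Env Γ} where

    invariant-el : {u u′ : El (lookupOb γ U)} → u ≈ u′ →
                   (φ : Formula (Γ ▹ one ⇒ var U)) → γ ▷ u ⊨ φ → γ ▷ u′ ⊨ φ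
    invariant-el e = invariant (sim-lift-ar sim-id {one} {var U} (id-square e))
                               (sim-lift-ar sim-id {one} {var U} (id-square ≈-refl))

    invariant-ob : {u u′ : El (lookupOb γ U)} → u ≈ u′ → {X Y : Obj} → X ≅ Y →
                   (φ : Formula (Γ ▹ one ⇒ var U ▹ ob)) → γ ▷ u ▷ X ⊨ φ → γ ▷ u′ ▷ Y ⊨ φ
    invariant-ob e i =
      invariant (sim-lift-ob (sim-lift-ar sim-id {one} {var U} (id-square e)) i)
                (sim-lift-ob (sim-lift-ar sim-id {one} {var U} (id-square ≈-refl)) ≅-refl)

  fibre-≅ : ∀ {U} {u : El U} {X : SliceObj C U} {Z W} → Fibre u X Z → Fibre u X W → Z ≅ W
  fibre-≅ {u = u} {X} F G = proj₁ (sameImage⇒iso (fibre-injective u X F) (fibre-injective u X G)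
    (λ s → fibre-covers u X G _ (fibre-over u X F s))
    (λ t → fibre-covers u X F _ (fibre-over u X G t)))

  IsFamily : ∀ {Γ} (U : ObVar Γ) (φ : Formula (Γ ▹ one ⇒ var U ▹ ob)) (γ : Env Γ) →
             SliceObj C (lookupOb γ U) → Set ℓ
  IsFamily U φ γ A = ∀ (u : El (lookupOb γ U)) → γ ▷ u ▷ total (u ^* A) ⊨ φ

  StrongCollection : Set ℓ
  StrongCollection =
    ∀ {Γ} (U : ObVar Γ) (φ : Formula (Γ ▹ one ⇒ var U ▹ ob)) (γ : Env Γ) →
    (∀ u → Σ[ X ∈ Obj ] (γ ▷ u ▷ X ⊨ φ)) → Σ[ A ∈ _ ] IsFamily U φ γ A

  collection⇒strong : CollectionOfSets → StrongCollection
  collection⇒strong coll U φ γ h with coll U φ γ h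
  ... | V , p , regular , A , good with section (epi⇒surjective (regularEpi⇒epi regular))
  ... | s , ps = s ^* A , λ u → invariant-ob (cancelˡ ps)
    (fibre-≅ (fibre-∘ s u A) (fibre u (s ^* A))) φ (good (s ∘ u))

  strong⇒collection : StrongCollection → CollectionOfSets
  strong⇒collection strong U φ γ h with strong U φ γ h
  ... | A , good = _ , id , id-regularEpi , A , λ v →
    invariant-ob (≈-sym identityˡ) ≅-refl φ (good v)

  -- An X satisfying it is the subset of 1 whose truth value is φ.
  indicator : ∀ {Γ} {X : ObVar Γ} → Formula (Γ ▹ one ⇒ var X) → Formula (Γ ▹ one ⇒ var X ▹ ob)
  indicator φ = (ren (↑ idᴿ) φ ∧ elab 1 (∃ᵉ 0 λ x → ∀ᵉ 0 λ y → $ y ≐ʳ $ x))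
              ∨ ((ren (↑ idᴿ) φ ⊃ ⊥ᶠ) ∧ elab 1 (¬ʳ (∃ᵉ 0 λ _ → ⊤ʳ)))

  module _ {Γ} (X : ObVar Γ) (φ : Formula (Γ ▹ one ⇒ var X)) (γ : Env Γ) where
    private
      X₀ = lookupOb γ X

      weaken : (x : El X₀) {Z : Obj} →
               Sim (↑ {d = ob} idᴿ) (_▷_ {d = one ⇒ var X} γ x) (γ ▷ x ▷ Z)
      weaken x {Z} = sim-↑ (sim-id {γ = γ ▷ x}) {ob} {Z}

    Separated : Set ℓ
    Separated = Σ[ S ∈ Obj ] Σ[ m ∈ Hom S X₀ ] Mono m × (∀ x → x ∈ m ⇔ (γ ▷ x ⊨ φ))

    indicator-exists : ∀ x → Σ[ Z ∈ Obj ] (γ ▷ x ▷ Z ⊨ indicator φ)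
    indicator-exists x with excluded-middle φ (γ ▷ x)
    ... | inj₁ p = 𝟙 , inj₁ (sim-⊨ (weaken x) φ p , id , λ _ → el-𝟙)
    ... | inj₂ n = let Z , none = empty in
      Z , inj₂ ((λ p → ⊥-elim₀ (n (sim-⊨⁻ (weaken x) φ p))) , λ (z , _) → none z)

    indicator-inhabited : ∀ {x Z} → γ ▷ x ▷ Z ⊨ indicator φ → El Z ⇔ (γ ▷ x ⊨ φ)
    indicator-inhabited {x} (inj₁ (p , z , _)) = mk⇔ (λ _ → sim-⊨⁻ (weaken x) φ p) (λ _ → z)
    indicator-inhabited {x} (inj₂ (n , none))  =
      mk⇔ (λ z → ⊥-elim (none (z , _))) (λ p → ⊥-elim (n (sim-⊨ (weaken x) φ p)))

    indicator-unique : ∀ {x Z} → γ ▷ x ▷ Z ⊨ indicator φ → (z w : El Z) → z ≈ w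
    indicator-unique (inj₁ (_ , _ , all≈)) z w = all≈ z ⨾ ≈-sym (all≈ w)
    indicator-unique (inj₂ (_ , none))     z w = ⊥-elim (none (z , _))

    -- Fibres with at most one element make the projection of the family injective, and its image
    -- consists of the `x` with inhabited fibre.
    separate : Σ[ A ∈ _ ] IsFamily X (indicator φ) γ A → Separated
    separate (A , good) = total A , arr A , injective⇒mono inj , λ x → mk⇔
      (λ (a , e) → invariant-el e φ (Equivalence.to (indicator-inhabited (good _))
        (proj₁ (fibre-covers _ A (fibre _ A) a ≈-refl))))
      (λ p → let F = fibre x A
                 z = Equivalence.from (indicator-inhabited (good x)) p
             in Fibre.incl F ∘ z , fibre-over x A F z)
      where
      inj : Injective (arr A)
      inj a b e with fibre-covers _ A (fibre (arr A ∘ a) A) a ≈-refl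
                   | fibre-covers _ A (fibre (arr A ∘ a) A) b (≈-sym e)
      ... | z , za | w , wb = ≈-sym za ⨾ ∘-congˡ (indicator-unique (good _) z w) ⨾ wb

  strong⇒separation : StrongCollection → FullSeparation
  strong⇒separation strong X φ γ =
    separate X φ γ (strong X (indicator φ) γ (indicator-exists X φ γ))

  subsingleton-iso : ∀ {X Y} → (∀ (x y : El X) → x ≈ y) → (∀ (x y : El Y) → x ≈ y) →
                     (El X → El Y) → (El Y → El X) → X ≅ Y
  subsingleton-iso ux uy f g =
    proj₁ (sameImage⇒iso {m = !} {n = !} (λ x y _ → ux x y) (λ x y _ → uy x y)
      (λ x → f x , el-𝟙) (λ y → g y , el-𝟙))

  replacement⇒separation : ReplacementOfContexts → FullSeparation
  replacement⇒separation repl X φ γ with repl X ([] ▸ ob) (indicator φ) γ unique!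
    where
    unique! : ∀ x → _ × _
    unique! x =
      (let Z , p = indicator-exists X φ γ x in ([] ▷ Z) , p) ,
      λ { ([] ▷ Z) ([] ▷ W) p q →
        let ι = indicator-inhabited X φ γ p
            κ = indicator-inhabited X φ γ q
            i = subsingleton-iso (indicator-unique X φ γ p) (indicator-unique X φ γ q)
                  (λ z → Equivalence.from κ (Equivalence.to ι z))
                  (λ w → Equivalence.from ι (Equivalence.to κ w))
        in ([] ▸ob i) , λ { ([] ▸ob j) here → generator _ _ λ z → indicator-unique X φ γ q _ _
                          ; ([] ▸ob j) (there (there v)) → ≈-refl } }
  ... | (Interpretation.[] Interpretation.▷ A) , good = separate X φ γ (A , good)

  -- Relations, power objects and choice of values

  Rel : ∀ {R A B} (r₁ : Hom R A) (r₂ : Hom R B) → El A → El B → Set ℓ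
  Rel {R} r₁ r₂ a b = Σ[ z ∈ El R ] (r₁ ∘ z ≈ a) × (r₂ ∘ z ≈ b)

  rel-resp : ∀ {R A B} {r₁ : Hom R A} {r₂ : Hom R B} {a a′ b b′} →
             a ≈ a′ → b ≈ b′ → Rel r₁ r₂ a b → Rel r₁ r₂ a′ b′
  rel-resp p q (z , e , f) = z , e ⨾ p , f ⨾ q

  ⟨⟩-∘ : ∀ {A B W V} {f : Hom W A} {g : Hom W B} {h : Hom V W} →
         ⟨ f , g ⟩ ∘ h ≈ ⟨ f ∘ h , g ∘ h ⟩
  ⟨⟩-∘ = ×-unique (pullˡ π₁-⟨⟩ ⨾ ≈-sym π₁-⟨⟩) (pullˡ π₂-⟨⟩ ⨾ ≈-sym π₂-⟨⟩)

  ⟨⟩-cong : ∀ {A B W} {f f′ : Hom W A} {g g′ : Hom W B} → f ≈ f′ → g ≈ g′ →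
            ⟨ f , g ⟩ ≈ ⟨ f′ , g′ ⟩
  ⟨⟩-cong p q = ×-unique (π₁-⟨⟩ ⨾ p ⨾ ≈-sym π₁-⟨⟩) (π₂-⟨⟩ ⨾ q ⨾ ≈-sym π₂-⟨⟩)

  -- e₁ and e₂ exhibit Mem ⊆ PX × X as the membership relation.
  record Power (X : Obj) : Set ℓ where
    field
      {PX Mem} : Obj
      e₁     : Hom Mem PX
      e₂     : Hom Mem X
      name   : ∀ {S} (m : Hom S X) → Mono m →
               Σ[ r ∈ El PX ] (∀ x → x ∈ m ⇔ Rel e₁ e₂ r x)
      extensional : ∀ r s → (∀ x → Rel e₁ e₂ r x → Rel e₁ e₂ s x) →
                    (∀ x → Rel e₁ e₂ s x → Rel e₁ e₂ r x) → r ≈ s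

  open SubobjectClassifier classifier using (Ω; true; χ; classify)
    renaming (unique to χ-unique)

  -- A truth value other than `true` classifies the empty subset of `𝟙`, so uniqueness of
  -- classifying maps identifies any two of these.
  Ω-extensional : (p q : El Ω) → (p ≈ true → q ≈ true) → (q ≈ true → p ≈ true) → p ≈ q
  Ω-extensional p q f g
    with decide (∅ ▹ ob ▹ one ⇒ var here ▹ one ⇒ var (there here)) ($ 1 ≐ʳ $ 2) ([] ▷ Ω ▷ p ▷ true)
  ... | inj₁ e = e ⨾ ≈-sym (f e)
  ... | inj₂ n = χ-unique _ (false p n) ⨾ ≈-sym (χ-unique mono (false q λ e → n (g e)))
    where
    Z    = proj₁ empty
    none = proj₂ empty
    mono : Mono (! {Z})
    mono = injective⇒mono λ x _ _ → ⊥-elim (none x)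
    false : ∀ p → ¬ₗ (p ≈ true) → IsPullback true p ! (! {Z})
    false p n = record
      { commutes     = generator _ _ λ z → ⊥-elim (none z)
      ; universal    = λ h k e → proj₁ (vacuous h k e)
      ; p₁-universal = λ _ → el-𝟙
      ; p₂-universal = λ _ → el-𝟙
      ; unique       = λ {_} {h} _ _ → generator _ _ λ w → ⊥-elim (none (h ∘ w))
      }
      where
      vacuous : ∀ {W} (h k : Hom W 𝟙) → true ∘ h ≈ p ∘ k → Σ[ f ∈ Hom W Z ] ! ∘ f ≈ k
      vacuous h k e = factor ! k λ w → ⊥-elim (n (
        ≈-sym identityʳ ⨾ ∘-congˡ el-𝟙 ⨾ pullˡ {k = w} (≈-sym e) ⨾ pullʳ el-𝟙 ⨾ identityʳ))

  power : ∀ X → Power X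
  power X = record
    { e₁ = π₁ ∘ p₂ ; e₂ = π₂ ∘ p₂
    ; name = λ m mono → curry (χ m mono ∘ π₂) , λ x → mk⇔
        (λ (s , e) → mem⇐ (eval-curry ⨾ ∘-congˡ (≈-sym e)
          ⨾ pullˡ (≈-sym (IsPullback.commutes (classify mono))) ⨾ pullʳ el-𝟙 ⨾ identityʳ))
        (λ r∋x → let sq = identityʳ ⨾ ≈-sym (≈-sym eval-curry ⨾ mem⇒ r∋x) in
          IsPullback.universal (classify mono) id x sq ,
          IsPullback.p₂-universal (classify mono) sq)
    ; extensional = λ r s f g → unique ≈-refl ⨾ ≈-sym (unique (generator _ _ λ w →
        restrict w ⨾ Ω-extensional _ _
          (λ e → mem⇒ (g _ (mem⇐ e))) (λ e → mem⇒ (f _ (mem⇐ e)))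
        ⨾ ≈-sym (restrict w)))
    }
    where
    open Exponential (exponential X Ω)
    open Pullback (pullback true eval) using (p₁; p₂; commutes; universal; p₂-universal)

    mem⇒ : ∀ {r x} → Rel (π₁ ∘ p₂) (π₂ ∘ p₂) r x → eval ∘ ⟨ r , x ⟩ ≈ true
    mem⇒ {r} {x} (z , e , f) =
      ∘-congˡ (×-unique (π₁-⟨⟩ ⨾ ≈-sym e ⨾ assoc) (π₂-⟨⟩ ⨾ ≈-sym f ⨾ assoc))
      ⨾ pullˡ {k = z} (≈-sym commutes) ⨾ pullʳ el-𝟙 ⨾ identityʳ

    mem⇐ : ∀ {r x} → eval ∘ ⟨ r , x ⟩ ≈ true → Rel (π₁ ∘ p₂) (π₂ ∘ p₂) r x
    mem⇐ e = universal id _ e′ , pullʳ (p₂-universal e′) ⨾ π₁-⟨⟩ , pullʳ (p₂-universal e′) ⨾ π₂-⟨⟩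
      where e′ = identityʳ ⨾ ≈-sym e

    restrict : ∀ {r : El B^A} (w : El (𝟙 ×ₒ X)) →
               (eval ∘ ⟨ r ∘ π₁ , π₂ ⟩) ∘ w ≈ eval ∘ ⟨ r , π₂ ∘ w ⟩
    restrict w = pullʳ (⟨⟩-∘ ⨾ ⟨⟩-cong (pullʳ el-𝟙 ⨾ identityʳ) ≈-refl)

    eval-curry : ∀ {f : Hom X Ω} {x : El X} → eval ∘ ⟨ curry (f ∘ π₂) , x ⟩ ≈ f ∘ x
    eval-curry {f} {x} =
      ∘-congˡ (⟨⟩-cong ≈-refl (≈-sym π₂-⟨⟩)) ⨾ ≈-sym (restrict ⟨ id , x ⟩)
      ⨾ ∘-congʳ β ⨾ pullʳ π₂-⟨⟩

  -- r names {(x w , y w) | w ∈ Z} through the ternary relation (e , a , b).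
  NamesPairs : ∀ {A B P M Z : Obj} → Hom M P → Hom M A → Hom M B → El P → Hom Z A → Hom Z B → Set ℓ
  NamesPairs {M = M} {Z} e a b r x y =
    (∀ w → Σ[ z ∈ El M ] (e ∘ z ≈ r) × ((a ∘ z ≈ x ∘ w) × (b ∘ z ≈ y ∘ w))) ×
    (∀ z → e ∘ z ≈ r → Σ[ w ∈ El Z ] (a ∘ z ≈ x ∘ w) × (b ∘ z ≈ y ∘ w))

  module _ {A B : Obj} where
    open Power (power (A ×ₒ B))

    -- `name` applies to monos only; the injectivity of `x` makes the pairing of `x` and `y` one.
    namePairs : ∀ {Z} (x : Hom Z A) (y : Hom Z B) → Injective x →
                Σ[ r ∈ El PX ] NamesPairs e₁ (π₁ ∘ e₂) (π₂ ∘ e₂) r x y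
    namePairs x y inj = proj₁ named ,
      (λ w → let z , e , q = Equivalence.to (proj₂ named (⟨ x , y ⟩ ∘ w)) (w , ≈-refl)
             in z , e , (pullʳ q ⨾ pullˡ π₁-⟨⟩) , (pullʳ q ⨾ pullˡ π₂-⟨⟩)) ,
      (λ z e → let w , q = Equivalence.from (proj₂ named (e₂ ∘ z)) (z , e , ≈-refl)
               in w , (pullʳ (≈-sym q) ⨾ pullˡ π₁-⟨⟩) , (pullʳ (≈-sym q) ⨾ pullˡ π₂-⟨⟩))
      where
      named = name ⟨ x , y ⟩ (injective⇒mono λ v w e → inj v w
        (∘-congʳ (≈-sym π₁-⟨⟩) ⨾ assoc ⨾ ∘-congˡ e ⨾ pullˡ π₁-⟨⟩))

  -- Decodes a family of relations: `ρ p` names a relation with an entry at `p`. The pullback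
  -- collects the pairs of a `p` and such an entry, and choice selects one entry for each `p`.
  choose-value : ∀ {A B M P} (ρ : Hom A P) (e : Hom M P) (a : Hom M A) (b : Hom M B) →
    (∀ p → Σ[ z ∈ El M ] (e ∘ z ≈ ρ ∘ p) × (a ∘ z ≈ p)) →
    Σ[ g ∈ Hom A B ] (∀ p → Σ[ z ∈ El M ] (e ∘ z ≈ ρ ∘ p) × ((a ∘ z ≈ p) × (b ∘ z ≈ g ∘ p)))
  choose-value ρ e a b defined = proj₁ chosen , λ p →
    let w , wp , wg = proj₂ chosen p
        sq = ≈-sym ⟨⟩-∘ ⨾ pullˡ (≈-sym commutes) ⨾ assoc ⨾ ∘-congˡ wp ⨾ ⟨⟩-∘
    in p₂ ∘ w , (≈-sym π₁-⟨⟩ ⨾ ∘-congˡ sq ⨾ π₁-⟨⟩) ,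
       (≈-sym π₂-⟨⟩ ⨾ ∘-congˡ sq ⨾ π₂-⟨⟩ ⨾ identityˡ) , (≈-sym assoc ⨾ wg)
    where
    open Pullback (pullback ⟨ ρ , id ⟩ ⟨ e , a ⟩)
    chosen = choose p₁ (b ∘ p₂) λ p →
      let z , ez , az = defined p
          sq = ⟨⟩-∘ ⨾ ⟨⟩-cong (≈-sym ez) (identityˡ ⨾ ≈-sym az) ⨾ ≈-sym ⟨⟩-∘
      in universal p z sq , p₁-universal sq

  module _ (separation : FullSeparation) where

    -- Choice speaks of arrows. It applies to a formula once separation has turned the pairs
    -- satisfying it into a subset of the product, whose projection is then surjective.
    choose-element :
      ∀ {Γ} (U Y : ObVar Γ) (φ : Formula (Γ ▹ one ⇒ var U ▹ one ⇒ var (there Y))) (γ : Env Γ) →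
      (∀ u → Σ[ y ∈ El (lookupOb γ Y) ] (γ ▷ u ▷ y ⊨ φ)) →
      Σ[ h ∈ Hom (lookupOb γ U) (lookupOb γ Y) ] (∀ u → γ ▷ u ▷ h ∘ u ⊨ φ)
    choose-element {Γ} U Y φ γ h = proj₁ chosen , λ u → spec u (proj₂ chosen u)
      where
      U₀ = lookupOb γ U
      Y₀ = lookupOb γ Y

      Γʷ Γʷᵘ Γʷᵘʸ : Ctx
      Γʷ   = span Γ U Y ▹ one ⇒ var (there (there here))
      Γʷᵘ  = Γʷ ▹ one ⇒ var (there (there (there (there U))))
      Γʷᵘʸ = Γʷᵘ ▹ one ⇒ var (there (there (there (there (there Y)))))

      γʷᵘʸ : El (U₀ ×ₒ Y₀) → El U₀ → El Y₀ → Env Γʷᵘʸ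
      γʷᵘʸ w u y = γ ▷ U₀ ×ₒ Y₀ ▷ π₁ ▷ π₂ ▷ w ▷ u ▷ y

      ρ₀ : Ren Γ Γʷᵘʸ
      ρ₀ = ↑ (↑ (↑ (↑ (↑ (↑ idᴿ)))))

      ρ : Ren (Γ ▹ one ⇒ var U ▹ one ⇒ var (there Y)) Γʷᵘʸ
      ρ = ρ₀ ,ar there here ,ar here

      -- Renamings replace variables by variables only, so the two components of `w` have to be
      -- named by quantified `u` and `y`.
      φ⁺ : Formula Γʷ
      φ⁺ = ex (one ⇒ _) (ex (one ⇒ _)
        (((var (there (there (there (there here)))) ∘ᵃ var (there (there here))) ≐ var (there here))
        ∧ (((var (there (there (there here))) ∘ᵃ var (there (there here))) ≐ var here)
        ∧ ren ρ φ)))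

      sim : ∀ {u u′ y y′ w} → u ≈ u′ → y ≈ y′ →
            Sim ρ (γ ▷ u ▷ y) (γʷᵘʸ w u′ y′)
      sim {u} {u′} {y} {y′} {w} e f =
        sim-ar (sim-ar s {one} {var U} (id-square e)) {one} {var (there Y)} (id-square f)
        where
        s : Sim ρ₀ γ (γʷᵘʸ w u′ y′)
        s = sim-↑ (sim-↑ (sim-↑ (sim-↑ (sim-↑ (sim-↑ sim-id)))))

      separated = separation (there (there here)) φ⁺ (γ ▷ U₀ ×ₒ Y₀ ▷ π₁ ▷ π₂)
      m      = proj₁ (proj₂ separated)
      member = proj₂ (proj₂ (proj₂ separated))

      surj : Surjective (π₁ ∘ m)
      surj u = let y , p = h u
                   s , e = Equivalence.from (member ⟨ u , y ⟩)
                     (u , y , π₁-⟨⟩ , π₂-⟨⟩ , sim-⊨ (sim ≈-refl ≈-refl) φ p)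
               in s , pullʳ e ⨾ π₁-⟨⟩

      chosen = choose (π₁ ∘ m) (π₂ ∘ m) surj

      spec : ∀ u → Σ[ s ∈ _ ] ((π₁ ∘ m) ∘ s ≈ u) × ((π₂ ∘ m) ∘ s ≈ proj₁ chosen ∘ u) →
             γ ▷ u ▷ proj₁ chosen ∘ u ⊨ φ
      spec u (s , e , f) =
        let u′ , y′ , e′ , f′ , p = Equivalence.to (member (m ∘ s)) (s , ≈-refl)
        in sim-⊨⁻ (sim {w = m ∘ s} (≈-sym e ⨾ assoc ⨾ e′) (≈-sym f ⨾ assoc ⨾ f′)) φ p

-- Formulas about the fibres of a family of structures

-- K names the total objects of a family of Δ-structures over the set tot one,
-- together with their projections and the total maps.
record Code (Δ K : Ctx) : Set where
  field
    tot  : Ob Δ → ObVar K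
    over : ∀ T → ArVar K (var (tot T)) (var (tot one))
    maps : ∀ {S T} → ArVar Δ S T → ArVar K (var (tot S)) (var (tot T))

open Code

restrict : ∀ {Δ d K} → Code (Δ ▹ d) K → Code Δ K
restrict κ = record { tot = λ T → tot κ (wk T) ; over = λ T → over κ (wk T) ; maps = λ f → maps κ (there f) }

weakenCode : ∀ {Δ K d} → Code Δ K → Code Δ (K ▹ d)
weakenCode κ = record
  { tot = λ T → there (tot κ T) ; over = λ T → there (over κ T) ; maps = λ f → there (maps κ f) }

-- Variables of B naming a Δ-structure and its inclusion into the total objects.
record Fibs {Δ K B} (κ : Code Δ K) (σ : Ren K B) : Set where
  field
    fib : Ren Δ B
    inc : ∀ T → ArVar B (fib · T) (var (onOb σ (tot κ T)))

open Fibs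

-- The terminal object of the slice is the identity of the base; its fibre at a point is `𝟙`,
-- included by the point itself.
emptyFibs : ∀ {K B} {κ : Code ∅ K} {σ : Ren K B} → ArVar K one (var (tot κ one)) → Fibs κ σ
emptyFibs {σ = σ} pt = record
  { fib = record { onOb = λ () ; onAr = λ () } ; inc = λ { one → onAr σ pt ; (var ()) } }

module _ {Δ K B : Ctx} where

  extendOb : {κ : Code (Δ ▹ ob) K} {σ : Ren K B} → Fibs (restrict κ) σ →
             Fibs {B = B ▹ ob ▹ var here ⇒ var (there (onOb σ (tot κ (var here))))} κ (↑ (↑ σ))
  extendOb F = record
    { fib = ↑ (↑ (fib F)) ,ob there here
    ; inc = λ { one             → there (there (inc F one))
              ; (var here)      → here
              ; (var (there v)) → there (there (inc F (var v))) } }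

  extendAr : ∀ {S T} {κ : Code (Δ ▹ S ⇒ T) K} {σ : Ren K B} (F : Fibs (restrict κ) σ) →
             Fibs {B = B ▹ fib F · S ⇒ fib F · T} κ (↑ σ)
  extendAr {S} {T} F = record
    { fib = ↑ (fib F) ,ar hereᴿ (onOb (fib F)) S T
    ; inc = λ { one             → there (inc F one)
              ; (var (there v)) → there (inc F (var v)) } }

module _ {B : Ctx} {F X U : ObVar B} where

  -- Stated with elements, since the language has no terms for pullbacks; the clauses are the fields
  -- of `IsFibre`.
  isFibre : ArVar B one (var U) → ArVar B (var X) (var U) → ArVar B (var F) (var X) → Formula B
  isFibre u a i =
      all (one ⇒ var F) ((var (there a) ∘ᵃ (var (there i) ∘ᵃ var here)) ≐ var (there u))
    ∧ (all (one ⇒ var F) (all (one ⇒ var (there F))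
        (((var (there (there i)) ∘ᵃ var (there here)) ≐ (var (there (there i)) ∘ᵃ var here))
          ⊃ (var (there here) ≐ var here)))
    ∧ all (one ⇒ var X) (((var (there a) ∘ᵃ var here) ≐ var (there u))
        ⊃ ex (one ⇒ var (there F)) ((var (there (there i)) ∘ᵃ var here) ≐ var (there here))))

-- Parametric in the context in which the fibre has been named, so that `elim` can bind the objects
-- and arrows of the fibre one at a time.
FibreFormula : ∀ {Δ K} → Code Δ K → Set
FibreFormula {K = K} κ = ∀ {B} (σ : Ren K B) → Fibs κ σ → Formula B

module _ {Δ K : Ctx} where

  elimOb : (κ : Code (Δ ▹ ob) K) → ArVar K one (var (tot κ one)) →
           FibreFormula κ → FibreFormula (restrict κ)
  elimOb κ pt φ σ F =
    ex ob (ex (var here ⇒ var (there (onOb σ (tot κ (var here)))))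
      (isFibre (onAr (↑ (↑ σ)) pt) (onAr (↑ (↑ σ)) (over κ (var here))) here
        ∧ φ (↑ (↑ σ)) (extendOb F)))

  elimAr : ∀ {S T} (κ : Code (Δ ▹ S ⇒ T) K) → FibreFormula κ → FibreFormula (restrict κ)
  elimAr {S} {T} κ φ σ F =
    ex (fib F · S ⇒ fib F · T)
      (((var (inc F⁺ (wk T)) ∘ᵃ var (onAr (fib F⁺) here))
         ≐ (var (onAr (↑ σ) (maps κ here)) ∘ᵃ var (inc F⁺ (wk S))))
        ∧ φ (↑ σ) F⁺)
    where F⁺ = extendAr {κ = κ} F

-- A fibre exists and is unique up to isomorphism, so binding it existentially loses nothing. The
-- last declaration of `Δ` becomes the innermost quantifier.
elim : ∀ {Δ K} (κ : Code Δ K) → ArVar K one (var (tot κ one)) → FibreFormula κ →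
       ∀ {B} → Ren K B → Formula B
elim {∅}         κ pt φ σ = φ σ (emptyFibs pt)
elim {Δ ▹ ob}    κ pt φ σ = elim (restrict κ) pt (elimOb κ pt φ) σ
elim {Δ ▹ S ⇒ T} κ pt φ σ = elim (restrict κ) pt (elimAr κ φ) σ

module FibreFormulas {C : Category ℓ} (E : ETCS C) where
  open Elements E
  open Families E

  record IsFibre {U A F : Obj} (u : El U) (a : Hom A U) (i : Hom F A) : Set ℓ where
    constructor fibre-of
    field
      lies-over : ∀ x → a ∘ i ∘ x ≈ u
      injective : Injective i
      covers    : ∀ z → a ∘ z ≈ u → z ∈ i

  open IsFibre public

  fibre-isFibre : ∀ {U} {u : El U} {X Z} (F : Fibre u X Z) → IsFibre u (arr X) (Fibre.incl F)
  fibre-isFibre {u = u} {X} F =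
    fibre-of (fibre-over u X F) (fibre-injective u X F) (fibre-covers u X F)

  Over : ∀ {Δ K} → Code Δ K → Env K → Set ℓ
  Over {Δ} κ k = ∀ {S T : Ob Δ} (f : ArVar Δ S T) →
    lookupAr k (over κ T) ∘ lookupAr k (maps κ f) ≈ lookupAr k (over κ S)

  module _ {K : Ctx} {k : Env K} where

    record Fibs⊨ {Δ B} {κ : Code Δ K} {σ : Ren K B} (pt : ArVar K one (var (tot κ one)))
                 (F : Fibs κ σ) (β : Env B) : Set ℓ where
      field
        isfib  : ∀ T → IsFibre (lookupAr β (onAr σ pt)) (lookupAr β (onAr σ (over κ T)))
                               (lookupAr β (inc F T))
        compat : ∀ {S T} (f : ArVar Δ S T) →
                 lookupAr β (inc F T) ∘ lookupAr β (onAr (fib F) f) ≈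
                 lookupAr β (onAr σ (maps κ f)) ∘ lookupAr β (inc F S)

    open Fibs⊨ public

    module _ {Δ B : Ctx} {σ : Ren K B} {β : Env B} where

      extendOb⊨ : {κ : Code (Δ ▹ ob) K} {pt : ArVar K one (var (tot κ one))}
                  {F : Fibs (restrict κ) σ} → Fibs⊨ pt F β →
                  ∀ {Z} {i : Hom Z (lookupOb β (onOb σ (tot κ (var here))))} →
                  IsFibre (lookupAr β (onAr σ pt)) (lookupAr β (onAr σ (over κ (var here)))) i →
                  Fibs⊨ {κ = κ} pt (extendOb F) (β ▷ Z ▷ i)
      isfib  (extendOb⊨ F⊨ fi) one             = isfib F⊨ one
      isfib  (extendOb⊨ F⊨ fi) (var here)      = fi
      isfib  (extendOb⊨ F⊨ fi) (var (there v)) = isfib F⊨ (var v)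
      compat (extendOb⊨ F⊨ fi) (there {S = one}   {one}   f) = compat F⊨ f
      compat (extendOb⊨ F⊨ fi) (there {S = one}   {var _} f) = compat F⊨ f
      compat (extendOb⊨ F⊨ fi) (there {S = var _} {one}   f) = compat F⊨ f
      compat (extendOb⊨ F⊨ fi) (there {S = var _} {var _} f) = compat F⊨ f

      module _ {S T} {κ : Code (Δ ▹ S ⇒ T) K} {pt : ArVar K one (var (tot κ one))}
               {F : Fibs (restrict κ) σ} {h : Hom (⟦ fib F · S ⟧ β) (⟦ fib F · T ⟧ β)} where

        private
          F⁺ = extendAr {κ = κ} F

        extendAr⊨ : Fibs⊨ pt F β →
                    β ▷ h ⊨ (var (inc F⁺ (wk T)) ∘ᵃ var (onAr (fib F⁺) here))
                          ≐ (var (onAr (↑ σ) (maps κ here)) ∘ᵃ var (inc F⁺ (wk S))) →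
                    Fibs⊨ {κ = κ} pt F⁺ (β ▷ h)
        isfib  (extendAr⊨ F⊨ e) one             = isfib F⊨ one
        isfib  (extendAr⊨ F⊨ e) (var (there v)) = isfib F⊨ (var v)
        compat (extendAr⊨ F⊨ e) here            = e
        compat (extendAr⊨ F⊨ e) (there {S = one}   {one}   f) = compat F⊨ f
        compat (extendAr⊨ F⊨ e) (there {S = one}   {var _} f) = compat F⊨ f
        compat (extendAr⊨ F⊨ e) (there {S = var _} {one}   f) = compat F⊨ f
        compat (extendAr⊨ F⊨ e) (there {S = var _} {var _} f) = compat F⊨ f

      compatible⁺ : ∀ S T {κ : Code (Δ ▹ S ⇒ T) K} {F : Fibs (restrict κ) σ}
                    {h : Hom (⟦ fib F · S ⟧ β) (⟦ fib F · T ⟧ β)} →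
                    lookupAr β (inc F T) ∘ h ≈
                      lookupAr β (onAr σ (maps κ here)) ∘ lookupAr β (inc F S) →
                    β ▷ h ⊨ (var (inc (extendAr {κ = κ} F) (wk T)) ∘ᵃ
                              var (onAr (fib (extendAr {κ = κ} F)) here))
                          ≐ (var (onAr (↑ σ) (maps κ here)) ∘ᵃ
                              var (inc (extendAr {κ = κ} F) (wk S)))
      compatible⁺ one     one     e = e
      compatible⁺ one     (var _) e = e
      compatible⁺ (var _) one     e = e
      compatible⁺ (var _) (var _) e = e

    -- The state reached when the quantifiers of `elim` have been instantiated: an environment
    -- extending `k` along `σ`, and a fibre named in it.
    record Solution {Δ} (κ : Code Δ K) (pt : ArVar K one (var (tot κ one))) : Set ℓ where
      field
        {B} : Ctx
        {σ} : Ren K B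
        {β} : Env B
        {F} : Fibs κ σ
        sim : Sim σ k β
        sem : Fibs⊨ pt F β

      Holds : FibreFormula κ → Set ℓ
      Holds φ = β ⊨ φ σ F

    open Solution public using (Holds)

    module _ {B} {σ : Ren K B} {β : Env B} (s : Sim σ k β) where

      empty⊨ : {κ : Code ∅ K} {pt : ArVar K one (var (tot κ one))} →
               lookupAr k (over κ one) ≈ id → Fibs⊨ {κ = κ} {σ} pt (emptyFibs pt) β
      isfib (empty⊨ {κ} {pt} idₖ) one = fibre-of
        (λ x → ∘-congʳ idᵦ ⨾ identityˡ ⨾ ∘-congˡ el-𝟙 ⨾ identityʳ)
        (λ _ _ _ → el-𝟙)
        (λ z e → id , identityʳ ⨾ ≈-sym e ⨾ ∘-congʳ idᵦ ⨾ identityˡ)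
        where idᵦ = sim-⊨ s (var (over κ one) ≐ idᵃ) idₖ
      compat (empty⊨ _) ()

      over-β : ∀ {Δ} {κ : Code Δ K} → Over κ k → ∀ {S T} (f : ArVar Δ S T) →
               lookupAr β (onAr σ (over κ T)) ∘ lookupAr β (onAr σ (maps κ f)) ≈
               lookupAr β (onAr σ (over κ S))
      over-β {κ = κ} o {S} {T} f =
        sim-⊨ s ((var (over κ T) ∘ᵃ var (maps κ f)) ≐ var (over κ S)) (o f)

      fibreMap-exists : ∀ {Δ S T} {κ : Code Δ K} {pt : ArVar K one (var (tot κ one))} {F : Fibs κ σ} →
        Fibs⊨ pt F β → {m : ArVar K (var (tot κ S)) (var (tot κ T))} →
        lookupAr β (onAr σ (over κ T)) ∘ lookupAr β (onAr σ m) ≈ lookupAr β (onAr σ (over κ S)) →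
        Σ[ h ∈ Hom (⟦ fib F · S ⟧ β) (⟦ fib F · T ⟧ β) ]
          lookupAr β (inc F T) ∘ h ≈ lookupAr β (onAr σ m) ∘ lookupAr β (inc F S)
      fibreMap-exists {S = S} {T} {F = F} F⊨ {m} o =
        factor (lookupAr β (inc F T)) (lookupAr β (onAr σ m) ∘ lookupAr β (inc F S)) λ x →
          covers (isfib F⊨ T) _
            (∘-congˡ assoc ⨾ pullˡ o ⨾ lies-over (isfib F⊨ S) x)

    module _ {Δ} {κ : Code (Δ ▹ ob) K} {pt : ArVar K one (var (tot κ one))}
             (X : Solution (restrict κ) pt) where
      open Solution X hiding (Holds)

      solutionOb : ∀ {Z} {i : Hom Z (lookupOb β (onOb σ (tot κ (var here))))} →
        IsFibre (lookupAr β (onAr σ pt)) (lookupAr β (onAr σ (over κ (var here)))) i →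
        Solution κ pt
      solutionOb {Z} {i} fi = record
        { sim = sim-↑ (sim-↑ sim {ob} {Z}) {var here ⇒ var (there (onOb σ (tot κ (var here))))} {i}
        ; sem = extendOb⊨ {κ = κ} sem fi }

      elimOb⇒ : (φ : FibreFormula κ) → Holds X (elimOb κ pt φ) → Σ[ Y ∈ Solution κ pt ] Holds Y φ
      elimOb⇒ φ (Z , i , (a , b , c) , q) = solutionOb (fibre-of a b c) , q

      elimOb⇐ : (φ : FibreFormula κ) → Σ[ Y ∈ Solution κ pt ] (Holds Y φ → Holds X (elimOb κ pt φ))
      elimOb⇐ φ = solutionOb fi , λ q → _ , _ , (lies-over fi , injective fi , covers fi) , q
        where
        fi = fibre-isFibre (fibre (lookupAr β (onAr σ pt))
               (lookupOb β (onOb σ (tot κ (var here))) ↓ lookupAr β (onAr σ (over κ (var here)))))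

    module _ {Δ S T} {κ : Code (Δ ▹ S ⇒ T) K} {pt : ArVar K one (var (tot κ one))}
             (X : Solution (restrict κ) pt) where
      open Solution X hiding (Holds)

      elimAr⇒ : (φ : FibreFormula κ) → Holds X (elimAr κ φ) → Σ[ Y ∈ Solution κ pt ] Holds Y φ
      elimAr⇒ φ (h , e , q) = record
        { sim = sim-↑ sim {fib F · S ⇒ fib F · T} {h} ; sem = extendAr⊨ {κ = κ} sem e } , q

      elimAr⇐ : Over κ k → (φ : FibreFormula κ) → Σ[ Y ∈ Solution κ pt ] (Holds Y φ → Holds X (elimAr κ φ))
      elimAr⇐ o φ = record
        { sim = sim-↑ sim {fib F · S ⇒ fib F · T} {proj₁ exists} ; sem = extendAr⊨ {κ = κ} sem e⁺ } ,
        λ q → proj₁ exists , e⁺ , q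
        where
        exists = fibreMap-exists sim {S = S} {T} {restrict κ} {pt} {F} sem {maps κ here}
                    (over-β sim {κ = κ} o here)
        e⁺ = compatible⁺ S T {κ} {F} (proj₂ exists)

    elim⇒ : ∀ {Δ} (κ : Code Δ K) {pt} (φ : FibreFormula κ) → lookupAr k (over κ one) ≈ id →
            ∀ {B} {σ : Ren K B} {β} → Sim σ k β → β ⊨ elim κ pt φ σ →
            Σ[ X ∈ Solution κ pt ] Holds X φ
    elim⇒ {∅} κ φ idₖ s p = record { sim = s ; sem = empty⊨ s {κ} idₖ } , p
    elim⇒ {Δ ▹ ob} κ {pt} φ idₖ s p =
      let X , q = elim⇒ (restrict κ) (elimOb κ pt φ) idₖ s p in elimOb⇒ X φ q
    elim⇒ {Δ ▹ S ⇒ T} κ {pt} φ idₖ s p =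
      let X , q = elim⇒ (restrict κ) (elimAr κ φ) idₖ s p in elimAr⇒ X φ q

    -- The solution is built from chosen pullbacks and induced maps, before anything is known about
    -- `φ`; that `φ` holds there can then be proved by matching it with another fibre.
    elim⇐ : ∀ {Δ} (κ : Code Δ K) {pt} (φ : FibreFormula κ) →
            lookupAr k (over κ one) ≈ id → Over κ k →
            ∀ {B} {σ : Ren K B} {β} → Sim σ k β →
            Σ[ X ∈ Solution κ pt ] (Holds X φ → β ⊨ elim κ pt φ σ)
    elim⇐ {∅} κ φ idₖ o s = record { sim = s ; sem = empty⊨ s {κ} idₖ } , λ p → p
    elim⇐ {Δ ▹ ob} κ {pt} φ idₖ o s =
      let X , r = elim⇐ (restrict κ) (elimOb κ pt φ) idₖ (λ f → o (there f)) s
          Y , q = elimOb⇐ X φ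
      in Y , λ p → r (q p)
    elim⇐ {Δ ▹ S ⇒ T} κ {pt} φ idₖ o s =
      let X , r = elim⇐ (restrict κ) (elimAr κ φ) idₖ (λ f → o (there f)) s
          Y , q = elimAr⇐ X o φ
      in Y , λ p → r (q p)

-- r codes the function h as a subset of a product through the relation (e , a , b),
-- the domain and codomain of h being included by i and j.
codesGraph : ∀ {B} {S T : Ob B} {X Y P M : ObVar B} →
             ArVar B S (var X) → ArVar B T (var Y) → ArVar B one (var P) →
             ArVar B (var M) (var P) → ArVar B (var M) (var X) → ArVar B (var M) (var Y) →
             Formula (B ▹ S ⇒ T)
codesGraph {S = S} {M = M} i j r e a b =
    all (one ⇒ wk S) (ex (one ⇒ var (there (there M))) (value ∧ (argument ∧ result)))
  ∧ all (one ⇒ wk S) (all (one ⇒ var (there (there M))) (value ⊃ (argument ⊃ result)))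
  where
  value    = (var (there (there (there e))) ∘ᵃ var here) ≐ var (there (there (there r)))
  argument = (var (there (there (there a))) ∘ᵃ var here)
           ≐ (var (there (there (there i))) ∘ᵃ var (there here))
  result   = (var (there (there (there b))) ∘ᵃ var here)
           ≐ (var (there (there (there j))) ∘ᵃ (var (there (there here)) ∘ᵃ var (there here)))

codedArrow : ∀ {Δ K} (κ : Code Δ K) {S T : Ob Δ} {P M : ObVar K} →
             ArVar K one (var P) → ArVar K (var M) (var P) →
             ArVar K (var M) (var (tot κ S)) → ArVar K (var M) (var (tot κ T)) →
             Formula (Δ ▹ S ⇒ T) → FibreFormula κ
codedArrow κ {S} {T} r e a b φ σ F = ex (fib F · S ⇒ fib F · T)
  (codesGraph (inc F S) (inc F T) (onAr σ r) (onAr σ e) (onAr σ a) (onAr σ b)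
    ∧ ren (lift (fib F) (S ⇒ T)) φ)

module _ {Δ K : Ctx} (κ : Code Δ K) where

  codeOb : Code (Δ ▹ ob) (K ▹ ob ▹ var here ⇒ var (there (tot κ one)))
  tot  codeOb one             = there (there (tot κ one))
  tot  codeOb (var here)      = there here
  tot  codeOb (var (there v)) = there (there (tot κ (var v)))
  over codeOb one             = there (there (over κ one))
  over codeOb (var here)      = here
  over codeOb (var (there v)) = there (there (over κ (var v)))
  maps codeOb (there {S = one}   {one}   f) = there (there (maps κ f))
  maps codeOb (there {S = one}   {var _} f) = there (there (maps κ f))
  maps codeOb (there {S = var _} {one}   f) = there (there (maps κ f))
  maps codeOb (there {S = var _} {var _} f) = there (there (maps κ f))

  module _ (S T : Ob Δ) where
    private
      K⁺ = K ▹ var (tot κ S) ⇒ var (tot κ T)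

      tot⁺ : Ob (Δ ▹ S ⇒ T) → ObVar K⁺
      tot⁺ one             = there (tot κ one)
      tot⁺ (var (there v)) = there (tot κ (var v))

      shift : ∀ P Q → ArVar K⁺ (var (there (tot κ P))) (var (there (tot κ Q))) →
              ArVar K⁺ (var (tot⁺ (wk P))) (var (tot⁺ (wk Q)))
      shift one     one     f = f
      shift one     (var _) f = f
      shift (var _) one     f = f
      shift (var _) (var _) f = f

    codeAr : Code (Δ ▹ S ⇒ T) K⁺
    tot  codeAr = tot⁺
    over codeAr one             = there (over κ one)
    over codeAr (var (there v)) = there (over κ (var v))
    maps codeAr here                  = shift S T here
    maps codeAr (there {S = P} {Q} g) = shift P Q (there (maps κ g))

-- Encoding a slice environment; collecting an object over it

module SliceFamilies {C : Category ℓ} (E : ETCS C) (U₀ : Category.Obj C) where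
  open Elements E
  open Families E
  open FibreFormulas E

  module Sl = Interpretation (Slice C U₀) (1/ C U₀)

  -- Says that `δ` is a pullback of `ε` along `u` without fixing a choice of pullbacks.
  record FibreEnv {Δ} (u : El U₀) (ε : Sl.Env Δ) (δ : Env Δ) : Set ℓ where
    field
      incl    : ∀ T → Hom (⟦ T ⟧ δ) (total (Sl.⟦ T ⟧ ε))
      isFib   : ∀ T → IsFibre u (arr (Sl.⟦ T ⟧ ε)) (incl T)
      natural : ∀ {S T} (f : ArVar Δ S T) →
                incl T ∘ lookupAr δ f ≈ map (Sl.lookupAr ε f) ∘ incl S

  -- `encode` stores the total objects themselves, but this is visible only case by case in `T`; the
  -- isomorphisms `θ` replace transports along equalities of objects.
  record Encoding {Δ K} (κ : Code Δ K) (ε : Sl.Env Δ) (k : Env K) : Set ℓ where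
    field
      θ      : ∀ T → total (Sl.⟦ T ⟧ ε) ≅ lookupOb k (tot κ T)
      θ-over : ∀ T → lookupAr k (over κ T) ∘ to (θ T) ≈ to (θ one) ∘ arr (Sl.⟦ T ⟧ ε)
      θ-maps : ∀ {S T} (f : ArVar Δ S T) →
               lookupAr k (maps κ f) ∘ to (θ S) ≈ to (θ T) ∘ map (Sl.lookupAr ε f)

    over-one : lookupAr k (over κ one) ≈ id
    over-one = iso-cancelʳ (θ one) (θ-over one ⨾ identityʳ ⨾ ≈-sym identityˡ)

    over-maps : Over κ k
    over-maps {S} {T} f = iso-cancelʳ (θ S)
      (pullʳ (θ-maps f) ⨾ pullˡ (θ-over T) ⨾ pullʳ (triangle (Sl.lookupAr ε f)) ⨾ ≈-sym (θ-over S))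

  open Encoding

  weakenEncoding : ∀ {Δ K} {κ : Code Δ K} {ε : Sl.Env Δ} {k : Env K} → Encoding κ ε k →
                   ∀ {d : Decl K} {x : ⟦ d ⟧ᵈ k} → Encoding (weakenCode {d = d} κ) ε (_▷_ {d = d} k x)
  weakenEncoding c = record { θ = θ c ; θ-over = θ-over c ; θ-maps = θ-maps c }

  module Match {Δ K} {κ : Code Δ K} {ε : Sl.Env Δ} {k : Env K} (c : Encoding κ ε k)
               {pt : ArVar K one (var (tot κ one))} (X : Solution {k = k} κ pt) where
    open Solution X

    τ : ∀ T → total (Sl.⟦ T ⟧ ε) ≅ lookupOb β (onOb σ (tot κ T))
    τ T = ≅-trans (θ c T) (iso sim (tot κ T))

    n : ∀ T → Hom (⟦ fib F · T ⟧ β) (lookupOb β (onOb σ (tot κ T)))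
    n T = lookupAr β (inc F T)

    τ-over : ∀ T → lookupAr β (onAr σ (over κ T)) ∘ to (τ T) ≈ to (τ one) ∘ arr (Sl.⟦ T ⟧ ε)
    τ-over T = pullˡ (≈-sym (square sim (over κ T))) ⨾ pullʳ (θ-over c T) ⨾ ≈-sym assoc

    τ-maps : ∀ {S T} (f : ArVar Δ S T) →
             lookupAr β (onAr σ (maps κ f)) ∘ to (τ S) ≈ to (τ T) ∘ map (Sl.lookupAr ε f)
    τ-maps f = pullˡ (≈-sym (square sim (maps κ f))) ⨾ pullʳ (θ-maps c f) ⨾ ≈-sym assoc

    point : to (iso sim (tot κ one)) ∘ lookupAr k pt ≈ lookupAr β (onAr σ pt)
    point = square sim pt ⨾ identityʳ

    module _ {u : El U₀} {δ : Env Δ} (base : lookupAr k pt ≈ to (θ c one) ∘ u)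
             (D : FibreEnv u ε δ) where
      open FibreEnv D

      point-τ : lookupAr β (onAr σ pt) ≈ to (τ one) ∘ u
      point-τ = ≈-sym point ⨾ ∘-congˡ base ⨾ ≈-sym assoc

      m : ∀ T → Hom (⟦ T ⟧ δ) (lookupOb β (onOb σ (tot κ T)))
      m T = to (τ T) ∘ incl T

      m-injective : ∀ T → Injective (m T)
      m-injective T x y e = injective (isFib T) x y
        (iso-cancelˡ (τ T) (≈-sym assoc ⨾ e ⨾ assoc))

      m⊆n : ∀ T x → (m T ∘ x) ∈ n T
      m⊆n T x = covers (isfib sem T) _
        (∘-congˡ assoc ⨾ pullˡ (τ-over T) ⨾ pullʳ (lies-over (isFib T) x) ⨾ ≈-sym point-τ)

      n⊆m : ∀ T y → (n T ∘ y) ∈ m T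
      n⊆m T y = let x , e = covers (isFib T) (from (τ T) ∘ n T ∘ y) (iso-cancelˡ (τ one)
                      (pullˡ (≈-sym (τ-over T)) ⨾ pullʳ (cancelˡ (to∘from (τ T)))
                       ⨾ lies-over (isfib sem T) y ⨾ point-τ))
                in x , (pullʳ e ⨾ cancelˡ (to∘from (τ T)))

      same : ∀ T → Σ[ i ∈ ⟦ T ⟧ δ ≅ ⟦ fib F · T ⟧ β ] n T ∘ to i ≈ m T
      same T = sameImage⇒iso (m-injective T) (injective (isfib sem T)) (m⊆n T) (n⊆m T)

      i : ∀ v → lookupOb δ v ≅ lookupOb β (onOb (fib F) v)
      i v = proj₁ (same (var v))

      i-inc : ∀ T → n T ∘ to (mapIso {r = onOb (fib F)} i T) ≈ m T
      i-inc one     = ∘-congˡ el-𝟙 ⨾ proj₂ (same one)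
      i-inc (var v) = proj₂ (same (var v))

      -- Both structures embed in the same total objects, up to `τ`, and have there the same
      -- elements, those over `u`. The resulting isomorphisms commute with the arrows because the
      -- inclusions are monic.
      matches : Sim (fib F) δ β
      matches = record
        { iso    = i
        ; square = λ {S} {T} f → injective⇒mono (injective (isfib sem T)) _ _
            (pullˡ (i-inc T) ⨾ pullʳ (natural f) ⨾ pullˡ (≈-sym (τ-maps f)) ⨾ pullʳ (≈-sym (i-inc S))
             ⨾ pullˡ (≈-sym (compat sem f)) ⨾ assoc)
        }

  encode : ∀ {Δ} (ε : Sl.Env Δ) →
           Σ[ K ∈ Ctx ] Σ[ k ∈ Env K ] Σ[ κ ∈ Code Δ K ] Encoding κ ε k
  encode Sl.[] = ∅ ▹ ob ▹ var here ⇒ var here , [] ▷ U₀ ▷ id ,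
    record { tot = λ { one → there here ; (var ()) }
           ; over = λ { one → here ; (var ()) }
           ; maps = λ () } ,
    record { θ = λ { one → ≅-refl ; (var ()) }
           ; θ-over = λ { one → ≈-refl ; (var ()) }
           ; θ-maps = λ () }
  encode (Sl._▷_ {Δ} {ob} ε A) =
    let K , k , κ , c = encode ε in
    K ▹ ob ▹ var here ⇒ var (there (tot κ one)) , k ▷ total A ▷ to (θ c one) ∘ arr A ,
    codeOb κ , encodingOb c
    where
    encodingOb : ∀ {K k} {κ : Code Δ K} (c : Encoding κ ε k) →
                 Encoding (codeOb κ) (ε Sl.▷ A) (k ▷ total A ▷ to (θ c one) ∘ arr A)
    θ (encodingOb c) one             = θ c one
    θ (encodingOb c) (var here)      = ≅-refl
    θ (encodingOb c) (var (there v)) = θ c (var v)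
    θ-over (encodingOb c) one             = θ-over c one
    θ-over (encodingOb c) (var here)      = identityʳ
    θ-over (encodingOb c) (var (there v)) = θ-over c (var v)
    θ-maps (encodingOb c) (there {S = one}   {one}   f) = θ-maps c f
    θ-maps (encodingOb c) (there {S = one}   {var _} f) = θ-maps c f
    θ-maps (encodingOb c) (there {S = var _} {one}   f) = θ-maps c f
    θ-maps (encodingOb c) (there {S = var _} {var _} f) = θ-maps c f
  encode (Sl._▷_ {Δ} {S ⇒ T} ε f) =
    let K , k , κ , c = encode ε in
    K ▹ var (tot κ S) ⇒ var (tot κ T) , k ▷ to (θ c T) ∘ map f ∘ from (θ c S) ,
    codeAr κ S T , encodingAr c
    where
    module _ {K k} {κ : Code Δ K} (c : Encoding κ ε k) where
      θ⁺ : {S T : Ob Δ} (f : Sl.⟦ S ⇒ T ⟧ᵈ ε) (P : Ob (Δ ▹ S ⇒ T)) →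
           total (Sl.⟦ P ⟧ (ε Sl.▷ f)) ≅
           lookupOb (k ▷ to (θ c T) ∘ map f ∘ from (θ c S)) (tot (codeAr κ S T) P)
      θ⁺ f one             = θ c one
      θ⁺ f (var (there v)) = θ c (var v)

      θ-here : ∀ S T (f : Sl.⟦ S ⇒ T ⟧ᵈ ε) →
               lookupAr (k ▷ to (θ c T) ∘ map f ∘ from (θ c S)) (maps (codeAr κ S T) (here {S = S} {T}))
                 ∘ to (θ⁺ f (wk S))
               ≈ to (θ⁺ f (wk T)) ∘ map (Sl.lookupAr (Sl._▷_ {d = S ⇒ T} ε f) (here {S = S} {T}))
      θ-here one     one     f = pullʳ (cancelʳ (from∘to (θ c one)))
      θ-here one     (var _) f = pullʳ (cancelʳ (from∘to (θ c one)))
      θ-here (var v) one     f = pullʳ (cancelʳ (from∘to (θ c (var v))))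
      θ-here (var v) (var _) f = pullʳ (cancelʳ (from∘to (θ c (var v))))

      encodingAr : Encoding (codeAr κ S T) (ε Sl.▷ f) (k ▷ to (θ c T) ∘ map f ∘ from (θ c S))
      θ encodingAr = θ⁺ f
      θ-over encodingAr one             = θ-over c one
      θ-over encodingAr (var (there v)) = θ-over c (var v)
      θ-maps encodingAr here                            = θ-here S T f
      θ-maps encodingAr (there {S = one}   {one}   g) = θ-maps c g
      θ-maps encodingAr (there {S = one}   {var _} g) = θ-maps c g
      θ-maps encodingAr (there {S = var _} {one}   g) = θ-maps c g
      θ-maps encodingAr (there {S = var _} {var _} g) = θ-maps c g

  module _ (strong : StrongCollection) {Δ} (ε : Sl.Env Δ) (δ : El U₀ → Env Δ)
           (D : ∀ u → FibreEnv u ε (δ u)) where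

    -- `φ` speaks of `δ u`, which varies with `u` and so cannot be a parameter of `strong`. The
    -- encoded total objects of `ε` can, and `elim` recovers the fibre from them.
    sliceOb : (φ : Formula (Δ ▹ ob)) → (∀ u → Σ[ X ∈ Obj ] (δ u ▷ X ⊨ φ)) →
              Σ[ A ∈ SliceObj C U₀ ] (∀ u → δ u ▷ total (u ^* A) ⊨ φ)
    sliceOb φ h = fromEncoding (proj₂ (proj₂ (proj₂ (encode ε))))
      where
      module _ {K} {k : Env K} {κ : Code Δ K} (c : Encoding κ ε k) where
        κ⁺ : Code Δ (K ▹ one ⇒ var (tot κ one) ▹ ob)
        κ⁺ = weakenCode (weakenCode κ)

        φ⁺ : FibreFormula κ⁺
        φ⁺ σ F = ren (fib F ,ob onOb σ here) φ

        module _ (u : El U₀) {u′ : El (lookupOb k (tot κ one))} (e : u′ ≈ to (θ c one) ∘ u)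
                 {X : Obj} where
          k⁺ : Env (K ▹ one ⇒ var (tot κ one) ▹ ob)
          k⁺ = k ▷ u′ ▷ X

          c⁺ : Encoding κ⁺ ε k⁺
          c⁺ = weakenEncoding (weakenEncoding c {one ⇒ var (tot κ one)}) {ob}

          matchesOb : (S : Solution κ⁺ (there here)) →
                      Sim (fib (Solution.F S) ,ob onOb (Solution.σ S) here) (δ u ▷ X) (Solution.β S)
          matchesOb S = sim-ob (Match.matches c⁺ S e (D u)) (iso (Solution.sim S) here)

          there⇒ : δ u ▷ X ⊨ φ → k⁺ ⊨ elim κ⁺ (there here) φ⁺ idᴿ
          there⇒ p = let S , r = elim⇐ κ⁺ φ⁺ (over-one c⁺) (over-maps c⁺) sim-id
                     in r (sim-⊨ (matchesOb S) φ p)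

          there⇐ : k⁺ ⊨ elim κ⁺ (there here) φ⁺ idᴿ → δ u ▷ X ⊨ φ
          there⇐ p = let S , q = elim⇒ κ⁺ φ⁺ (over-one c⁺) sim-id p
                     in sim-⊨⁻ (matchesOb S) φ q

        fromEncoding : Σ[ A ∈ SliceObj C U₀ ] (∀ u → δ u ▷ total (u ^* A) ⊨ φ)
        fromEncoding =
          let A , good = strong (tot κ one) (elim κ⁺ (there here) φ⁺ idᴿ) k λ u′ →
                let X , p = h (from (θ c one) ∘ u′)
                in X , there⇒ _ (≈-sym (cancelˡ (to∘from (θ c one)))) p
              -- The family found lies over the copy of the base named in `k`; this moves it over
              -- `U₀`.
              A′ = total A ↓ (from (θ c one) ∘ arr A)
          in A′ , λ u →
            let u′ = to (θ c one) ∘ u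
                F = fibre-isFibre (fibre u′ A)
                G = fibre-isFibre (fibre u A′)
                i = sameImage⇒iso (injective F) (injective G)
                      (λ x → covers G _ (pullʳ (lies-over F x) ⨾ cancelˡ (from∘to (θ c one))))
                      (λ x → covers F _ (iso-cancelˡ (≅-sym (θ c one))
                         (≈-sym assoc ⨾ lies-over G x ⨾ ≈-sym (cancelˡ (from∘to (θ c one))))))
            in invariant (sim-lift-ob sim-id (proj₁ i)) (sim-lift-ob sim-id ≅-refl) φ
                 (there⇐ u ≈-refl (good u′))

-- Collecting an arrow over a slice environment

module SliceArrows {C : Category ℓ} (E : ETCS C) (U₀ : Category.Obj C) where
  open Elements E
  open Families E
  open FibreFormulas E
  open SliceFamilies E U₀

  IsGraph : ∀ {S T X Y P M : Obj} → Hom S X → Hom T Y → El P →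
            Hom M P → Hom M X → Hom M Y → Hom S T → Set ℓ
  IsGraph {S} {M = M} i j r e a b h =
    (∀ (x : El S) → Σ[ z ∈ El M ] (e ∘ z ≈ r) × ((a ∘ z ≈ i ∘ x) × (b ∘ z ≈ j ∘ h ∘ x))) ×
    (∀ (x : El S) (z : El M) → e ∘ z ≈ r → a ∘ z ≈ i ∘ x → b ∘ z ≈ j ∘ h ∘ x)

  codesGraph⊨ : ∀ {B} {β : Env B} (S T : Ob B) {X Y P M : ObVar B}
    {i : ArVar B S (var X)} {j : ArVar B T (var Y)} {r : ArVar B one (var P)}
    {e : ArVar B (var M) (var P)} {a : ArVar B (var M) (var X)} {b : ArVar B (var M) (var Y)}
    {h : Hom (⟦ S ⟧ β) (⟦ T ⟧ β)} →
    (β ▷ h ⊨ codesGraph i j r e a b) ⇔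
    IsGraph (lookupAr β i) (lookupAr β j) (lookupAr β r) (lookupAr β e) (lookupAr β a) (lookupAr β b) h
  codesGraph⊨ one     one     = mk⇔ (λ g → g) (λ g → g)
  codesGraph⊨ one     (var _) = mk⇔ (λ g → g) (λ g → g)
  codesGraph⊨ (var _) one     = mk⇔ (λ g → g) (λ g → g)
  codesGraph⊨ (var _) (var _) = mk⇔ (λ g → g) (λ g → g)

  module _ {Δ} (ε : Sl.Env Δ) (δ : El U₀ → Env Δ) (D : ∀ u → FibreEnv u ε (δ u))
           {S T : Ob Δ} (φ : Formula (Δ ▹ S ⇒ T)) where

    -- The parameters name an element of the base, and an element r of P coding
    -- through (e , a , b) a relation between the total objects of S and T.
    module Coded {K} {k : Env K} {κ : Code Δ K} (c : Encoding κ ε k)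
                 (pt : ArVar K one (var (tot κ one))) {P M : ObVar K}
                 (rᵛ : ArVar K one (var P)) (eᵛ : ArVar K (var M) (var P))
                 (aᵛ : ArVar K (var M) (var (tot κ S))) (bᵛ : ArVar K (var M) (var (tot κ T))) where
      open Encoding c using (θ; over-one; over-maps)

      φᶜ : FibreFormula κ
      φᶜ = codedArrow κ rᵛ eᵛ aᵛ bᵛ φ

      u′ = lookupAr k pt
      r  = lookupAr k rᵛ
      e  = lookupAr k eᵛ
      a  = lookupAr k aᵛ
      b  = lookupAr k bᵛ

      A  = lookupOb k (tot κ S)
      B′ = lookupOb k (tot κ T)

      NamesGraph : (u : El U₀) → Hom (⟦ S ⟧ (δ u)) (⟦ T ⟧ (δ u)) → Set ℓ
      NamesGraph u f =
        (∀ x → Σ[ z ∈ El (lookupOb k M) ] (e ∘ z ≈ r) ×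
           ((a ∘ z ≈ (to (θ S) ∘ incl S) ∘ x) × (b ∘ z ≈ (to (θ T) ∘ incl T) ∘ f ∘ x))) ×
        (∀ z → e ∘ z ≈ r → Σ[ x ∈ El (⟦ S ⟧ (δ u)) ]
           (a ∘ z ≈ (to (θ S) ∘ incl S) ∘ x) × (b ∘ z ≈ (to (θ T) ∘ incl T) ∘ f ∘ x))
        where open FibreEnv (D u) using (incl)

      module At (X : Solution {k = k} κ pt) where
        open Solution X public hiding (Holds)
        open Match {k = k} c X public

        rᵦ = lookupAr β (onAr σ rᵛ)
        eᵦ = lookupAr β (onAr σ eᵛ)
        aᵦ = lookupAr β (onAr σ aᵛ)
        bᵦ = lookupAr β (onAr σ bᵛ)

        ιᴾ = iso sim P
        ιᴹ = iso sim M
        ιᴬ = iso sim (tot κ S)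
        ιᴮ = iso sim (tot κ T)

        r-square : to ιᴾ ∘ r ≈ rᵦ
        r-square = square sim rᵛ ⨾ identityʳ

        e-square : to ιᴾ ∘ e ≈ eᵦ ∘ to ιᴹ
        e-square = square sim eᵛ

        a-square : to ιᴬ ∘ a ≈ aᵦ ∘ to ιᴹ
        a-square = square sim aᵛ

        b-square : to ιᴮ ∘ b ≈ bᵦ ∘ to ιᴹ
        b-square = square sim bᵛ

        Graphᵦ : Hom (⟦ fib F · S ⟧ β) (⟦ fib F · T ⟧ β) → Set ℓ
        Graphᵦ = IsGraph (n S) (n T) rᵦ eᵦ aᵦ bᵦ

        pushed : ∀ {z p} → e ∘ z ≈ r → a ∘ z ≈ p →
                 (eᵦ ∘ to ιᴹ ∘ z ≈ rᵦ) × (aᵦ ∘ to ιᴹ ∘ z ≈ to ιᴬ ∘ p)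
        pushed ez az = pullˡ (≈-sym e-square) ⨾ pullʳ ez ⨾ r-square ,
                       pullˡ (≈-sym a-square) ⨾ pullʳ az

        pulled : ∀ {z} →
                 eᵦ ∘ z ≈ rᵦ → Σ[ z₀ ∈ El (lookupOb k M) ] (to ιᴹ ∘ z₀ ≈ z) × (e ∘ z₀ ≈ r)
        pulled {z} ez = from ιᴹ ∘ z , cancelˡ (to∘from ιᴹ) , iso-cancelˡ ιᴾ
          (pullˡ e-square ⨾ pullʳ (cancelˡ (to∘from ιᴹ)) ⨾ ez ⨾ ≈-sym r-square)

        over-n : ∀ Q {p} {y} → n Q ∘ y ≈ to (iso sim (tot κ Q)) ∘ p →
                 lookupAr k (over κ Q) ∘ p ≈ u′
        over-n Q {p} {y} ny = iso-cancelˡ (iso sim (tot κ one))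
          (pullˡ (square sim (over κ Q)) ⨾ pullʳ (≈-sym ny) ⨾ lies-over (isfib sem Q) y ⨾ ≈-sym point)

        lift-A : ∀ p → lookupAr k (over κ S) ∘ p ≈ u′ → (to ιᴬ ∘ p) ∈ n S
        lift-A p o = covers (isfib sem S) _
          (pullˡ (≈-sym (square sim (over κ S))) ⨾ pullʳ o ⨾ point)

        module _ (h : Hom (⟦ fib F · S ⟧ β) (⟦ fib F · T ⟧ β)) (graph : Graphᵦ h) where

          value : ∀ {p z y} → n S ∘ y ≈ to ιᴬ ∘ p → e ∘ z ≈ r → a ∘ z ≈ p →
                  n T ∘ h ∘ y ≈ to ιᴮ ∘ b ∘ z
          value q ez az =
            let e′ , a′ = pushed ez az
            in ≈-sym (proj₂ graph _ _ e′ (a′ ⨾ ≈-sym q)) ⨾ pullˡ (≈-sym b-square) ⨾ assoc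

          defined : ∀ p → lookupAr k (over κ S) ∘ p ≈ u′ →
                    Σ[ z ∈ El (lookupOb k M) ] (e ∘ z ≈ r) × (a ∘ z ≈ p)
          defined p o =
            let y , q = lift-A p o
                z , ez , az , _ = proj₁ graph y
                z₀ , zz , e₀ = pulled ez
            in z₀ , e₀ , iso-cancelˡ ιᴬ (pullˡ a-square ⨾ pullʳ zz ⨾ az ⨾ q)

          value-over : ∀ {p z} → lookupAr k (over κ S) ∘ p ≈ u′ → e ∘ z ≈ r → a ∘ z ≈ p →
                       lookupAr k (over κ T) ∘ b ∘ z ≈ u′
          value-over o ez az = let y , q = lift-A _ o in over-n T (value q ez az)

        module _ (u : El U₀) (base : u′ ≈ to (θ one) ∘ u) where
          open FibreEnv (D u) using (incl)

          s : Sim (fib F) (δ u) β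
          s = matches base (D u)

          iS = isoOb s S
          iT = isoOb s T

          nS : ∀ (x : El (⟦ S ⟧ (δ u))) → to ιᴬ ∘ (to (θ S) ∘ incl S) ∘ x ≈ n S ∘ to iS ∘ x
          nS x = ≈-sym assoc ⨾ ∘-congʳ (≈-sym assoc ⨾ ≈-sym (i-inc base (D u) S)) ⨾ assoc

          nT : ∀ (x : El (⟦ T ⟧ (δ u))) → to ιᴮ ∘ (to (θ T) ∘ incl T) ∘ x ≈ n T ∘ to iT ∘ x
          nT x = ≈-sym assoc ⨾ ∘-congʳ (≈-sym assoc ⨾ ≈-sym (i-inc base (D u) T)) ⨾ assoc

          module _ (f : Hom (⟦ S ⟧ (δ u)) (⟦ T ⟧ (δ u))) where

            -- `h` is read off the code on the elements of the fibre, and `f` is a restriction of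
            -- `g`, which decodes the same code; the injective `n T` reduces their equality to one
            -- of values.
            agrees : (h : Hom (⟦ fib F · S ⟧ β) (⟦ fib F · T ⟧ β)) → Graphᵦ h → ∀ {g : Hom A B′} →
              (∀ p → lookupAr k (over κ S) ∘ p ≈ u′ →
                Σ[ z ∈ El (lookupOb k M) ] (e ∘ z ≈ r) × ((a ∘ z ≈ p) × (b ∘ z ≈ g ∘ p))) →
              (to (θ T) ∘ incl T) ∘ f ≈ g ∘ to (θ S) ∘ incl S →
              to iT ∘ f ≈ h ∘ to iS
            agrees h graph spec gf = generator _ _ λ x →
              let q = ≈-sym (nS x)
                  z , ez , az , bz = spec _ (over-n S q)
              in injective (isfib sem T) _ _
                (∘-congˡ assoc ⨾ ≈-sym (nT (f ∘ x)) ⨾ ∘-congˡ (pullˡ gf ⨾ assoc ⨾ ≈-sym bz)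
                 ⨾ ≈-sym (value h graph q ez az) ⨾ ∘-congˡ (≈-sym assoc))

            codes : NamesGraph u f → Graphᵦ (to iT ∘ f ∘ from iS)
            codes (total , only) =
              (λ y → let x = from iS ∘ y
                         iSx = cancelˡ (to∘from iS)
                         z , ez , az , bz = total x
                         e′ , a′ = pushed ez az
                     in to ιᴹ ∘ z , e′ , (a′ ⨾ nS x ⨾ ∘-congˡ iSx) ,
                        (pullˡ (≈-sym b-square) ⨾ pullʳ bz ⨾ nTf x ⨾ ∘-congˡ (∘-congˡ iSx))) ,
              (λ y z ez q →
                let z₀ , zz , e₀ = pulled ez
                    x , az , bz = only z₀ e₀
                    _ , a₀ = pushed e₀ az
                    y≈ = injective (isfib sem S) _ _ (≈-sym q ⨾ ∘-congˡ (≈-sym zz) ⨾ a₀ ⨾ nS x)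
                in ∘-congˡ (≈-sym zz) ⨾ pullˡ (≈-sym b-square) ⨾ pullʳ bz
                   ⨾ nTf x ⨾ ∘-congˡ (∘-congˡ (≈-sym y≈)))
              where
              h = to iT ∘ f ∘ from iS
              nTf : ∀ (x : El (⟦ S ⟧ (δ u))) → to ιᴮ ∘ (to (θ T) ∘ incl T) ∘ f ∘ x ≈ n T ∘ h ∘ to iS ∘ x
              nTf x = nT (f ∘ x)
                ⨾ ∘-congˡ (≈-sym (assoc ⨾ ∘-congˡ (assoc ⨾ ∘-congˡ (cancelˡ (from∘to iS)))))

            codes-φ : δ u ▷ f ⊨ φ → NamesGraph u f → Holds X φᶜ
            codes-φ p names = to iT ∘ f ∘ from iS ,
              Equivalence.from (codesGraph⊨ (fib F · S) (fib F · T)) (codes names) ,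
              sim-⊨ (proj₂ (sim-push s (S ⇒ T) f)) φ p

      Coding : Set ℓ
      Coding = k ⊨ elim κ pt φᶜ idᴿ

      coding⇐ : ∀ u → u′ ≈ to (θ one) ∘ u → ∀ f → δ u ▷ f ⊨ φ → NamesGraph u f → Coding
      coding⇐ u base f p names =
        let X , r = elim⇐ κ φᶜ over-one over-maps sim-id
        in r (At.codes-φ X u base f p names)

      module _ (coding : Coding) where
        private
          X     = proj₁ (elim⇒ κ φᶜ over-one sim-id coding)
          holds = proj₂ (elim⇒ κ φᶜ over-one sim-id coding)
          F     = Solution.F X

          graph : At.Graphᵦ X (proj₁ holds)
          graph = Equivalence.to (codesGraph⊨ (fib F · S) (fib F · T)) (proj₁ (proj₂ holds))

        coded-defined : ∀ p → lookupAr k (over κ S) ∘ p ≈ u′ →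
                        Σ[ z ∈ El (lookupOb k M) ] (e ∘ z ≈ r) × (a ∘ z ≈ p)
        coded-defined = At.defined X (proj₁ holds) graph

        coded-over : ∀ {p z} → lookupAr k (over κ S) ∘ p ≈ u′ → e ∘ z ≈ r → a ∘ z ≈ p →
                     lookupAr k (over κ T) ∘ b ∘ z ≈ u′
        coded-over = At.value-over X (proj₁ holds) graph

        coding⇒ : ∀ u → u′ ≈ to (θ one) ∘ u →
          ∀ (f : Hom (⟦ S ⟧ (δ u)) (⟦ T ⟧ (δ u))) {g : Hom A B′} →
          (∀ p → lookupAr k (over κ S) ∘ p ≈ u′ →
            Σ[ z ∈ El (lookupOb k M) ] (e ∘ z ≈ r) × ((a ∘ z ≈ p) × (b ∘ z ≈ g ∘ p))) →
          (to (θ T) ∘ FibreEnv.incl (D u) T) ∘ f ≈ g ∘ to (θ S) ∘ FibreEnv.incl (D u) S →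
          δ u ▷ f ⊨ φ
        coding⇒ u base f spec gf = sim-⊨⁻
          (sim-lift-ar (At.s X u base) {S} {T} {f} {proj₁ holds}
            (At.agrees X u base f (proj₁ holds) graph spec gf)) φ (proj₂ (proj₂ holds))

    module _ (separation : FullSeparation) {K} {k : Env K} {κ : Code Δ K} (c : Encoding κ ε k)
             {P M : ObVar K} (eᵛ : ArVar K (var M) (var P))
             (aᵛ : ArVar K (var M) (var (tot κ S))) (bᵛ : ArVar K (var M) (var (tot κ T)))
             (name : ∀ {Z} (x : Hom Z (lookupOb k (tot κ S))) (y : Hom Z (lookupOb k (tot κ T))) →
                Injective x → Σ[ r ∈ El (lookupOb k P) ]
                  NamesPairs (lookupAr k eᵛ) (lookupAr k aᵛ) (lookupAr k bᵛ) r x y)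
             (given : ∀ u → Σ[ f ∈ Hom (⟦ S ⟧ (δ u)) (⟦ T ⟧ (δ u)) ] (δ u ▷ f ⊨ φ)) where
      open Encoding c using (θ; θ-over)

      private
        U A B′ PX Mem : Obj
        U   = lookupOb k (tot κ one)
        A   = lookupOb k (tot κ S)
        B′  = lookupOb k (tot κ T)
        PX  = lookupOb k P
        Mem = lookupOb k M

        oˢ : Hom A U
        oˢ = lookupAr k (over κ S)

        oᵀ : Hom B′ U
        oᵀ = lookupAr k (over κ T)

        e : Hom Mem PX
        e = lookupAr k eᵛ

        a : Hom Mem A
        a = lookupAr k aᵛ

        b : Hom Mem B′
        b = lookupAr k bᵛ

        K⁺ : Ctx
        K⁺ = K ▹ one ⇒ var (tot κ one) ▹ one ⇒ var (there P)

        κ⁺ : Code Δ K⁺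
        κ⁺ = weakenCode (weakenCode κ)

        c⁺ : (u′ : El U) (r : El PX) → Encoding κ⁺ ε (k ▷ u′ ▷ r)
        c⁺ u′ r = record { θ = θ ; θ-over = θ-over ; θ-maps = Encoding.θ-maps c }

        module At⁺ (u′ : El U) (r : El PX) =
          Coded (c⁺ u′ r) (there here) here (there (there eᵛ)) (there (there aᵛ)) (there (there bᵛ))

        Φ : Formula K⁺
        Φ = elim κ⁺ (there here)
          (codedArrow κ⁺ {S} {T} here (there (there eᵛ)) (there (there aᵛ)) (there (there bᵛ)) φ) idᴿ

        coded : ∀ u′ → Σ[ r ∈ El PX ] (k ▷ u′ ▷ r ⊨ Φ)
        coded u′ = r , At⁺.coding⇐ u′ r u (≈-sym (cancelˡ (to∘from (θ one)))) f (proj₂ (given u))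
          ((λ x → let z , ez , az , bz = proj₁ names x in z , ez , az , (bz ⨾ assoc)) ,
           (λ z ez → let x , az , bz = proj₂ names z ez in x , az , (bz ⨾ assoc)))
          where
          u = from (θ one) ∘ u′
          f = proj₁ (given u)
          open FibreEnv (D u)

          named = name (to (θ S) ∘ incl S) ((to (θ T) ∘ incl T) ∘ f) λ x y eq →
            injective (isFib S) x y (iso-cancelˡ (θ S) (≈-sym assoc ⨾ eq ⨾ assoc))

          r     = proj₁ named
          names = proj₂ named

        -- The arrows between the fibres at `u` form a set varying with `u`, whereas their graphs
        -- are elements of the one set `PX`; hence codes can be chosen by an arrow `ρ`.
        codes : Σ[ ρ ∈ Hom U PX ] (∀ u′ → k ▷ u′ ▷ ρ ∘ u′ ⊨ Φ)
        codes = choose-element separation (tot κ one) P Φ k coded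

      module _ (ρ : Hom U PX) (ρ-codes : ∀ u′ → At⁺.Coding u′ (ρ ∘ u′)) where
        value-exists : ∀ p → Σ[ z ∈ El Mem ] (e ∘ z ≈ ρ ∘ oˢ ∘ p) × (a ∘ z ≈ p)
        value-exists p = At⁺.coded-defined (oˢ ∘ p) (ρ ∘ oˢ ∘ p) (ρ-codes (oˢ ∘ p)) p ≈-refl

        value-over : ∀ p z → e ∘ z ≈ ρ ∘ oˢ ∘ p → a ∘ z ≈ p → oᵀ ∘ b ∘ z ≈ oˢ ∘ p
        value-over p z = At⁺.coded-over (oˢ ∘ p) (ρ ∘ oˢ ∘ p) (ρ-codes (oˢ ∘ p)) {p} {z} ≈-refl

        satisfied : ∀ u (f : Hom (⟦ S ⟧ (δ u)) (⟦ T ⟧ (δ u))) (g : Hom A B′) →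
          (∀ p → oˢ ∘ p ≈ to (θ one) ∘ u → Σ[ z ∈ El Mem ] (e ∘ z ≈ ρ ∘ to (θ one) ∘ u) ×
            ((a ∘ z ≈ p) × (b ∘ z ≈ g ∘ p))) →
          (to (θ T) ∘ FibreEnv.incl (D u) T) ∘ f ≈ g ∘ to (θ S) ∘ FibreEnv.incl (D u) S →
          δ u ▷ f ⊨ φ
        satisfied u f g = At⁺.coding⇒ u′ (ρ ∘ u′) (ρ-codes u′) u ≈-refl f {g}
          where u′ = to (θ one) ∘ u

        defined : ∀ p → Σ[ z ∈ El Mem ] (e ∘ z ≈ (ρ ∘ oˢ) ∘ p) × (a ∘ z ≈ p)
        defined p = let z , ez , az = value-exists p in z , (ez ⨾ ≈-sym assoc) , az

        module _ (g : Hom A B′)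
                 (g-spec : ∀ p → Σ[ z ∈ El Mem ] (e ∘ z ≈ (ρ ∘ oˢ) ∘ p) ×
                             ((a ∘ z ≈ p) × (b ∘ z ≈ g ∘ p))) where

          g-over : oᵀ ∘ g ≈ oˢ
          g-over = generator _ _ λ p →
            let z , ez , az , bz = g-spec p
            in assoc ⨾ ∘-congˡ (≈-sym bz)
               ⨾ value-over p z (ez ⨾ assoc) az

          arrowOver : SliceHom C U₀ (Sl.⟦ S ⟧ ε) (Sl.⟦ T ⟧ ε)
          arrowOver = (from (θ T) ∘ g ∘ to (θ S)) ∣ iso-cancelˡ (θ one)
            (pullˡ (≈-sym (θ-over T)) ⨾ pullʳ (cancelˡ (to∘from (θ T))) ⨾ pullˡ g-over ⨾ θ-over S)

          arrowOver⊨ : ∀ u (f : Hom (⟦ S ⟧ (δ u)) (⟦ T ⟧ (δ u))) →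
            FibreEnv.incl (D u) T ∘ f ≈ map arrowOver ∘ FibreEnv.incl (D u) S → δ u ▷ f ⊨ φ
          arrowOver⊨ u f eq = satisfied u f g
            (λ p o → let z , ez , q = g-spec p in z , (ez ⨾ assoc ⨾ ∘-congˡ o) , q)
            (pullʳ eq ⨾ ∘-congˡ (assoc ⨾ ∘-congˡ assoc) ⨾ cancelˡ (to∘from (θ T)))

      codedSliceAr : Σ[ g ∈ SliceHom C U₀ (Sl.⟦ S ⟧ ε) (Sl.⟦ T ⟧ ε) ]
        (∀ u f → FibreEnv.incl (D u) T ∘ f ≈ map g ∘ FibreEnv.incl (D u) S → δ u ▷ f ⊨ φ)
      codedSliceAr =
        let ρ , ρ-codes = codes
            g , g-spec = choose-value (ρ ∘ oˢ) e a b (defined ρ ρ-codes)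
        in arrowOver ρ ρ-codes g g-spec , arrowOver⊨ ρ ρ-codes g g-spec

    -- The conclusion concerns every `f` that `g` restricts to, and so fits any choice of pullbacks:
    -- those of `fibreInst` as well as those in collection of functions.
    sliceAr : FullSeparation → (∀ u → Σ[ f ∈ Hom (⟦ S ⟧ (δ u)) (⟦ T ⟧ (δ u)) ] (δ u ▷ f ⊨ φ)) →
      Σ[ g ∈ SliceHom C U₀ (Sl.⟦ S ⟧ ε) (Sl.⟦ T ⟧ ε) ]
        (∀ u f → FibreEnv.incl (D u) T ∘ f ≈ map g ∘ FibreEnv.incl (D u) S → δ u ▷ f ⊨ φ)
    sliceAr separation given = fromEncoding (proj₂ (proj₂ (proj₂ (encode ε))))
      where
      module _ {K} {k : Env K} {κ : Code Δ K} (c : Encoding κ ε k) where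
        open Power (power (lookupOb k (tot κ S) ×ₒ lookupOb k (tot κ T)))

        K⁺ : Ctx
        K⁺ = K ▹ ob ▹ ob ▹ var here ⇒ var (there here)
               ▹ var (there here) ⇒ var (there (there (there (tot κ S))))
               ▹ var (there (there here)) ⇒ var (there (there (there (there (tot κ T)))))

        k⁺ : Env K⁺
        k⁺ = k ▷ PX ▷ Mem ▷ e₁ ▷ π₁ ∘ e₂ ▷ π₂ ∘ e₂

        κ⁺ : Code Δ K⁺
        κ⁺ = weakenCode (weakenCode (weakenCode (weakenCode (weakenCode κ))))

        c⁺ : Encoding κ⁺ ε k⁺
        c⁺ = record { θ = Encoding.θ c ; θ-over = Encoding.θ-over c ; θ-maps = Encoding.θ-maps c }

        fromEncoding : Σ[ g ∈ SliceHom C U₀ (Sl.⟦ S ⟧ ε) (Sl.⟦ T ⟧ ε) ]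
          (∀ u f → FibreEnv.incl (D u) T ∘ f ≈ map g ∘ FibreEnv.incl (D u) S → δ u ▷ f ⊨ φ)
        fromEncoding = codedSliceAr separation c⁺ (there (there here)) (there here) here namePairs given

-- Replacement of contexts and collection of functions

module FromCollection {C : Category ℓ} (E : ETCS C) where
  open Elements E
  open Families E
  open FibreFormulas E

  fibreMap-incl : ∀ {U} {u : El U} {X Y : SliceObj C U} {Z W} (F : Fibre u X Z) (G : Fibre u Y W)
                  (f : SliceHom C U X Y) → Fibre.incl G ∘ fibreMap F G f ≈ map f ∘ Fibre.incl F
  fibreMap-incl F G f = Fibre.p₂-universal G _

  module _ {U₀ : Obj} (u : El U₀) where
    open SliceFamilies E U₀ using (module Sl)

    constantMap-natural : ∀ {X Y Z W} (K : Constant U₀ X Z) (L : Constant U₀ Y W) (f : Hom Z W) →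
      Fibre.incl (fibre-constant U₀ u L) ∘ f ≈
      map (constantMap U₀ K L f) ∘ Fibre.incl (fibre-constant U₀ u K)
    constantMap-natural K L f = L.unique
      (pullˡ L.π₁-⟨⟩ ⨾ pullʳ el-𝟙 ⨾ ≈-sym (pullˡ L.π₁-⟨⟩ ⨾ K.π₁-⟨⟩))
      (pullˡ L.π₂-⟨⟩ ⨾ identityˡ ⨾ ≈-sym (pullˡ L.π₂-⟨⟩ ⨾ pullʳ K.π₂-⟨⟩ ⨾ identityʳ))
      where module K = Constant K
            module L = Constant L

    constant-natural : ∀ {Γ S T} (γ : Env Γ) (f : ArVar Γ S T) →
      Fibre.incl (fibre-constant U₀ u (constant U₀ γ T)) ∘ lookupAr γ f ≈
      map (Sl.lookupAr (pull U₀ γ) f) ∘ Fibre.incl (fibre-constant U₀ u (constant U₀ γ S))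
    constant-natural (γ ▷ g) (here {S = S@one}     {T@one}) =
      constantMap-natural (constant U₀ γ S) (constant U₀ γ T) g
    constant-natural (γ ▷ g) (here {S = S@one}     {T@(var _)}) =
      constantMap-natural (constant U₀ γ S) (constant U₀ γ T) g
    constant-natural (γ ▷ g) (here {S = S@(var _)} {T@one}) =
      constantMap-natural (constant U₀ γ S) (constant U₀ γ T) g
    constant-natural (γ ▷ g) (here {S = S@(var _)} {T@(var _)}) =
      constantMap-natural (constant U₀ γ S) (constant U₀ γ T) g
    constant-natural (_▷_ {d = ob} γ _)    (there {S = one}   {one}   f) = constant-natural γ f
    constant-natural (_▷_ {d = ob} γ _)    (there {S = one}   {var _} f) = constant-natural γ f
    constant-natural (_▷_ {d = ob} γ _)    (there {S = var _} {one}   f) = constant-natural γ f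
    constant-natural (_▷_ {d = ob} γ _)    (there {S = var _} {var _} f) = constant-natural γ f
    constant-natural (_▷_ {d = _ ⇒ _} γ _) (there {S = one}   {one}   f) = constant-natural γ f
    constant-natural (_▷_ {d = _ ⇒ _} γ _) (there {S = one}   {var _} f) = constant-natural γ f
    constant-natural (_▷_ {d = _ ⇒ _} γ _) (there {S = var _} {one}   f) = constant-natural γ f
    constant-natural (_▷_ {d = _ ⇒ _} γ _) (there {S = var _} {var _} f) = constant-natural γ f

  module _ {Γ} (γ : Env Γ) (U : ObVar Γ) where
    private U₀ = lookupOb γ U
    open SliceFamilies E U₀

    diagonal-natural : (u : El U₀) →
      Fibre.incl (fibre-constant U₀ u (constantᵛ U₀ γ U)) ∘ u ≈
      map (diagonal γ U) ∘ Fibre.incl (fibre-constant U₀ u (constant-𝟙 U₀))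
    diagonal-natural u = L.unique
      (pullˡ L.π₁-⟨⟩ ⨾ pullʳ el-𝟙 ⨾ ≈-sym (pullˡ L.π₁-⟨⟩ ⨾ identityˡ))
      (pullˡ L.π₂-⟨⟩ ⨾ identityˡ ⨾ ≈-sym (pullˡ L.π₂-⟨⟩ ⨾ identityˡ ⨾ ∘-congˡ el-𝟙 ⨾ identityʳ))
      where module L = Constant (constantᵛ U₀ γ U)

    fibreInst-natural : ∀ {Δ} {Θ : Tel (Γ ▹ one ⇒ var U) Δ} (i : Sl.Inst (generic γ U) Θ) (u : El U₀)
      {S T} (f : ArVar Δ S T) →
      Fibre.incl (fibreOf γ U u i T) ∘ lookupAr ((γ ▷ u) ⊕ fibreInst γ U u i) f ≈
      map (Sl.lookupAr (generic γ U Sl.⊕ i) f) ∘ Fibre.incl (fibreOf γ U u i S)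
    fibreInst-natural Sl.[] u here = diagonal-natural u
    fibreInst-natural Sl.[] u (there {S = one}   {one}   f) = constant-natural u γ f
    fibreInst-natural Sl.[] u (there {S = one}   {var _} f) = constant-natural u γ f
    fibreInst-natural Sl.[] u (there {S = var _} {one}   f) = constant-natural u γ f
    fibreInst-natural Sl.[] u (there {S = var _} {var _} f) = constant-natural u γ f
    fibreInst-natural (Sl._▷_ {d = ob} i _) u (there {S = one}   {one}   f) = fibreInst-natural i u f
    fibreInst-natural (Sl._▷_ {d = ob} i _) u (there {S = one}   {var _} f) = fibreInst-natural i u f
    fibreInst-natural (Sl._▷_ {d = ob} i _) u (there {S = var _} {one}   f) = fibreInst-natural i u f
    fibreInst-natural (Sl._▷_ {d = ob} i _) u (there {S = var _} {var _} f) = fibreInst-natural i u f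
    fibreInst-natural (Sl._▷_ {d = _ ⇒ _} i _) u (there {S = one}   {one}   f) = fibreInst-natural i u f
    fibreInst-natural (Sl._▷_ {d = _ ⇒ _} i _) u (there {S = one}   {var _} f) = fibreInst-natural i u f
    fibreInst-natural (Sl._▷_ {d = _ ⇒ _} i _) u (there {S = var _} {one}   f) = fibreInst-natural i u f
    fibreInst-natural (Sl._▷_ {d = _ ⇒ _} i _) u (there {S = var _} {var _} f) = fibreInst-natural i u f
    fibreInst-natural (Sl._▷_ {d = _ ⇒ _} i g) u (here {S = S@one}     {T@one}) =
      fibreMap-incl (fibreOf γ U u i S) (fibreOf γ U u i T) g
    fibreInst-natural (Sl._▷_ {d = _ ⇒ _} i g) u (here {S = S@one}     {T@(var _)}) =
      fibreMap-incl (fibreOf γ U u i S) (fibreOf γ U u i T) g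
    fibreInst-natural (Sl._▷_ {d = _ ⇒ _} i g) u (here {S = S@(var _)} {T@one}) =
      fibreMap-incl (fibreOf γ U u i S) (fibreOf γ U u i T) g
    fibreInst-natural (Sl._▷_ {d = _ ⇒ _} i g) u (here {S = S@(var _)} {T@(var _)}) =
      fibreMap-incl (fibreOf γ U u i S) (fibreOf γ U u i T) g

    fibreEnv : ∀ {Δ} {Θ : Tel (Γ ▹ one ⇒ var U) Δ} (i : Sl.Inst (generic γ U) Θ) (u : El U₀) →
               FibreEnv u (generic γ U Sl.⊕ i) ((γ ▷ u) ⊕ fibreInst γ U u i)
    fibreEnv i u = record
      { incl    = λ T → Fibre.incl (fibreOf γ U u i T)
      ; isFib   = λ T → fibre-isFibre (fibreOf γ U u i T)
      ; natural = fibreInst-natural i u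
      }

    module _ (strong : StrongCollection) (separation : FullSeparation) where

      -- The last declaration is absorbed into `φ` by a quantifier. The induction hypothesis gives
      -- an instantiation `i` of the rest over whose fibres a value still exists; that value is
      -- collected over `i`, and the pointwise instantiations are discarded.
      instantiate : ∀ {Δ} (Θ : Tel (Γ ▹ one ⇒ var U) Δ) (φ : Formula Δ) →
        (∀ u → Σ[ i ∈ Inst (γ ▷ u) Θ ] ((γ ▷ u) ⊕ i ⊨ φ)) →
        Σ[ i ∈ Sl.Inst (generic γ U) Θ ] (∀ u → (γ ▷ u) ⊕ fibreInst γ U u i ⊨ φ)
      instantiate []       φ h = Sl.[] , λ u → good (h u)
        where
        good : ∀ {u} → Σ[ i ∈ Inst (γ ▷ u) [] ] ((γ ▷ u) ⊕ i ⊨ φ) → γ ▷ u ⊨ φ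
        good ([] , p) = p
      instantiate (Θ ▸ ob) φ h = (i Sl.▷ proj₁ family) , proj₂ family
        where
        split : ∀ {u} → Σ[ i ∈ Inst (γ ▷ u) (Θ ▸ ob) ] ((γ ▷ u) ⊕ i ⊨ φ) →
                Σ[ i ∈ Inst (γ ▷ u) Θ ] ((γ ▷ u) ⊕ i ⊨ ex ob φ)
        split ((i ▷ X) , p) = i , X , p
        IH = instantiate Θ (ex ob φ) λ u → split (h u)
        i  = proj₁ IH
        family = sliceOb strong (generic γ U Sl.⊕ i) _ (fibreEnv i) φ (proj₂ IH)
      instantiate (Θ ▸ S ⇒ T) φ h = (i Sl.▷ proj₁ family) , λ u →
        proj₂ family u _ (fibreMap-incl (fibreOf γ U u i S) (fibreOf γ U u i T) (proj₁ family))
        where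
        split : ∀ {u} → Σ[ i ∈ Inst (γ ▷ u) (Θ ▸ S ⇒ T) ] ((γ ▷ u) ⊕ i ⊨ φ) →
                Σ[ i ∈ Inst (γ ▷ u) Θ ] ((γ ▷ u) ⊕ i ⊨ ex (S ⇒ T) φ)
        split ((i ▷ f) , p) = i , f , p
        IH = instantiate Θ (ex (S ⇒ T) φ) λ u → split (h u)
        i  = proj₁ IH
        family = SliceArrows.sliceAr E U₀ (generic γ U Sl.⊕ i) _ (fibreEnv i) φ separation (proj₂ IH)

  strong⇒replacement : StrongCollection → FullSeparation → ReplacementOfContexts
  strong⇒replacement strong separation U Θ φ γ h =
    instantiate γ U strong separation Θ φ λ u → proj₁ (h u)

  separation⇒functions : FullSeparation → CollectionOfFunctions
  separation⇒functions separation U φ γ A B h = U₀ , id , id-regularEpi , g′ , λ v →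
    proj₂ family (id ∘ v) _ (restricts v)
    where
    U₀ = lookupOb γ U
    open SliceFamilies E U₀

    -- `A` and `B` serve as an instantiation of the two object declarations; only the arrow has to
    -- be found.
    i : Sl.Inst (generic γ U) ([] ▸ ob ▸ ob)
    i = Sl.[] Sl.▷ A Sl.▷ B

    family = SliceArrows.sliceAr E U₀ (generic γ U Sl.⊕ i) _ (fibreEnv γ U i)
               {var (there here)} {var here} φ separation h

    g : SliceHom C U₀ A B
    g = proj₁ family

    module Pᴬ = Pullback (pullback id (arr A))
    module Pᴮ = Pullback (pullback id (arr B))

    square′ : id ∘ Pᴬ.p₁ ≈ arr B ∘ map g ∘ Pᴬ.p₂
    square′ = Pᴬ.commutes ⨾ ∘-congʳ (≈-sym (triangle g)) ⨾ assoc

    -- Pulling back along the cover `id` yields only isomorphic copies of `A` and `B`, to which `g`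
    -- is transferred.
    g′ : SliceHom C U₀ (id ^* A) (id ^* B)
    g′ = Pᴮ.universal Pᴬ.p₁ (map g ∘ Pᴬ.p₂) square′ ∣ Pᴮ.p₁-universal square′

    restricts : ∀ v →
      Pullback.p₂ (pullback (id ∘ v) (arr B)) ∘ fibreMap (fibre-∘ id v A) (fibre-∘ id v B) g′ ≈
      map g ∘ Pullback.p₂ (pullback (id ∘ v) (arr A))
    restricts v =
      ∘-congʳ (≈-sym (Pᴮ.p₂-universal _)) ⨾ pullʳ (fibreMap-incl (fibre-∘ id v A) (fibre-∘ id v B) g′)
      ⨾ pullˡ (Pᴮ.p₂-universal square′) ⨾ pullʳ (Pᴬ.p₂-universal _)

-- Well-orders

-- R, r₁, r₂ exhibit a strict well-order of X, as a subset of X × X.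
wellOrderʳ : (X R r₁ r₂ : ℕ) → Raw
wellOrderʳ X R r₁ r₂ =
     (∀ᵉ X λ x → ¬ʳ (relʳ R r₁ r₂ ($ x) ($ x)))
  ∧ʳ (∀ᵉ X λ x → ∀ᵉ X λ y → ∀ᵉ X λ z →
        relʳ R r₁ r₂ ($ x) ($ y) ⊃ʳ relʳ R r₁ r₂ ($ y) ($ z) ⊃ʳ relʳ R r₁ r₂ ($ x) ($ z))
  ∧ʳ (∀ᵒ λ S → ∀ᵃ S X λ m → ∀ᵉ S λ _ → ∃ᵉ S λ s → ∀ᵉ S λ t →
        ($ m ∙ $ t ≐ʳ $ m ∙ $ s) ∨ʳ relʳ R r₁ r₂ ($ m ∙ $ s) ($ m ∙ $ t))
  ∧ʳ (∀ᵉ R λ z → ∀ᵉ R λ w → $ r₁ ∙ $ z ≐ʳ $ r₁ ∙ $ w ⊃ʳ $ r₂ ∙ $ z ≐ʳ $ r₂ ∙ $ w ⊃ʳ $ z ≐ʳ $ w)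

module Orders {C : Category ℓ} (E : ETCS C) where
  open Elements E
  open Families E

  -- The fourth clause makes `R` a set of pairs, so that an isomorphism of carriers determines the
  -- one of relations. Totality is contained in the third clause, through subsets with at most two
  -- elements.
  IsWellOrder : ∀ {X R} → Hom R X → Hom R X → Set ℓ
  IsWellOrder {X} {R} r₁ r₂ =
    (∀ (x : El X) → ¬ₗ (Rel r₁ r₂ x x)) ×
    (∀ x y z → Rel r₁ r₂ x y → Rel r₁ r₂ y z → Rel r₁ r₂ x z) ×
    (∀ S (m : Hom S X) → El S → Σ[ s ∈ El S ] (∀ t → (m ∘ t ≈ m ∘ s) ⊎ Rel r₁ r₂ (m ∘ s) (m ∘ t))) ×
    (∀ (z w : El R) → r₁ ∘ z ≈ r₁ ∘ w → r₂ ∘ z ≈ r₂ ∘ w → z ≈ w)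

  subset-rel : ∀ {A B R} {m : Hom R (A ×ₒ B)} {P : El A → El B → Set ℓ} →
    (∀ {a a′ b b′} → a ≈ a′ → b ≈ b′ → P a b → P a′ b′) →
    (∀ w → w ∈ m ⇔ P (π₁ ∘ w) (π₂ ∘ w)) → ∀ a b → Rel (π₁ ∘ m) (π₂ ∘ m) a b ⇔ P a b
  subset-rel {m = m} resp spec a b = mk⇔
    (λ (z , e , f) → resp (≈-sym assoc ⨾ e) (≈-sym assoc ⨾ f) (Equivalence.to (spec (m ∘ z)) (z , ≈-refl)))
    (λ p → let z , e = Equivalence.from (spec ⟨ a , b ⟩) (resp (≈-sym π₁-⟨⟩) (≈-sym π₂-⟨⟩) p)
           in z , (pullʳ e ⨾ π₁-⟨⟩) , (pullʳ e ⨾ π₂-⟨⟩))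

  subset-jointly-mono : ∀ {A B R} {m : Hom R (A ×ₒ B)} → Mono m →
    ∀ (z w : El R) → (π₁ ∘ m) ∘ z ≈ (π₁ ∘ m) ∘ w → (π₂ ∘ m) ∘ z ≈ (π₂ ∘ m) ∘ w → z ≈ w
  subset-jointly-mono mono z w e f = mono z w
    (×-unique (≈-sym assoc ⨾ e ⨾ assoc) (≈-sym assoc ⨾ f ⨾ assoc))

-- Zermelo's theorem

Γ∋ Γᶜ : Ctx
Γ∋ = span (∅ ▹ ob ▹ ob) here (there here)
Γᶜ = Γ∋ ▹ var (there (there (there here))) ⇒ var (there (there (there (there here))))

infix 7 _∋ʳ_

-- In Γᶜ the levels 0, …, 5 are X, PX, the membership relation, its two
-- projections, and c : PX → X.
_∋ʳ_ : RawAr → RawAr → Raw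
r ∋ʳ x = relʳ 2 3 4 r x

cʳ : RawAr → RawAr
cʳ r = $ 5 ∙ r

subʳ succʳ : RawAr → RawAr → Raw
subʳ r s  = ∀ᵉ 0 λ x → r ∋ʳ $ x ⊃ʳ s ∋ʳ $ x
succʳ r s = ∀ᵉ 0 λ x → (s ∋ʳ $ x ⊃ʳ r ∋ʳ $ x ∨ʳ $ x ≐ʳ cʳ r) ∧ʳ (r ∋ʳ $ x ∨ʳ $ x ≐ʳ cʳ r ⊃ʳ s ∋ʳ $ x)

inʳ : (F n : ℕ) → RawAr → Raw
inʳ F n r = ∃ᵉ F λ f → $ n ∙ $ f ≐ʳ r

unionʳ : (G g : ℕ) → RawAr → Raw
unionʳ G g s = ∀ᵉ 0 λ x → (s ∋ʳ $ x ⊃ʳ (∃ᵉ G λ y → $ g ∙ $ y ∋ʳ $ x))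
                       ∧ʳ ((∃ᵉ G λ y → $ g ∙ $ y ∋ʳ $ x) ⊃ʳ s ∋ʳ $ x)

closedʳ : (F n : ℕ) → Raw
closedʳ F n =
     (∀ᵉ F λ f → ∀ᵉ 1 λ s → succʳ ($ n ∙ $ f) ($ s) ⊃ʳ inʳ F n ($ s))
  ∧ʳ (∀ᵒ λ G → ∀ᵃ G 1 λ g → (∀ᵉ G λ y → inʳ F n ($ g ∙ $ y)) ⊃ʳ
        (∀ᵉ 1 λ s → unionʳ G g ($ s) ⊃ʳ inʳ F n ($ s)))

towerʳ : RawAr → Raw
towerʳ r = ∀ᵒ λ F → ∀ᵃ F 1 λ n → closedʳ F n ⊃ʳ inʳ F n r

goodʳ : RawAr → Raw
goodʳ a = ∀ᵉ 1 λ b → towerʳ ($ b) ⊃ʳ subʳ ($ b) a ⊃ʳ ¬ʳ (subʳ a ($ b)) ⊃ʳ a ∋ʳ cʳ ($ b)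

beforeʳ : RawAr → RawAr → Raw
beforeʳ x y = ∃ᵉ 1 λ b → towerʳ ($ b) ∧ʳ ($ b ∋ʳ x ∧ʳ ¬ʳ ($ b ∋ʳ y))

module Zermelo {C : Category ℓ} (E : ETCS C) (separation : Schemas.FullSeparation E)
               (X : Category.Obj C) where
  open Elements E
  open Families E
  open Orders E
  open Power (power X)

  infix 4 _∋_
  _∋_ : El PX → El X → Set ℓ
  r ∋ x = Rel e₁ e₂ r x

  γ∋ : Env Γ∋
  γ∋ = [] ▷ X ▷ PX ▷ Mem ▷ e₁ ▷ e₂

  choice-function : El X → Σ[ c ∈ Hom PX X ] (∀ r → ¬ₗ (r ∋ c ∘ r) ⊎ (∀ x → r ∋ x))
  choice-function x₀ = choose-element separation (there (there (there here))) (there (there (there (there here))))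
    (elab 7 (¬ʳ ($ 5 ∋ʳ $ 6) ∨ʳ (∀ᵉ 0 λ x → $ 5 ∋ʳ $ x))) γ∋ missing
    where
    Γʳ : Ctx
    Γʳ = Γ∋ ▹ one ⇒ var (there (there (there here)))
    missing : ∀ r → Σ[ y ∈ El X ] (¬ₗ (r ∋ y) ⊎ (∀ x → r ∋ x))
    missing r with decide Γʳ (∃ᵉ 0 λ x → ¬ʳ ($ 5 ∋ʳ $ x)) (γ∋ ▷ r)
    ... | inj₁ (y , n) = y , inj₁ n
    -- Nothing lies outside `r`, and `x₀` is a default value.
    ... | inj₂ none    = x₀ , inj₂ full
      where
      full : ∀ x → r ∋ x
      full x with decide (Γʳ ▹ one ⇒ var (there (there (there (there (there here))))))
                    ($ 5 ∋ʳ $ 6) (γ∋ ▷ r ▷ x)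
      ... | inj₁ p = p
      ... | inj₂ n = ⊥-elim (none (x , n))

  -- The least family of subsets of X closed under unions and under r ↦ r ∪ {c r}
  -- is linearly ordered by inclusion; x precedes y when some member of it
  -- contains x but not y.
  module Tower (c : Hom PX X) (c-spec : ∀ r → ¬ₗ (r ∋ c ∘ r) ⊎ (∀ x → r ∋ x)) where

    γᶜ : Env Γᶜ
    γᶜ = γ∋ ▷ c

    Sub Succ : El PX → El PX → Set ℓ
    Sub r s  = ∀ x → r ∋ x → s ∋ x
    Succ r s = ∀ x → (s ∋ x → r ∋ x ⊎ x ≈ c ∘ r) × (r ∋ x ⊎ x ≈ c ∘ r → s ∋ x)

    Union : ∀ {G} → Hom G PX → El PX → Set ℓ
    Union {G} g s = ∀ x → (s ∋ x → Σ[ y ∈ El G ] (g ∘ y ∋ x)) × (Σ[ y ∈ El G ] (g ∘ y ∋ x) → s ∋ x)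

    -- The empty set, from which the tower starts, enters as the union of an empty family.
    Closed : ∀ {F} → Hom F PX → Set ℓ
    Closed {F} n =
      (∀ (f : El F) s → Succ (n ∘ f) s → s ∈ n) ×
      (∀ G (g : Hom G PX) → (∀ (y : El G) → (g ∘ y) ∈ n) → ∀ s → Union g s → s ∈ n)

    Tower : El PX → Set ℓ
    Tower r = ∀ F (n : Hom F PX) → Closed n → r ∈ n

    PXᵛ : ObVar Γᶜ
    PXᵛ = there (there (there (there here)))

    Xᵛ : ObVar Γᶜ
    Xᵛ = there (there (there (there (there here))))

    ∋-resp : ∀ {r s x y} → r ≈ s → x ≈ y → r ∋ x → s ∋ y
    ∋-resp = rel-resp

    succ : ∀ r → Σ[ s ∈ El PX ] Succ r s
    succ r = proj₁ named , λ x → let n = proj₂ named x ; p = spec x in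
      (λ s∋x → Equivalence.to p (Equivalence.from n s∋x)) ,
      (λ q → Equivalence.to n (Equivalence.from p q))
      where
      separated : Σ[ S ∈ Obj ] Σ[ m ∈ Hom S X ] Mono m × (∀ x → x ∈ m ⇔ (r ∋ x ⊎ x ≈ c ∘ r))
      separated = separation {Γᶜ ▹ one ⇒ var PXᵛ} (there Xᵛ) (elab 8 ($ 6 ∋ʳ $ 7 ∨ʳ $ 7 ≐ʳ cʳ ($ 6))) (γᶜ ▷ r)
      spec  = proj₂ (proj₂ (proj₂ separated))
      named = name _ (proj₁ (proj₂ (proj₂ separated)))

    union : ∀ {G} (g : Hom G PX) → Σ[ s ∈ El PX ] Union g s
    union {G} g = proj₁ named , λ x → let n = proj₂ named x ; p = spec x in
      (λ s∋x → Equivalence.to p (Equivalence.from n s∋x)) ,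
      (λ q → Equivalence.to n (Equivalence.from p q))
      where
      separated : Σ[ S ∈ Obj ] Σ[ m ∈ Hom S X ] Mono m × (∀ x → x ∈ m ⇔ (Σ[ y ∈ El G ] (g ∘ y ∋ x)))
      separated = separation {leg Γᶜ PXᵛ} (there (there Xᵛ))
        (elab 9 (∃ᵉ 6 λ y → $ 7 ∙ $ y ∋ʳ $ 8)) (γᶜ ▷ G ▷ g)
      spec  = proj₂ (proj₂ (proj₂ separated))
      named = name _ (proj₁ (proj₂ (proj₂ separated)))

    tower-succ : ∀ {r s} → Tower r → Succ r s → Tower s
    tower-succ t σ F n cl with t F n cl
    ... | f , e = proj₁ cl f _ λ x →
      (λ q → resp (≈-sym e) (proj₁ (σ x) q)) , (λ q → proj₂ (σ x) (resp e q))
      where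
      resp : ∀ {r r′ x} → r ≈ r′ → r ∋ x ⊎ x ≈ c ∘ r → r′ ∋ x ⊎ x ≈ c ∘ r′
      resp e (inj₁ p) = inj₁ (∋-resp e ≈-refl p)
      resp e (inj₂ p) = inj₂ (p ⨾ ∘-congˡ e)

    tower-union : ∀ {G} {g : Hom G PX} {s} → (∀ y → Tower (g ∘ y)) → Union g s → Tower s
    tower-union t υ F n cl = proj₂ cl _ _ (λ y → t y F n cl) _ υ

    Separable : (El PX → Set ℓ) → Set ℓ
    Separable P = Σ[ F ∈ Obj ] Σ[ n ∈ Hom F PX ] Mono n × (∀ r → r ∈ n ⇔ P r)

    -- The tower is contained in each closed family that is given by an arrow into `PX`. Separation
    -- is what turns a property into such a family.
    induction : ∀ {P} → Separable P → (∀ r s → P r → Succ r s → P s) →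
                (∀ G (g : Hom G PX) → (∀ y → P (g ∘ y)) → ∀ s → Union g s → P s) →
                ∀ r → Tower r → P r
    induction (F , n , _ , spec) step limit r t = Equivalence.to (spec r) (t F n
      ((λ f s σ → Equivalence.from (spec s) (step _ s (Equivalence.to (spec _) (f , ≈-refl)) σ)) ,
       (λ G g h s υ → Equivalence.from (spec s) (limit G g (λ y → Equivalence.to (spec _) (h y)) s υ))))

    sub? : ∀ r s → Sub r s ⊎ ¬ₗ (Sub r s)
    sub? r s = decide (Γᶜ ▹ one ⇒ var PXᵛ ▹ one ⇒ var (there PXᵛ)) (subʳ ($ 6) ($ 7)) (γᶜ ▷ r ▷ s)

    all-sub? : ∀ {G} (g : Hom G PX) s → (Σ[ y ∈ El G ] ¬ₗ (Sub (g ∘ y) s)) ⊎ (∀ y → Sub (g ∘ y) s)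
    all-sub? {G} g s = [ inj₁ , (λ n → inj₂ (all-sub n)) ]′ some-not-sub?
      where
      some-not-sub? : (Σ[ y ∈ El G ] ¬ₗ (Sub (g ∘ y) s)) ⊎ ¬ₗ (Σ[ y ∈ El G ] ¬ₗ (Sub (g ∘ y) s))
      some-not-sub? = decide (leg Γᶜ PXᵛ ▹ one ⇒ var (there (there PXᵛ)))
        (∃ᵉ 6 λ y → ¬ʳ (subʳ ($ 7 ∙ $ y) ($ 8))) (γᶜ ▷ G ▷ g ▷ s)

      all-sub : ¬ₗ (Σ[ y ∈ El G ] ¬ₗ (Sub (g ∘ y) s)) → ∀ y → Sub (g ∘ y) s
      all-sub n y = [ (λ p → p) , (λ q → ⊥-elim (n (y , q))) ]′ (sub? (g ∘ y) s)

    -- As in the proof of the Bourbaki-Witt theorem: the successor of any strictly smaller member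
    -- `b` of the tower is still contained in `a`.
    Good : El PX → Set ℓ
    Good a = ∀ b → Tower b → Sub b a → ¬ₗ (Sub a b) → a ∋ c ∘ b

    Compared : El PX → El PX → Set ℓ
    Compared a b = Sub b a ⊎ (Sub a b × b ∋ c ∘ a)

    -- The `b` that are contained in `a`, or contain the successor of `a`, are closed under
    -- successors and unions. `Tower b` is carried along because goodness of `a` speaks of members
    -- of the tower.
    good-compared : ∀ a → Good a → ∀ b → Tower b → Compared a b
    good-compared a good b tb = proj₂ (induction {λ b → Tower b × Compared a b} separated
      (λ r s (t , q) σ → tower-succ t σ , step r s t q σ)
      (λ G g h s υ → tower-union (λ y → proj₁ (h y)) υ , limit g (λ y → proj₂ (h y)) s υ) b tb)
      where
      separated : Separable (λ b → Tower b × Compared a b)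
      separated = separation {Γᶜ ▹ one ⇒ var PXᵛ} (there PXᵛ)
        (elab 8 (towerʳ ($ 7) ∧ʳ (subʳ ($ 7) ($ 6) ∨ʳ (subʳ ($ 6) ($ 7) ∧ʳ $ 7 ∋ʳ cʳ ($ 6))))) (γᶜ ▷ a)

      step : ∀ r s → Tower r → Compared a r → Succ r s → Compared a s
      step r s t (inj₂ (p , q)) σ = inj₂ ((λ x ax → proj₂ (σ x) (inj₁ (p x ax))) , proj₂ (σ _) (inj₁ q))
      step r s t (inj₁ p) σ = [
        (λ q → inj₂ ((λ x ax → proj₂ (σ x) (inj₁ (q x ax))) ,
                     proj₂ (σ _) (inj₂ (∘-congˡ (extensional a r q p))))) ,
        (λ q → inj₁ λ x sx → [ p x , (λ e → ∋-resp ≈-refl (≈-sym e) (good r t p q)) ]′ (proj₁ (σ x) sx))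
        ]′ (sub? a r)

      limit : ∀ {G} (g : Hom G PX) → (∀ y → Compared a (g ∘ y)) → ∀ s → Union g s → Compared a s
      limit g h s υ = [
        (λ (y , n) → [ (λ p → ⊥-elim (n p)) , (λ (p , q) →
          inj₂ ((λ x ax → proj₂ (υ x) (y , p x ax)) , proj₂ (υ _) (y , q))) ]′ (h y)) ,
        (λ p → inj₁ λ x sx → let y , q = proj₁ (υ x) sx in p y x q)
        ]′ (all-sub? g a)

    tower-good : ∀ a → Tower a → Good a
    tower-good a ta = proj₂ (induction {λ a → Tower a × Good a} separated
      (λ r s (t , q) σ → tower-succ t σ , step r s q σ)
      (λ G g h s υ → tower-union (λ y → proj₁ (h y)) υ , limit g (λ y → proj₂ (h y)) s υ) a ta)
      where
      separated : Separable (λ a → Tower a × Good a)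
      separated = separation {Γᶜ} PXᵛ (elab 7 (towerʳ ($ 6) ∧ʳ goodʳ ($ 6))) γᶜ

      step : ∀ r s → Good r → Succ r s → Good s
      step r s good σ b tb bs nsb = [
        (λ p → [ (λ q → proj₂ (σ _) (inj₂ (∘-congˡ (extensional b r p q)))) ,
                 (λ q → proj₂ (σ _) (inj₁ (good b tb p q))) ]′ (sub? r b)) ,
        (λ (p , q) → ⊥-elim (nsb λ x sx →
          [ p x , (λ e → ∋-resp ≈-refl (≈-sym e) q) ]′ (proj₁ (σ x) sx)))
        ]′ (good-compared r good b tb)

      limit : ∀ {G} (g : Hom G PX) → (∀ y → Good (g ∘ y)) → ∀ s → Union g s → Good s
      limit g h s υ b tb bs nsb = [
        (λ (y , n) → [ (λ p → proj₂ (υ _) (y , h y b tb p n)) , (λ (p , _) → ⊥-elim (n p)) ]′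
          (good-compared (g ∘ y) (h y) b tb)) ,
        (λ p → ⊥-elim (nsb λ x sx → let y , q = proj₁ (υ x) sx in p y x q))
        ]′ (all-sub? g b)

    compare : ∀ {a b} → Tower a → Tower b → Compared a b
    compare ta tb = good-compared _ (tower-good _ ta) _ tb

    Before : El X → El X → Set ℓ
    Before x y = Σ[ b ∈ El PX ] Tower b × (b ∋ x × ¬ₗ (b ∋ y))

    before-resp : ∀ {x x′ y y′} → x ≈ x′ → y ≈ y′ → Before x y → Before x′ y′
    before-resp e f (b , t , p , n) = b , t , ∋-resp ≈-refl e p , λ q → n (∋-resp ≈-refl (≈-sym f) q)

    before-trans : ∀ {x y z} → Before x y → Before y z → Before x z
    before-trans (b , tb , bx , nby) (d , td , dy , ndz) = [
      (λ d⊆b → ⊥-elim (nby (d⊆b _ dy))) , (λ (b⊆d , _) → d , td , b⊆d _ bx , ndz)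
      ]′ (compare tb td)

    module _ {S : Obj} (m : Hom S X) (s₀ : El S) where
      private
        separated : Separable (λ b → Tower b × (∀ t → ¬ₗ (b ∋ m ∘ t)))
        separated = separation {leg Γᶜ Xᵛ} (there (there PXᵛ))
          (elab 9 (towerʳ ($ 8) ∧ʳ (∀ᵉ 6 λ t → ¬ʳ ($ 8 ∋ʳ $ 7 ∙ $ t)))) (γᶜ ▷ S ▷ m)

        g = proj₁ (proj₂ separated)
        a = proj₁ (union g)
        b = proj₁ (succ a)

        υ : Union g a
        υ = proj₂ (union g)

        σ : Succ a b
        σ = proj₂ (succ a)

        spec : ∀ r → r ∈ g ⇔ (Tower r × (∀ t → ¬ₗ (r ∋ m ∘ t)))
        spec = proj₂ (proj₂ (proj₂ separated))

        avoids : ∀ t → ¬ₗ (a ∋ m ∘ t)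
        avoids t p = let y , q = proj₁ (υ _) p in proj₂ (Equivalence.to (spec (g ∘ y)) (y , ≈-refl)) t q

        tower-a : Tower a
        tower-a = tower-union (λ y → proj₁ (Equivalence.to (spec (g ∘ y)) (y , ≈-refl))) υ

        proper : ¬ₗ (a ∋ c ∘ a)
        proper p = [ (λ n → n p) , (λ full → avoids s₀ (full (m ∘ s₀))) ]′ (c-spec a)

        hit : Σ[ s ∈ El S ] m ∘ s ≈ c ∘ a
        hit = [ (λ p → p) , missing ]′ hit?
          where
          Hit : Set ℓ
          Hit = Σ[ s ∈ El S ] m ∘ s ≈ c ∘ a

          hit? : Hit ⊎ ¬ₗ Hit
          hit? = decide (leg Γᶜ Xᵛ ▹ one ⇒ var (there (there PXᵛ)))
                   (∃ᵉ 6 λ s → $ 7 ∙ $ s ≐ʳ cʳ ($ 8)) (γᶜ ▷ S ▷ m ▷ a)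

          -- Otherwise `b` would avoid the image of `m` too and so be contained in `a`, although
          -- `c a` lies in `b` and not in `a`.
          missing : ¬ₗ Hit → Hit
          missing n =
            let y , gy = Equivalence.from (spec b) (tower-succ tower-a σ ,
                  λ t p → [ avoids t , (λ e → n (t , e)) ]′ (proj₁ (σ _) p))
            in ⊥-elim (proper (proj₂ (υ _) (y , ∋-resp (≈-sym gy) ≈-refl (proj₂ (σ _) (inj₂ ≈-refl)))))

      -- `a` is the largest member of the tower disjoint from the image of `m`. Its successor `b`
      -- adds only `c a`, which is therefore the one point of the image in `b`, and `b` separates it
      -- from all others.
      before-least : Σ[ s ∈ El S ] (∀ t → (m ∘ t ≈ m ∘ s) ⊎ Before (m ∘ s) (m ∘ t))
      before-least = s , least
        where
        s = proj₁ hit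
        least : ∀ t → (m ∘ t ≈ m ∘ s) ⊎ Before (m ∘ s) (m ∘ t)
        least t =
          [ (λ p → [ (λ q → ⊥-elim (avoids t q)) , (λ e → inj₁ (e ⨾ ≈-sym (proj₂ hit))) ]′ (proj₁ (σ _) p))
          , (λ n → inj₂ (b , tower-succ tower-a σ , proj₂ (σ _) (inj₂ (proj₂ hit)) , n)) ]′ in-b?
          where
          in-b? : (b ∋ m ∘ t) ⊎ ¬ₗ (b ∋ m ∘ t)
          in-b? = decide (Γᶜ ▹ one ⇒ var PXᵛ ▹ one ⇒ var (there Xᵛ)) ($ 6 ∋ʳ $ 7) (γᶜ ▷ b ▷ m ∘ t)

    wellOrder : Σ[ R ∈ Obj ] Σ[ r₁ ∈ Hom R X ] Σ[ r₂ ∈ Hom R X ] IsWellOrder r₁ r₂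
    wellOrder = proj₁ separated , π₁ ∘ m , π₂ ∘ m ,
      (λ x p → let _ , _ , q , n = rel⇒ p in n q) ,
      (λ x y z p q → rel⇐ (before-trans (rel⇒ p) (rel⇒ q))) ,
      (λ S n s₀ → let s , h = before-least n s₀ in s , λ t → [ inj₁ , (λ p → inj₂ (rel⇐ p)) ]′ (h t)) ,
      subset-jointly-mono (proj₁ (proj₂ (proj₂ separated)))
      where
      separated : Σ[ S ∈ Obj ] Σ[ m ∈ Hom S (X ×ₒ X) ] Mono m × (∀ w → w ∈ m ⇔ Before (π₁ ∘ w) (π₂ ∘ w))
      separated = separation {span Γᶜ Xᵛ Xᵛ}
        (there (there here)) (elab 10 (beforeʳ ($ 7 ∙ $ 9) ($ 8 ∙ $ 9))) (γᶜ ▷ X ×ₒ X ▷ π₁ ▷ π₂)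
      m = proj₁ (proj₂ separated)
      rel⇔ = subset-rel {P = Before} before-resp (proj₂ (proj₂ (proj₂ separated)))
      rel⇒ : ∀ {x y} → Rel (π₁ ∘ m) (π₂ ∘ m) x y → Before x y
      rel⇒ = Equivalence.to (rel⇔ _ _)
      rel⇐ : ∀ {x y} → Before x y → Rel (π₁ ∘ m) (π₂ ∘ m) x y
      rel⇐ = Equivalence.from (rel⇔ _ _)

  well-orderable : Σ[ R ∈ Obj ] Σ[ r₁ ∈ Hom R X ] Σ[ r₂ ∈ Hom R X ] IsWellOrder r₁ r₂
  well-orderable with decide (∅ ▹ ob) (∃ᵉ 0 λ _ → ⊤ʳ) ([] ▷ X)
  ... | inj₁ (x₀ , _) = let c , c-spec = choice-function x₀ in Tower.wellOrder c c-spec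
  -- An empty set offers no default value for a choice function, but every relation on it is a
  -- well-order.
  ... | inj₂ none = X , id , id , (λ x _ → none′ x) , (λ x _ _ _ _ → ⊥-elim (none′ x)) ,
    (λ S m s → ⊥-elim (none′ (m ∘ s))) , (λ z _ _ _ → ⊥-elim (none′ z))
    where
    none′ : ¬ₗ (El X)
    none′ x = none (x , _)

-- Comparison of well-orders by bisimulation

_▹order : Ctx → Ctx
Γ ▹order = span (Γ ▹ ob) here here

Γ² : Ctx
Γ² = (∅ ▹order) ▹order

-- In Γ² the levels 0, …, 3 and 4, …, 7 are two ordered sets.
lt₁ʳ lt₂ʳ : RawAr → RawAr → Raw
lt₁ʳ = relʳ 1 2 3
lt₂ʳ = relʳ 5 6 7

bisimulationʳ : (G g₁ g₂ : ℕ) → Raw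
bisimulationʳ G g₁ g₂ = ∀ᵉ G λ w →
     (∀ᵉ 0 λ x → lt₁ʳ ($ x) ($ g₁ ∙ $ w) ⊃ʳ
        (∃ᵉ G λ v → $ g₁ ∙ $ v ≐ʳ $ x ∧ʳ lt₂ʳ ($ g₂ ∙ $ v) ($ g₂ ∙ $ w)))
  ∧ʳ (∀ᵉ 4 λ y → lt₂ʳ ($ y) ($ g₂ ∙ $ w) ⊃ʳ
        (∃ᵉ G λ v → $ g₂ ∙ $ v ≐ʳ $ y ∧ʳ lt₁ʳ ($ g₁ ∙ $ v) ($ g₁ ∙ $ w)))

similarʳ : RawAr → RawAr → Raw
similarʳ x y = ∃ᵒ λ G → ∃ᵃ G 0 λ g₁ → ∃ᵃ G 4 λ g₂ →
  bisimulationʳ G g₁ g₂ ∧ʳ relʳ G g₁ g₂ x y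

Γ~ : Ctx
Γ~ = span (∅ ▹order ▹ ob) (there (there (there (there here)))) here

-- In Γ~ the levels 0, …, 3 are an ordered set, and 5, 6, 7 a relation from it to 4.
~ʳ : RawAr → RawAr → Raw
~ʳ = relʳ 5 6 7

module Comparison {C : Category ℓ} (E : ETCS C) (separation : Schemas.FullSeparation E) where
  open Elements E
  open Families E
  open Orders E

  module WellOrder {X R} {r₁ r₂ : Hom R X} (wo : IsWellOrder r₁ r₂) where
    infix 4 _<_
    _<_ : El X → El X → Set ℓ
    _<_ = Rel r₁ r₂

    irrefl : ∀ {x} → ¬ₗ (x < x)
    irrefl = proj₁ wo _

    trans : ∀ {x y z} → x < y → y < z → x < z
    trans = proj₁ (proj₂ wo) _ _ _

    jointly-mono : ∀ {z w : El R} → r₁ ∘ z ≈ r₁ ∘ w → r₂ ∘ z ≈ r₂ ∘ w → z ≈ w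
    jointly-mono = proj₂ (proj₂ (proj₂ wo)) _ _

    least : ∀ {P : El X → Set ℓ} → (∀ {x y} → x ≈ y → P x → P y) →
            Σ[ S ∈ Obj ] Σ[ m ∈ Hom S X ] Mono m × (∀ x → x ∈ m ⇔ P x) → Σ[ x ∈ El X ] P x →
            Σ[ x ∈ El X ] P x × (∀ y → P y → y ≈ x ⊎ x < y)
    least resp (S , m , _ , spec) (x , p) =
      let s₀ , _ = Equivalence.from (spec x) p
          s , h  = proj₁ (proj₂ (proj₂ wo)) S m s₀
      in m ∘ s , Equivalence.to (spec _) (s , ≈-refl) , λ y q →
           let t , e = Equivalence.from (spec y) q
           in [ (λ f → inj₁ (≈-sym e ⨾ f)) , (λ l → inj₂ (rel-resp ≈-refl e l)) ]′ (h t)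

    <-minimal : ∀ {x y} → y ≈ x ⊎ x < y → ¬ₗ (y < x)
    <-minimal (inj₁ e) l = irrefl (rel-resp e ≈-refl l)
    <-minimal (inj₂ k) l = irrefl (trans k l)

    -- Compare both elements with the least element of the subset that they form.
    trichotomy : ∀ x y → x ≈ y ⊎ (x < y ⊎ y < x)
    trichotomy x y =
      let s , s∈ , h = least (λ e → [ (λ f → inj₁ (≈-sym e ⨾ f)) , (λ f → inj₂ (≈-sym e ⨾ f)) ]′)
                         pair (x , inj₁ ≈-refl)
      in [ (λ sx → [ (λ e → inj₁ (≈-sym sx ⨾ ≈-sym e)) , (λ l → inj₂ (inj₁ (rel-resp sx ≈-refl l))) ]′
                     (h y (inj₂ ≈-refl)))
         , (λ sy → [ (λ e → inj₁ (e ⨾ sy)) , (λ l → inj₂ (inj₂ (rel-resp sy ≈-refl l))) ]′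
                     (h x (inj₁ ≈-refl))) ]′ s∈
      where
      pair : Σ[ S ∈ Obj ] Σ[ m ∈ Hom S X ] Mono m × (∀ z → z ∈ m ⇔ (z ≈ x ⊎ z ≈ y))
      pair = separation {∅ ▹ ob ▹ one ⇒ var here ▹ one ⇒ var (there here)} (there (there here))
        (elab 4 ($ 3 ≐ʳ $ 1 ∨ʳ $ 3 ≐ʳ $ 2)) ([] ▷ X ▷ x ▷ y)

  Bisimulation : ∀ {X R Y Q G} (r₁ r₂ : Hom R X) (q₁ q₂ : Hom Q Y) → Hom G X → Hom G Y → Set ℓ
  Bisimulation {X} {R} {Y} {Q} {G} r₁ r₂ q₁ q₂ g₁ g₂ = ∀ (w : El G) →
    (∀ x → Rel r₁ r₂ x (g₁ ∘ w) → Σ[ v ∈ El G ] (g₁ ∘ v ≈ x) × Rel q₁ q₂ (g₂ ∘ v) (g₂ ∘ w)) ×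
    (∀ y → Rel q₁ q₂ y (g₂ ∘ w) → Σ[ v ∈ El G ] (g₂ ∘ v ≈ y) × Rel r₁ r₂ (g₁ ∘ v) (g₁ ∘ w))

  Similar : ∀ {X R Y Q} (r₁ r₂ : Hom R X) (q₁ q₂ : Hom Q Y) → El X → El Y → Set ℓ
  Similar {X} {_} {Y} r₁ r₂ q₁ q₂ x y =
    Σ[ G ∈ Obj ] Σ[ g₁ ∈ Hom G X ] Σ[ g₂ ∈ Hom G Y ] Bisimulation r₁ r₂ q₁ q₂ g₁ g₂ × Rel g₁ g₂ x y

  similar-sym : ∀ {X R Y Q} {r₁ r₂ : Hom R X} {q₁ q₂ : Hom Q Y} {x y} →
                Similar r₁ r₂ q₁ q₂ x y → Similar q₁ q₂ r₁ r₂ y x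
  similar-sym (G , g₁ , g₂ , bis , w , e , f) =
    G , g₂ , g₁ , (λ w → proj₂ (bis w) , proj₁ (bis w)) , w , f , e

  IsSegment : ∀ {X R Z} (r₁ r₂ : Hom R X) → El X → Hom Z X → Set ℓ
  IsSegment r₁ r₂ x z =
    Injective z × (∀ x′ → (Rel r₁ r₂ x′ x → x′ ∈ z) × (x′ ∈ z → Rel r₁ r₂ x′ x))

  rel-sym : ∀ {R A B} {r₁ : Hom R A} {r₂ : Hom R B} {a b} → Rel r₁ r₂ a b → Rel r₂ r₁ b a
  rel-sym (z , e , f) = z , f , e

  IsSimilarity : ∀ {X R Y Q K} (r₁ r₂ : Hom R X) (q₁ q₂ : Hom Q Y) → Hom K X → Hom K Y → Set ℓ
  IsSimilarity r₁ r₂ q₁ q₂ k₁ k₂ = ∀ x y → Rel k₁ k₂ x y ⇔ Similar r₁ r₂ q₁ q₂ x y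

  -- The union of all bisimulations is definable by quantifying over the object `G`, and separation
  -- makes it a set of pairs.
  similarity : ∀ {X R Y Q} (r₁ r₂ : Hom R X) (q₁ q₂ : Hom Q Y) →
    Σ[ K ∈ Obj ] Σ[ k₁ ∈ Hom K X ] Σ[ k₂ ∈ Hom K Y ] IsSimilarity r₁ r₂ q₁ q₂ k₁ k₂
  similarity {X} {R} {Y} {Q} r₁ r₂ q₁ q₂ =
    proj₁ subset , _ , _ , subset-rel {P = Similar r₁ r₂ q₁ q₂}
      (λ e f (G , g₁ , g₂ , bis , p) → G , g₁ , g₂ , bis , rel-resp e f p) (proj₂ (proj₂ (proj₂ subset)))
    where
    subset : Σ[ S ∈ Obj ] Σ[ m ∈ Hom S (X ×ₒ Y) ] Mono m ×
               (∀ w → w ∈ m ⇔ Similar r₁ r₂ q₁ q₂ (π₁ ∘ w) (π₂ ∘ w))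
    subset = separation
      {span Γ² (there (there (there (there (there (there (there here))))))) (there (there (there here)))}
      (there (there here)) (elab 12 (similarʳ ($ 9 ∙ $ 11) ($ 10 ∙ $ 11)))
      ([] ▷ X ▷ R ▷ r₁ ▷ r₂ ▷ Y ▷ Q ▷ q₁ ▷ q₂ ▷ X ×ₒ Y ▷ π₁ ▷ π₂)

  module OneSided {X R} {r₁ r₂ : Hom R X} (woX : IsWellOrder r₁ r₂)
                  {Y Q} {q₁ q₂ : Hom Q Y} (woY : IsWellOrder q₁ q₂)
                  {K} {k₁ : Hom K X} {k₂ : Hom K Y} (sim : IsSimilarity r₁ r₂ q₁ q₂ k₁ k₂) where
    module X = WellOrder woX
    module Y = WellOrder woY

    γ~ : Env Γ~
    γ~ = [] ▷ X ▷ R ▷ r₁ ▷ r₂ ▷ Y ▷ K ▷ k₁ ▷ k₂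

    Xᵛ Yᵛ : ObVar Γ~
    Xᵛ = there (there (there (there (there (there (there here))))))
    Yᵛ = there (there (there here))

    infix 4 _~_
    _~_ : El X → El Y → Set ℓ
    _~_ = Rel k₁ k₂

    ~-resp : ∀ {x x′ y y′} → x ≈ x′ → y ≈ y′ → x ~ y → x′ ~ y′
    ~-resp = rel-resp

    ~-down : ∀ {x y x′} → x ~ y → x′ X.< x → Σ[ y′ ∈ El Y ] (y′ Y.< y) × (x′ ~ y′)
    ~-down s l =
      let G , g₁ , g₂ , bis , w , e , f = Equivalence.to (sim _ _) s
          v , gv , k = proj₁ (bis w) _ (rel-resp ≈-refl (≈-sym e) l)
      in g₂ ∘ v , rel-resp ≈-refl f k , Equivalence.from (sim _ _) (G , g₁ , g₂ , bis , v , gv , ≈-refl)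

    ~-down′ : ∀ {x y y′} → x ~ y → y′ Y.< y → Σ[ x′ ∈ El X ] (x′ X.< x) × (x′ ~ y′)
    ~-down′ s k =
      let G , g₁ , g₂ , bis , w , e , f = Equivalence.to (sim _ _) s
          v , gv , l = proj₂ (bis w) _ (rel-resp ≈-refl (≈-sym f) k)
      in g₁ ∘ v , rel-resp ≈-refl e l , Equivalence.from (sim _ _) (G , g₁ , g₂ , bis , v , ≈-refl , gv)

    Doubled : El X → Set ℓ
    Doubled x′ = Σ[ x ∈ El X ] Σ[ y ∈ El Y ] (x′ X.< x) × ((x ~ y) × (x′ ~ y))

    doubled-subset : Σ[ S ∈ Obj ] Σ[ m ∈ Hom S X ] Mono m × (∀ x → x ∈ m ⇔ Doubled x)
    doubled-subset = separation {Γ~} Xᵛ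
      (elab 9 (∃ᵉ 0 λ x → ∃ᵉ 4 λ y →
        lt₁ʳ ($ 8) ($ x) ∧ʳ (~ʳ ($ x) ($ y) ∧ʳ ~ʳ ($ 8) ($ y)))) γ~

    -- Take the least `x₀` that shares a partner `y` with some larger `x`. Descending from `x` gives
    -- `y′` below `y` similar to `x₀`; descending from `y` gives `x₁` below `x₀` similar to `y′`. So
    -- `x₁` shares `y′` with `x₀`, against minimality.
    ~-strict : ∀ {x x′ y} → x′ X.< x → x ~ y → ¬ₗ (x′ ~ y)
    ~-strict l s s′ =
      let x₀ , (x , y , l₀ , p , q) , h = X.least
            (λ e (x , y , l , s , s′) → x , y , rel-resp e ≈-refl l , s , ~-resp e ≈-refl s′)
            doubled-subset (_ , _ , _ , l , s , s′)
          y′ , k , p′ = ~-down p l₀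
          x₁ , l₁ , q′ = ~-down′ q k
      in X.<-minimal (h x₁ (x₀ , y′ , l₁ , p′ , q′)) l₁

    ~-strict′ : ∀ {x y y′} → y′ Y.< y → x ~ y → ¬ₗ (x ~ y′)
    ~-strict′ k s s′ = let _ , l , p = ~-down′ s k in ~-strict l s′ p

    ~-functional : ∀ {x y y′} → x ~ y → x ~ y′ → y ≈ y′
    ~-functional {x} {y} {y′} s s′ =
      [ (λ e → e) , [ (λ k → ⊥-elim (~-strict′ k s′ s)) , (λ k → ⊥-elim (~-strict′ k s s′)) ]′ ]′
        (Y.trichotomy y y′)

    ~-injective : ∀ {x x′ y} → x ~ y → x′ ~ y → x ≈ x′
    ~-injective {x} {x′} s s′ =
      [ (λ e → e) , [ (λ l → ⊥-elim (~-strict l s′ s)) , (λ l → ⊥-elim (~-strict l s s′)) ]′ ]′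
        (X.trichotomy x x′)

    ~-monotone : ∀ {x x′ y y′} → x ~ y → x′ ~ y′ → x′ X.< x → y′ Y.< y
    ~-monotone s s′ l = let _ , k , p = ~-down s l in rel-resp (~-functional p s′) ≈-refl k

    InDomain : El X → Set ℓ
    InDomain x = Σ[ y ∈ El Y ] x ~ y

    Total : Set ℓ
    Total = ∀ x → InDomain x

    FirstOutside : Set ℓ
    FirstOutside = Σ[ x ∈ El X ] ¬ₗ (InDomain x) × (∀ x′ → x′ X.< x → InDomain x′)

    inDomain? : ∀ x → InDomain x ⊎ ¬ₗ (InDomain x)
    inDomain? x = decide (Γ~ ▹ one ⇒ var Xᵛ) (∃ᵉ 4 λ y → ~ʳ ($ 8) ($ y)) (γ~ ▷ x)

    total-or-first : Total ⊎ FirstOutside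
    total-or-first = [ (λ p → inj₂ (first p)) , (λ n → inj₁ (all-inside n)) ]′ outside?
      where
      Outside : Set ℓ
      Outside = Σ[ x ∈ El X ] ¬ₗ (InDomain x)

      outside? : Outside ⊎ ¬ₗ Outside
      outside? = decide Γ~ (∃ᵉ 0 λ x → ¬ʳ (∃ᵉ 4 λ y → ~ʳ ($ x) ($ y))) γ~

      outside-subset : Σ[ S ∈ Obj ] Σ[ m ∈ Hom S X ] Mono m × (∀ x → x ∈ m ⇔ ¬ₗ (InDomain x))
      outside-subset = separation {Γ~} Xᵛ (elab 9 (¬ʳ (∃ᵉ 4 λ y → ~ʳ ($ 8) ($ y)))) γ~

      all-inside : ¬ₗ Outside → Total
      all-inside n x = [ (λ p → p) , (λ q → ⊥-elim (n (x , q))) ]′ (inDomain? x)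

      first : Outside → FirstOutside
      first p =
        let x , q , h = X.least (λ e n (y , s) → n (y , ~-resp (≈-sym e) ≈-refl s)) outside-subset p
        in x , q , λ x′ l → [ (λ d → d) , (λ n → ⊥-elim (X.<-minimal (h x′ n) l)) ]′ (inDomain? x′)

    ~-function : Total → Σ[ f ∈ Hom X Y ] (∀ x → x ~ f ∘ x)
    ~-function = choose-element separation {Γ~} Xᵛ Yᵛ (elab 10 (~ʳ ($ 8) ($ 9))) γ~

    ~-function-injective : ∀ (f : Hom X Y) → (∀ x → x ~ f ∘ x) → Injective f
    ~-function-injective f x~f x x′ e = ~-injective (~-resp ≈-refl e (x~f x)) (x~f x′)

    FirstMissed : Set ℓ
    FirstMissed = Σ[ y ∈ El Y ] ¬ₗ (Σ[ x ∈ El X ] x ~ y) × (∀ y′ → y′ Y.< y → Σ[ x ∈ El X ] x ~ y′)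

    segment : Total → FirstMissed → Σ[ y ∈ El Y ] Σ[ f ∈ Hom X Y ] IsSegment q₁ q₂ y f
    segment covered (y , ny , hy) = y , f , ~-function-injective f x~f , λ y′ →
      (λ k → let x , s = hy y′ k in x , ~-functional (x~f x) s) ,
      (λ (x , e) → let s = ~-resp ≈-refl e (x~f x) in
        [ (λ e → ⊥-elim (ny (x , ~-resp ≈-refl e s)))
        -- If an image lay above `y`, descending from it would make `y` similar to something.
        , [ (λ k → k) , (λ k → let x′ , _ , s′ = ~-down′ s k in ⊥-elim (ny (x′ , s′))) ]′ ]′
        (Y.trichotomy y′ y))
      where
      f   = proj₁ (~-function covered)
      x~f = proj₂ (~-function covered)

    -- The graph of an order isomorphism is a bisimulation, hence part of the largest one. As the
    -- latter is functional, two order isomorphisms coincide.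
    isomorphism-similar : (i : X ≅ Y) (j : R ≅ Q) → to i ∘ r₁ ≈ q₁ ∘ to j → to i ∘ r₂ ≈ q₂ ∘ to j →
                          ∀ x → x ~ to i ∘ x
    isomorphism-similar i j e₁ e₂ x = Equivalence.from (sim _ _) (X , id , to i ,
      (λ w →
        (λ x′ (z , p , q) → x′ , identityˡ , to j ∘ z ,
          (pullˡ (≈-sym e₁) ⨾ pullʳ p) , (pullˡ (≈-sym e₂) ⨾ pullʳ (q ⨾ identityˡ))) ,
        (λ y′ (z , p , q) → from i ∘ y′ , cancelˡ (to∘from i) , from j ∘ z ,
          iso-cancelˡ i (pullˡ e₁ ⨾ pullʳ (cancelˡ (to∘from j)) ⨾ p
            ⨾ ≈-sym (∘-congˡ identityˡ ⨾ cancelˡ (to∘from i))) ,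
          iso-cancelˡ i (pullˡ e₂ ⨾ pullʳ (cancelˡ (to∘from j)) ⨾ q ⨾ ≈-sym (∘-congˡ identityˡ)))) ,
      x , identityˡ , ≈-refl)

  module Compare {X R} {r₁ r₂ : Hom R X} (woX : IsWellOrder r₁ r₂)
                 {Y Q} {q₁ q₂ : Hom Q Y} (woY : IsWellOrder q₁ q₂)
                 {K} {k₁ : Hom K X} {k₂ : Hom K Y} (sim : IsSimilarity r₁ r₂ q₁ q₂ k₁ k₂) where
    open OneSided woX woY sim public
    private
      -- Bisimulation is symmetric in the two orders, so `K` with its legs exchanged lets every
      -- one-sided result be used in the other direction.
      mis : IsSimilarity q₁ q₂ r₁ r₂ k₂ k₁
      mis y x = mk⇔ (λ p → similar-sym (Equivalence.to (sim x y) (rel-sym p)))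
                    (λ s → rel-sym (Equivalence.from (sim x y) (similar-sym s)))

      module Op = OneSided woY woX mis

    -- Everything below `x` and below `y` is already matched, so adding the pair of `x` and `y` to
    -- the similarity relation gives a bisimulation again. By maximality the pair was there before.
    cannot-both-be-partial : FirstOutside → ¬ₗ Op.FirstOutside
    cannot-both-be-partial (x , nx , hx) (y , ny , hy) = nx (y , x~y)
      where
      Joined : El X → El Y → Set ℓ
      Joined a b = a ~ b ⊎ ((a ≈ x) × (b ≈ y))

      Joined-resp : ∀ {a a′ b b′} → a ≈ a′ → b ≈ b′ → Joined a b → Joined a′ b′
      Joined-resp e f = [ (λ s → inj₁ (~-resp e f s)) , (λ (p , q) → inj₂ ((≈-sym e ⨾ p) , (≈-sym f ⨾ q))) ]′

      Joined-subset : Σ[ S ∈ Obj ] Σ[ m ∈ Hom S (X ×ₒ Y) ] Mono m × (∀ w → w ∈ m ⇔ Joined (π₁ ∘ w) (π₂ ∘ w))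
      Joined-subset = separation
        {span Γ~ Xᵛ Yᵛ ▹ one ⇒ var (there (there (there Xᵛ))) ▹ one ⇒ var (there (there (there (there Yᵛ))))}
        (there (there (there (there here))))
        (elab 14 (~ʳ ($ 9 ∙ $ 13) ($ 10 ∙ $ 13) ∨ʳ ($ 9 ∙ $ 13 ≐ʳ $ 11 ∧ʳ $ 10 ∙ $ 13 ≐ʳ $ 12)))
        (γ~ ▷ X ×ₒ Y ▷ π₁ ▷ π₂ ▷ x ▷ y)

      S = proj₁ Joined-subset
      m = proj₁ (proj₂ Joined-subset)

      g₁ : Hom S X
      g₁ = π₁ ∘ m

      g₂ : Hom S Y
      g₂ = π₂ ∘ m

      Joined⇔ : ∀ a b → Rel g₁ g₂ a b ⇔ Joined a b
      Joined⇔ = subset-rel {P = Joined} Joined-resp (proj₂ (proj₂ (proj₂ Joined-subset)))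

      Joined-down : ∀ {a b x′} → Joined a b → x′ X.< a → Σ[ y′ ∈ El Y ] (y′ Y.< b) × (x′ ~ y′)
      Joined-down (inj₁ s) l = ~-down s l
      Joined-down (inj₂ (p , q)) l =
        let y′ , s = hx _ (rel-resp ≈-refl p l)
        in y′ , [ (λ e → ⊥-elim (ny (_ , rel-sym (~-resp ≈-refl e s))))
                , [ (λ k → rel-resp ≈-refl (≈-sym q) k)
                  , (λ k → let x″ , _ , s′ = ~-down′ s k in ⊥-elim (ny (x″ , rel-sym s′))) ]′ ]′
                (Y.trichotomy y′ y) , s

      Joined-down′ : ∀ {a b y′} → Joined a b → y′ Y.< b → Σ[ x′ ∈ El X ] (x′ X.< a) × (x′ ~ y′)
      Joined-down′ (inj₁ s) k = ~-down′ s k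
      Joined-down′ (inj₂ (p , q)) k =
        let x′ , s₀ = hy _ (rel-resp ≈-refl q k)
            s = rel-sym s₀
        in x′ , [ (λ e → ⊥-elim (nx (_ , ~-resp e ≈-refl s)))
                , [ (λ l → rel-resp ≈-refl (≈-sym p) l)
                  , (λ l → let y″ , _ , s′ = ~-down s l in ⊥-elim (nx (y″ , s′))) ]′ ]′
                (X.trichotomy x′ x) , s

      bisimulation : Bisimulation r₁ r₂ q₁ q₂ g₁ g₂
      bisimulation w =
        (λ x′ l → let y′ , k , s = Joined-down (Equivalence.to (Joined⇔ _ _) (w , ≈-refl , ≈-refl)) l
                      v , e , f = Equivalence.from (Joined⇔ _ _) (inj₁ s)
                  in v , e , rel-resp (≈-sym f) ≈-refl k) ,
        (λ y′ k → let x′ , l , s = Joined-down′ (Equivalence.to (Joined⇔ _ _) (w , ≈-refl , ≈-refl)) k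
                      v , e , f = Equivalence.from (Joined⇔ _ _) (inj₁ s)
                  in v , f , rel-resp (≈-sym e) ≈-refl l)

      x~y : x ~ y
      x~y = Equivalence.from (sim x y) (S , g₁ , g₂ , bisimulation , Equivalence.from (Joined⇔ x y) (inj₂ (≈-refl , ≈-refl)))

    OrderIso : Set ℓ
    OrderIso = Σ[ i ∈ X ≅ Y ] (∀ x → x ~ to i ∘ x)

    order-iso : Total → Op.Total → OrderIso
    order-iso covered onto =
      let f , x~f = ~-function covered
          i , e = bijective⇒iso f (~-function-injective f x~f) λ y →
            let x , s = onto y in x , ~-functional (x~f x) (rel-sym s)
      in i , λ x → ~-resp ≈-refl (∘-congʳ (≈-sym e)) (x~f x)

    compare : OrderIso ⊎ ((Σ[ y ∈ El Y ] Σ[ f ∈ Hom X Y ] IsSegment q₁ q₂ y f) ⊎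
                          (Σ[ x ∈ El X ] Σ[ g ∈ Hom Y X ] IsSegment r₁ r₂ x g))
    compare =
      [ (λ covered → [ (λ onto → inj₁ (order-iso covered onto)) ,
                       (λ q → inj₂ (inj₁ (segment covered (flip-first′ q)))) ]′ Op.total-or-first)
      , (λ p → [ (λ onto → inj₂ (inj₂ (Op.segment onto (flip-first p)))) ,
                 (λ q → ⊥-elim (cannot-both-be-partial p q)) ]′ Op.total-or-first) ]′ total-or-first
      where
      flip-first : FirstOutside → Op.FirstMissed
      flip-first (x , n , h) = x , (λ (y , s) → n (y , rel-sym s)) ,
        λ x′ l → let y , s = h x′ l in y , rel-sym s
      flip-first′ : Op.FirstOutside → FirstMissed
      flip-first′ (y , n , h) = y , (λ (x , s) → n (x , rel-sym s)) ,
        λ y′ l → let x , s = h y′ l in x , rel-sym s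

-- Least well-orders and their uniqueness

segmentʳ : (X R r₁ r₂ x Z z : ℕ) → Raw
segmentʳ X R r₁ r₂ x Z z =
     (∀ᵉ Z λ a → ∀ᵉ Z λ b → $ z ∙ $ a ≐ʳ $ z ∙ $ b ⊃ʳ $ a ≐ʳ $ b)
  ∧ʳ (∀ᵉ X λ y → (relʳ R r₁ r₂ ($ y) ($ x) ⊃ʳ inʳ Z z ($ y))
              ∧ʳ (inʳ Z z ($ y) ⊃ʳ relʳ R r₁ r₂ ($ y) ($ x)))

orderTel : ∀ {Γ} → Tel Γ (Γ ▹order)
orderTel = [] ▸ ob ▸ ob ▸ var here ⇒ var (there here) ▸ var (there here) ⇒ var (there (there here))

opaque
  wellOrderᶠ : ∀ {Γ} → Formula (Γ ▹order)
  wellOrderᶠ = elab 4 (wellOrderʳ 0 1 2 3)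

_▹point _▹segment : Ctx → Ctx
Γ ▹point   = Γ ▹order ▹ one ⇒ var (there (there (there here)))
Γ ▹segment = leg (Γ ▹point) (there (there (there (there here))))

opaque
  segmentᶠ : ∀ {Γ} → Formula (Γ ▹segment)
  segmentᶠ = elab 7 (segmentʳ 0 1 2 3 4 5 6)

module _ {Γ : Ctx} (φ : Formula (Γ ▹ ob)) where

  onCarrier : Ren (Γ ▹ ob) (Γ ▹order)
  onCarrier = ↑ (↑ (↑ (↑ idᴿ))) ,ob there (there (there here))

  onSegment : Ren (Γ ▹ ob) (Γ ▹segment)
  onSegment = ↑ (↑ (↑ (↑ (↑ (↑ (↑ idᴿ)))))) ,ob there here

  opaque
    holdsBelow : Formula (Γ ▹point)
    holdsBelow = ex ob (ex (var here ⇒ var (there (there (there (there (there here))))))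
      (segmentᶠ ∧ ren onSegment φ))

    leastOrder : Formula (Γ ▹order)
    leastOrder = wellOrderᶠ
      ∧ (ren onCarrier φ ∧ all (one ⇒ var (there (there (there here)))) (holdsBelow ⊃ ⊥ᶠ))

module LeastOrders {C : Category ℓ} (E : ETCS C) (separation : Schemas.FullSeparation E) where
  open Elements E
  open Families E
  open Orders E
  open Comparison E separation

  segment-∘ : ∀ {X R r₁ r₂} → IsWellOrder {X} {R} r₁ r₂ →
              ∀ {Z P} {z : Hom Z X} {q₁ q₂ : Hom P Z} →
              (∀ a b → Rel q₁ q₂ a b ⇔ Rel r₁ r₂ (z ∘ a) (z ∘ b)) → ∀ {x} → IsSegment r₁ r₂ x z →
              ∀ {b W} {w : Hom W Z} → IsSegment q₁ q₂ b w → IsSegment r₁ r₂ (z ∘ b) (z ∘ w)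
  segment-∘ wo {z = z} induced {x} (z-inj , z-spec) {b} {W} {w} (w-inj , w-spec) =
    (λ c d e → w-inj c d (z-inj _ _ (≈-sym assoc ⨾ e ⨾ assoc))) , λ x′ →
    (λ l → let a , za = proj₁ (z-spec x′) (X.trans l (proj₂ (z-spec _) (b , ≈-refl)))
               c , wc = proj₁ (w-spec a) (Equivalence.from (induced a b) (rel-resp (≈-sym za) ≈-refl l))
           in c , (pullʳ wc ⨾ za)) ,
    (λ (c , e) → rel-resp (≈-sym assoc ⨾ e) ≈-refl
      (Equivalence.to (induced _ b) (proj₂ (w-spec (w ∘ c)) (c , ≈-refl))))
    where module X = WellOrder wo

  module Induced {X R} {r₁ r₂ : Hom R X} (wo : IsWellOrder r₁ r₂) {Z} (z : Hom Z X) (z-inj : Injective z) where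
    private module X = WellOrder wo
    open Pullback (pullback ⟨ r₁ , r₂ ⟩ ⟨ z ∘ π₁ , z ∘ π₂ ⟩)

    q₁ q₂ : Hom P Z
    q₁ = π₁ ∘ p₂
    q₂ = π₂ ∘ p₂

    leg₁ : z ∘ q₁ ≈ r₁ ∘ p₁
    leg₁ = ≈-sym assoc ⨾ ∘-congʳ (≈-sym π₁-⟨⟩) ⨾ assoc ⨾ ∘-congˡ (≈-sym commutes) ⨾ pullˡ π₁-⟨⟩

    leg₂ : z ∘ q₂ ≈ r₂ ∘ p₁
    leg₂ = ≈-sym assoc ⨾ ∘-congʳ (≈-sym π₂-⟨⟩) ⨾ assoc ⨾ ∘-congˡ (≈-sym commutes) ⨾ pullˡ π₂-⟨⟩

    induced : ∀ a b → Rel q₁ q₂ a b ⇔ Rel r₁ r₂ (z ∘ a) (z ∘ b)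
    induced a b = mk⇔
      (λ (w , e , f) → p₁ ∘ w , (pullˡ (≈-sym leg₁) ⨾ pullʳ e) , (pullˡ (≈-sym leg₂) ⨾ pullʳ f))
      (λ (t , e , f) →
        let sq : ⟨ r₁ , r₂ ⟩ ∘ t ≈ ⟨ z ∘ π₁ , z ∘ π₂ ⟩ ∘ ⟨ a , b ⟩
            sq = ⟨⟩-∘ ⨾ ⟨⟩-cong (e ⨾ ≈-sym (pullʳ π₁-⟨⟩)) (f ⨾ ≈-sym (pullʳ π₂-⟨⟩)) ⨾ ≈-sym ⟨⟩-∘
        in universal t ⟨ a , b ⟩ sq ,
           (pullʳ (p₂-universal sq) ⨾ π₁-⟨⟩) , (pullʳ (p₂-universal sq) ⨾ π₂-⟨⟩))

    induced-wellOrder : IsWellOrder q₁ q₂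
    induced-wellOrder =
      (λ x l → X.irrefl (Equivalence.to (induced x x) l)) ,
      (λ x y w l k → Equivalence.from (induced x w)
        (X.trans (Equivalence.to (induced x y) l) (Equivalence.to (induced y w) k))) ,
      (λ S m s₀ → let s , h = proj₁ (proj₂ (proj₂ wo)) S (z ∘ m) s₀ in s , λ t →
        [ (λ e → inj₁ (z-inj _ _ (≈-sym assoc ⨾ e ⨾ assoc)))
        , (λ l → inj₂ (Equivalence.from (induced _ _) (rel-resp assoc assoc l))) ]′ (h t)) ,
      (λ v w e f →
        let p₂≈ = ×-unique (≈-sym assoc ⨾ e ⨾ assoc) (≈-sym assoc ⨾ f ⨾ assoc)
        in unique (X.jointly-mono
          (pullˡ (≈-sym leg₁) ⨾ pullʳ e ⨾ ≈-sym (pullˡ (≈-sym leg₁) ⨾ assoc))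
          (pullˡ (≈-sym leg₂) ⨾ pullʳ f ⨾ ≈-sym (pullˡ (≈-sym leg₂) ⨾ assoc))) p₂≈)

  module _ {Γ} (φ : Formula (Γ ▹ ob)) (γ : Env Γ) where

    Below : ∀ {X R} (r₁ r₂ : Hom R X) → El X → Set ℓ
    Below {X} r₁ r₂ x = Σ[ Z ∈ Obj ] Σ[ z ∈ Hom Z X ] IsSegment r₁ r₂ x z × (γ ▷ Z ⊨ φ)

    Least : ∀ {X R} (r₁ r₂ : Hom R X) → Set ℓ
    Least {X} r₁ r₂ = IsWellOrder r₁ r₂ × ((γ ▷ X ⊨ φ) × (∀ x → ¬ₗ (Below r₁ r₂ x)))

    private
      order : ∀ {X R} (r₁ r₂ : Hom R X) → Env (Γ ▹order)
      order {X} {R} r₁ r₂ = γ ▷ X ▷ R ▷ r₁ ▷ r₂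

      orderSegment : ∀ {X R} (r₁ r₂ : Hom R X) → El X → ∀ {Z} → Hom Z X → Env (Γ ▹segment)
      orderSegment r₁ r₂ x {Z} z = order r₁ r₂ ▷ x ▷ Z ▷ z

    module _ {X R} {r₁ r₂ : Hom R X} where

      sim-carrier : Sim (onCarrier φ) (γ ▷ X) (order r₁ r₂)
      sim-carrier = sim-ob s ≅-refl
        where
        s : Sim (↑ (↑ (↑ (↑ idᴿ)))) γ (order r₁ r₂)
        s = sim-↑ (sim-↑ (sim-↑ (sim-↑ sim-id)))

      sim-segment : ∀ {x Z} {z : Hom Z X} → Sim (onSegment φ) (γ ▷ Z) (orderSegment r₁ r₂ x z)
      sim-segment {x} {Z} {z} = sim-ob s ≅-refl
        where
        s : Sim (↑ (↑ (↑ (↑ (↑ (↑ (↑ idᴿ))))))) γ (orderSegment r₁ r₂ x z)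
        s = sim-↑ (sim-↑ (sim-↑ (sim-↑ (sim-↑ (sim-↑ (sim-↑ sim-id))))))

      opaque
        unfolding segmentᶠ

        segment⊨ : ∀ {x Z} {z : Hom Z X} →
          (orderSegment r₁ r₂ x z ⊨ segmentᶠ) ⇔ IsSegment r₁ r₂ x z
        segment⊨ = mk⇔ (λ s → s) (λ s → s)

      opaque
        unfolding holdsBelow

        below⇒ : ∀ x → order r₁ r₂ ▷ x ⊨ holdsBelow φ → Below r₁ r₂ x
        below⇒ x (Z , z , seg , p) = Z , z , Equivalence.to segment⊨ seg , sim-⊨⁻ sim-segment φ p

        below⇐ : ∀ x → Below r₁ r₂ x → order r₁ r₂ ▷ x ⊨ holdsBelow φ
        below⇐ x (Z , z , seg , p) = Z , z , Equivalence.from segment⊨ seg , sim-⊨ sim-segment φ p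

      opaque
        unfolding wellOrderᶠ

        wellOrder⊨ : (order r₁ r₂ ⊨ wellOrderᶠ) ⇔ IsWellOrder r₁ r₂
        wellOrder⊨ = mk⇔ (λ w → w) (λ w → w)

      opaque
        unfolding leastOrder

        least⇒ : order r₁ r₂ ⊨ leastOrder φ → Least r₁ r₂
        least⇒ (wo , p , h) = Equivalence.to wellOrder⊨ wo , sim-⊨⁻ sim-carrier φ p , λ x b → h x (below⇐ x b)

        least⇐ : Least r₁ r₂ → order r₁ r₂ ⊨ leastOrder φ
        least⇐ (wo , p , h) = Equivalence.from wellOrder⊨ wo , sim-⊨ sim-carrier φ p , λ x b → h x (below⇒ x b)

    -- If some proper segment of a Zermelo order on `X` satisfies `φ`, take the one at the least
    -- such point. A segment of it is a segment of `X` at an earlier point, where `φ` fails.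
    least-exists : Σ[ X ∈ Obj ] (γ ▷ X ⊨ φ) →
                   Σ[ X ∈ Obj ] Σ[ R ∈ Obj ] Σ[ r₁ ∈ Hom R X ] Σ[ r₂ ∈ Hom R X ] Least r₁ r₂
    least-exists (X , p) = [ (λ (x , b) → shrink x (below⇒ x b)) ,
      (λ n → X , R , r₁ , r₂ , wo , p , λ x b → ⊥-elim₀ (n (x , below⇐ x b))) ]′ below?
      where
      ordered = Zermelo.well-orderable E separation X
      R  = proj₁ ordered
      r₁ = proj₁ (proj₂ ordered)
      r₂ = proj₁ (proj₂ (proj₂ ordered))
      wo = proj₂ (proj₂ (proj₂ ordered))

      below? = excluded-middle (ex (one ⇒ var (there (there (there here)))) (holdsBelow φ)) (order r₁ r₂)

      shrink : ∀ x → Below r₁ r₂ x →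
               Σ[ X ∈ Obj ] Σ[ R ∈ Obj ] Σ[ r₁ ∈ Hom R X ] Σ[ r₂ ∈ Hom R X ] Least r₁ r₂
      shrink x b = Z , _ , I.q₁ , I.q₂ , I.induced-wellOrder , pZ , λ a (W , w , segw , pW) →
        WellOrder.<-minimal wo
          (h (z ∘ a) (W , z ∘ w , segment-∘ wo I.induced seg segw , pW))
          (proj₂ (proj₂ seg (z ∘ a)) (a , ≈-refl))
        where
        below-subset : Σ[ S ∈ Obj ] Σ[ m ∈ Hom S X ] Mono m × (∀ x → x ∈ m ⇔ Below r₁ r₂ x)
        below-subset =
          let S , m , mono , spec = separation (there (there (there here))) (holdsBelow φ) (order r₁ r₂)
          in S , m , mono , λ x → mk⇔ (λ q → below⇒ x (Equivalence.to (spec x) q))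
                                      (λ q → Equivalence.from (spec x) (below⇐ x q))
        first = WellOrder.least wo {Below r₁ r₂}
          (λ e (Z , z , (inj , seg) , p) → Z , z , (inj , λ x′ →
            (λ l → proj₁ (seg x′) (rel-resp ≈-refl (≈-sym e) l)) ,
            (λ m → rel-resp ≈-refl e (proj₂ (seg x′) m))) , p) below-subset (x , b)
        x₀  = proj₁ first
        Z   = proj₁ (proj₁ (proj₂ first))
        z   = proj₁ (proj₂ (proj₁ (proj₂ first)))
        seg = proj₁ (proj₂ (proj₂ (proj₁ (proj₂ first))))
        pZ  = proj₂ (proj₂ (proj₂ (proj₁ (proj₂ first))))
        h   = proj₂ (proj₂ first)
        module I = Induced wo z (proj₁ seg)

    module _ {X R} {r₁ r₂ : Hom R X} (leastX : Least r₁ r₂)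
             {Y Q} {q₁ q₂ : Hom Q Y} (leastY : Least q₁ q₂) where
      private
        sims = similarity r₁ r₂ q₁ q₂
        module Cmp = Compare (proj₁ leastX) (proj₁ leastY) (proj₂ (proj₂ (proj₂ sims)))
        module Y = WellOrder (proj₁ leastY)

      -- Were `X` a proper segment of `Y`, then `X` itself would witness `φ` below a point of `Y`,
      -- against the minimality of `Y`; likewise with the roles exchanged.
      least-iso : Cmp.OrderIso
      least-iso = [ (λ i → i) , [
        (λ (y , f , seg) → ⊥-elim (proj₂ (proj₂ leastY) y (X , f , seg , proj₁ (proj₂ leastX)))) ,
        (λ (x , g , seg) → ⊥-elim (proj₂ (proj₂ leastX) x (Y , g , seg , proj₁ (proj₂ leastY)))) ]′ ]′
        Cmp.compare

      private
        i   = proj₁ least-iso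
        x~i = proj₂ least-iso

        ⟨⟩-injective : ∀ {A B D W} {f : Hom D A} {g : Hom D B} {v w : Hom W D} →
          ⟨ f , g ⟩ ∘ v ≈ ⟨ f , g ⟩ ∘ w → (f ∘ v ≈ f ∘ w) × (g ∘ v ≈ g ∘ w)
        ⟨⟩-injective e = (∘-congʳ (≈-sym π₁-⟨⟩) ⨾ assoc ⨾ ∘-congˡ e ⨾ pullˡ π₁-⟨⟩) ,
                         (∘-congʳ (≈-sym π₂-⟨⟩) ⨾ assoc ⨾ ∘-congˡ e ⨾ pullˡ π₂-⟨⟩)

        -- Both relations embed in the square of `Y`, the first through `i`; they have the same
        -- image because similarity preserves the order both ways.
        relation-iso : Σ[ j ∈ R ≅ Q ] ⟨ q₁ , q₂ ⟩ ∘ to j ≈ ⟨ to i ∘ r₁ , to i ∘ r₂ ⟩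
        relation-iso = sameImage⇒iso
          (λ z w e → let e₁ , e₂ = ⟨⟩-injective e in Cmp.X.jointly-mono
            (iso-cancelˡ i (≈-sym assoc ⨾ e₁ ⨾ assoc)) (iso-cancelˡ i (≈-sym assoc ⨾ e₂ ⨾ assoc)))
          (λ z w e → let e₁ , e₂ = ⟨⟩-injective e in Y.jointly-mono e₁ e₂)
          (λ z → let t , e₁ , e₂ = Cmp.~-monotone (x~i (r₂ ∘ z)) (x~i (r₁ ∘ z)) (z , ≈-refl , ≈-refl)
                 in t , (⟨⟩-∘ ⨾ ⟨⟩-cong (e₁ ⨾ ≈-sym assoc) (e₂ ⨾ ≈-sym assoc) ⨾ ≈-sym ⟨⟩-∘))
          (λ t → let x~ : ∀ y → from i ∘ y Cmp.~ y
                     x~ y = Cmp.~-resp ≈-refl (cancelˡ (to∘from i)) (x~i (from i ∘ y))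
                     x , (z , e₁ , e₂) , s = Cmp.~-down′ (x~ (q₂ ∘ t)) (t , ≈-refl , ≈-refl)
                 in z , (⟨⟩-∘ ⨾ ⟨⟩-cong
                      (assoc ⨾ ∘-congˡ (e₁ ⨾ Cmp.~-injective s (x~ (q₁ ∘ t))) ⨾ cancelˡ (to∘from i))
                      (assoc ⨾ ∘-congˡ e₂ ⨾ cancelˡ (to∘from i)) ⨾ ≈-sym ⟨⟩-∘))

        j : R ≅ Q
        j = proj₁ relation-iso

        square₁ : to i ∘ r₁ ≈ q₁ ∘ to j
        square₁ = ≈-sym π₁-⟨⟩ ⨾ ∘-congˡ (≈-sym (proj₂ relation-iso)) ⨾ pullˡ π₁-⟨⟩

        square₂ : to i ∘ r₂ ≈ q₂ ∘ to j
        square₂ = ≈-sym π₂-⟨⟩ ⨾ ∘-congˡ (≈-sym (proj₂ relation-iso)) ⨾ pullˡ π₂-⟨⟩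

        -- Any competing isomorphism lies in the similarity relation, whose functionality settles
        -- the carriers; joint monicity of `q₁` and `q₂` settles the relations.
        agree : (i′ : X ≅ Y) (j′ : R ≅ Q) → to i′ ∘ r₁ ≈ q₁ ∘ to j′ → to i′ ∘ r₂ ≈ q₂ ∘ to j′ →
                (to i ≈ to i′) × (to j ≈ to j′)
        agree i′ j′ e₁ e₂ = i≈i′ , generator _ _ λ z → Y.jointly-mono
          (pullˡ (≈-sym square₁ ⨾ ∘-congʳ i≈i′ ⨾ e₁) ⨾ assoc)
          (pullˡ (≈-sym square₂ ⨾ ∘-congʳ i≈i′ ⨾ e₂) ⨾ assoc)
          where
          i≈i′ : to i ≈ to i′
          i≈i′ = generator _ _ λ x →
            Cmp.~-functional (x~i x) (Cmp.isomorphism-similar i′ j′ e₁ e₂ x)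

        instX : Inst γ orderTel
        instX = [] ▷ X ▷ R ▷ r₁ ▷ r₂

        instY : Inst γ orderTel
        instY = [] ▷ Y ▷ Q ▷ q₁ ▷ q₂

      unique-isomorphism : Σ[ α ∈ instX ≅ᵢ instY ] (∀ β → α ≈ᵢ β)
      unique-isomorphism = (((([] ▸ob i) ▸ob j) ▸ar square₁) ▸ar square₂) , unique
        where
        unique : ∀ β → (((([] ▸ob i) ▸ob j) ▸ar square₁) ▸ar square₂) ≈ᵢ β
        unique (((([] ▸ob i′) ▸ob j′) ▸ar e₁) ▸ar e₂) (there (there here))         = proj₂ (agree i′ j′ e₁ e₂)
        unique (((([] ▸ob i′) ▸ob j′) ▸ar e₁) ▸ar e₂) (there (there (there here))) = proj₁ (agree i′ j′ e₁ e₂)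
        -- On the objects of `Γ` both isomorphisms are identities.
        unique (((([] ▸ob i′) ▸ob j′) ▸ar e₁) ▸ar e₂) (there (there (there (there v)))) = ≈-refl

    least-instance : Σ[ X ∈ Obj ] (γ ▷ X ⊨ φ) → Σ[ i ∈ Inst γ orderTel ] (γ ⊕ i ⊨ leastOrder φ)
    least-instance p = fromLeast (least-exists p)
      where
      fromLeast : Σ[ X ∈ Obj ] Σ[ R ∈ Obj ] Σ[ r₁ ∈ Hom R X ] Σ[ r₂ ∈ Hom R X ] Least r₁ r₂ →
                  Σ[ i ∈ Inst γ orderTel ] (γ ⊕ i ⊨ leastOrder φ)
      fromLeast (X , R , r₁ , r₂ , least) = ([] ▷ X ▷ R ▷ r₁ ▷ r₂) , least⇐ least

    unique-instance : ∀ (i j : Inst γ orderTel) → γ ⊕ i ⊨ leastOrder φ → γ ⊕ j ⊨ leastOrder φ →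
                      Σ[ α ∈ i ≅ᵢ j ] (∀ β → α ≈ᵢ β)
    unique-instance ([] ▷ X ▷ R ▷ r₁ ▷ r₂) ([] ▷ Y ▷ Q ▷ q₁ ▷ q₂) p q =
      unique-isomorphism (least⇒ p) (least⇒ q)

    leastOrder-carrier : ∀ {X R} {r₁ r₂ : Hom R X} → γ ▷ X ▷ R ▷ r₁ ▷ r₂ ⊨ leastOrder φ → γ ▷ X ⊨ φ
    leastOrder-carrier p = proj₁ (proj₂ (least⇒ p))

-- From replacement to collection

module FromReplacement {C : Category ℓ} (E : ETCS C) (replacement : Schemas.ReplacementOfContexts E) where
  open Elements E
  open Families E
  open LeastOrders E (replacement⇒separation replacement)

  module _ {Γ} (U : ObVar Γ) (φ : Formula (Γ ▹ one ⇒ var U ▹ ob)) (γ : Env Γ) where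
    private module Sl = Interpretation (Slice C (lookupOb γ U)) (1/ C (lookupOb γ U))

    least-family : (∀ u → Σ[ X ∈ Obj ] (γ ▷ u ▷ X ⊨ φ)) →
      Σ[ i ∈ Sl.Inst (generic γ U) orderTel ] (∀ u → (γ ▷ u) ⊕ fibreInst γ U u i ⊨ leastOrder φ)
    least-family h = replacement U orderTel (leastOrder φ) γ λ u →
      least-instance φ (γ ▷ u) (h u) , unique-instance φ (γ ▷ u)

    carrier : Σ[ i ∈ Sl.Inst (generic γ U) orderTel ] (∀ u → (γ ▷ u) ⊕ fibreInst γ U u i ⊨ leastOrder φ) →
              Σ[ A ∈ _ ] IsFamily U φ γ A
    carrier ((Sl.[] Sl.▷ A Sl.▷ _ Sl.▷ _ Sl.▷ _) , good) = A , λ u → leastOrder-carrier φ (γ ▷ u) (good u)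

  replacement⇒strong : StrongCollection
  replacement⇒strong U φ γ h = carrier U φ γ (least-family U φ γ h)

proposition7p7 : ∀ {ℓ : Level} (C : Category ℓ) (E : ETCS C) →
    let open Schemas E in
    (ReplacementOfContexts ⇔ CollectionOfSets) ×
    (CollectionOfSets ⇔ (FullSeparation × CollectionOfSets × CollectionOfFunctions))
proposition7p7 C E = mk⇔ sets-of-replacement replacement-of-sets , mk⇔ all-of-sets sets-of-all
  where
  open Schemas E
  open Families E
  open FromCollection E

  sets-of-replacement : ReplacementOfContexts → CollectionOfSets
  sets-of-replacement r = strong⇒collection (FromReplacement.replacement⇒strong E r)

  separation-of-sets : CollectionOfSets → FullSeparation
  separation-of-sets c = strong⇒separation (collection⇒strong c)

  replacement-of-sets : CollectionOfSets → ReplacementOfContexts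
  replacement-of-sets c = strong⇒replacement (collection⇒strong c) (separation-of-sets c)

  all-of-sets : CollectionOfSets → FullSeparation × CollectionOfSets × CollectionOfFunctions
  all-of-sets c = separation-of-sets c , c , separation⇒functions (separation-of-sets c)

  sets-of-all : FullSeparation × CollectionOfSets × CollectionOfFunctions → CollectionOfSets
  sets-of-all (_ , c , _) = c
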